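{- Let $s,t\ge 1$ be coprime integers. Then $$\frac{\sum_{\lambda\in \mathcal{D}_s\cap \mathcal{D}_t} |\mathrm{Stab}_{H_{s,t}}(\lambda)|^{ -1}\cdot |\lambda|}{\sum_{\lambda\in \mathcal{D}_s\cap \mathcal{D}_t} |\mathrm{Stab}_{H_{s,t}}(\lambda)|^{ -1}} = \begin{cases}\frac{1}{24}(s-1)(t^2-1) & \text{if } t\equiv1\pmod 2,\\ \frac{1}{24}(s-1)(t^2+2) & \text{if } t\equiv0\pmod 2,\end{cases}$$ where the (finite) sums run over all self-conjugate partitions that are simultaneously $s$-cores and $t$-cores, and the (finite) stabilizers are taken with respect to the action of the group $H_{s,t}$ on $\mathcal{D}_s$.
   Context: A partition is an infinite weakly decreasing sequence $\lambda=(\lambda_1,\lambda_2,\ldots)$ of nonnegative integers with finite size $|\lambda|=\lambda_1+\lambda_2+\cdots$. Its Young diagram is $[\lambda]=\{(r,c)\in\mathbb{Z}_{>0}^2 : c\le\lambda_r\}$, its conjugate $\overline{\lambda}$ is given by $\overline{\lambda}_r=\#\{c\in\mathbb{Z}_{>0}: r\le\lambda_c\}$ ($\lambda$ is self-conjugate if $\lambda=\overline\lambda$), and the hook length at $(r,c)\in[\lambda]$ is $1+(\lambda_r-r)+(\overline{\lambda}_c-c)$. A partition is an $s$-core if it has no hook of length $s$; $\mathcal{C}_s$ is the set of $s$-cores and $\mathcal{D}_s\subseteq\mathcal{C}_s$ the set of self-conjugate $s$-cores. For coprime $s,t$, the set $\mathcal{C}_s\cap\mathcal{C}_t$ is finite.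 Beta-sets and $s$-sets: the beta-set of $\lambda$ is $B^\lambda=\{\lambda_i-i : i\ge1\}\subset\mathbb{Z}$; $\lambda$ is an $s$-core iff $B^\lambda-s\subseteq B^\lambda$. For an $s$-core $\lambda$, its $s$-set is $\mathcal{S}_s(\lambda)=(B^\lambda+s)\setminus B^\lambda$; $\lambda\mapsto\mathcal{S}_s(\lambda)$ is a bijection from $\mathcal{C}_s$ to the collection of all sets of $s$ integers that are pairwise incongruent modulo $s$ and have sum $\binom{s}{2}$. An $s$-core $\lambda$ is self-conjugate iff $\mathcal{S}_s(\lambda)=s-1-\mathcal{S}_s(\lambda)$. The group $H_{s,t}$: the group (under composition) of permutations $f:\mathbb{Z}\to\mathbb{Z}$ such that $f(m+s)=f(m)+s$ for all $m$; $\sum_{i=0}^{s-1}f(i)=\binom{s}{2}$; $f(m)\equiv m\pmod t$ for all $m$; and $f(-1-m)=-1-f(m)$ for all $m$. It acts on $\mathcal{D}_s$ by letting $f\lambda$ be the self-conjugate $s$-core with $\mathcal{S}_s(f\lambda)=f(\mathcal{S}_s(\lambda))$ (equivalently $B^{f\lambda}=f(B^\lambda)$). -}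

module Defs where

open import Level using (0ℓ)
open import Data.Fin.Base as Fin using (Fin; toℕ)
open import Data.Fin.Properties using (nonZeroIndex; toℕ-inject₁; toℕ-fromℕ)
open import Data.Integer.Base as ℤ using (ℤ; +_; -1ℤ; 1ℤ)
import Data.Integer.Properties as ℤ
open import Data.Integer.Divisibility using () renaming (_∣_ to _∣ℤ_)
open import Data.List.Base as List using (List; length; filter; upTo; map)
open import Data.Nat.Base as ℕ using (ℕ; zero; suc; z≤n)
import Data.Nat.Properties as ℕ
open import Data.Nat.Combinatorics using (_C_; nC1≡n; nCk+nC[k+1]≡[n+1]C[k+1])
import Data.Nat.Divisibility as ℕ∣
open import Data.Product.Base using (Σ; Σ-syntax; ∃-syntax; _×_; _,_; proj₁; proj₂)
open import Data.Rational.Base as ℚ using (ℚ; _÷_)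
import Data.Rational.Properties as ℚ
open import Function.Bundles using (Inverse; _↔_)
open import Function.Construct.Identity using (↔-id)
open import Relation.Binary.Bundles using (Setoid)
import Relation.Binary.Construct.On as On
open import Relation.Binary.PropositionalEquality
  using (_≡_; _≢_; refl; sym; trans; cong; cong₂; subst; _→-setoid_)
import Relation.Binary.PropositionalEquality.Properties as ≡
open import Relation.Nullary using (¬_)
open import Relation.Unary using (Pred; _∈_; _∩_; _≐_)

open import Algebra.Properties.CommutativeMonoid.Sum ℤ.+-0-commutativeMonoid
  using () renaming (sum to ∑ℤ; sum-init-last to ∑ℤ-init-last; sum-cong-≗ to ∑ℤ-cong)
open import Algebra.Properties.CommutativeMonoid.Sum ℚ.+-0-commutativeMonoid
  using () renaming (sum to ∑ℚ)

-- All sets counted or summed over here consist of functions with side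
-- conditions, so they are setoids whose equality is pointwise equality of the
-- underlying functions.  A complete enumeration without repetition:

record Finite (S : Setoid 0ℓ 0ℓ) : Set where
  field
    card        : ℕ
    enumeration : Inverse (≡.setoid (Fin card)) S

  element : Fin card → Setoid.Carrier S
  element = Inverse.to enumeration

open Finite public

inhabited⇒nonZero : ∀ {S} (fin : Finite S) → Setoid.Carrier S → ℕ.NonZero (card fin)
inhabited⇒nonZero fin x = nonZeroIndex (Inverse.from (enumeration fin) x)

subsetoid : (S : Setoid 0ℓ 0ℓ) → Pred (Setoid.Carrier S) 0ℓ → Setoid 0ℓ 0ℓ
subsetoid S P = On.setoid {B = Σ (Setoid.Carrier S) P} S proj₁

-- Rows and columns are indexed from 0: `part μ r` is the (r+1)-st part of μ.
-- Finite size is witnessed by a point beyond which all parts vanish; `size` and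
-- `conj` do not depend on its choice.

record Partition : Set where
  field
    part       : ℕ → ℕ
    decreasing : ∀ {i j} → i ℕ.≤ j → part j ℕ.≤ part i
    bound      : ℕ
    vanishing  : ∀ {i} → bound ℕ.≤ i → part i ≡ 0

open Partition public

partitionSetoid : Setoid 0ℓ 0ℓ
partitionSetoid = On.setoid (ℕ →-setoid ℕ) part

size : Partition → ℕ
size μ = List.sum (map (part μ) (upTo (bound μ)))

-- Column r (from 0) of the diagram meets row c exactly when r < part μ c.
conj : Partition → ℕ → ℕ
conj μ r = length (filter (λ c → r ℕ.<? part μ c) (upTo (bound μ)))

SelfConjugate : Pred Partition 0ℓ
SelfConjugate μ = ∀ r → part μ r ≡ conj μ r

-- The `suc`s convert to the usual coordinates, which start at 1.
hookLength : Partition → ℕ → ℕ → ℤ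
hookLength μ r c = 1ℤ ℤ.+ (+ part μ r ℤ.- + suc r) ℤ.+ (+ conj μ c ℤ.- + suc c)

𝒞 : ℕ → Pred Partition 0ℓ
𝒞 s μ = ∀ r c → c ℕ.< part μ r → hookLength μ r c ≢ + s

𝒟 : ℕ → Pred Partition 0ℓ
𝒟 s = 𝒞 s ∩ SelfConjugate

betaSet : Partition → Pred ℤ 0ℓ
betaSet μ x = ∃[ i ] x ≡ + part μ i ℤ.- + suc i

-- (B + s) ∖ B, where x ∈ B + s is expressed as x - s ∈ B.
sSet : ℕ → Partition → Pred ℤ 0ℓ
sSet s μ x = (x ℤ.- + s) ∈ betaSet μ × ¬ (x ∈ betaSet μ)

image : (ℤ → ℤ) → Pred ℤ 0ℓ → Pred ℤ 0ℓ
image f A y = ∃[ x ] x ∈ A × f x ≡ y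

record H (s t : ℕ) : Set where
  field
    permutation : ℤ ↔ ℤ

  open Inverse permutation public using (to)

  field
    shift    : ∀ m → to (m ℤ.+ + s) ≡ to m ℤ.+ + s
    balanced : ∑ℤ (λ (i : Fin s) → to (+ toℕ i)) ≡ + (s C 2)
    mod-t    : ∀ m → + t ∣ℤ (to m ℤ.- m)
    odd      : ∀ m → to (-1ℤ ℤ.- m) ≡ -1ℤ ℤ.- to m

HSetoid : ℕ → ℕ → Setoid 0ℓ 0ℓ
HSetoid s t = On.setoid (ℤ →-setoid ℤ) (H.to {s} {t})

-- The graph of the action of H s t on 𝒟 s: `f · μ ↦ ν` says that ν is the
-- self-conjugate s-core with s-set f(sSet s μ).  An s-core is determined by its
-- s-set, so there is at most one such ν.
_·_↦_ : ∀ {s t} → H s t → Partition → Partition → Set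
_·_↦_ {s} f μ ν = ν ∈ 𝒟 s × sSet s ν ≐ image (H.to f) (sSet s μ)

Stab : ∀ s t → Partition → Setoid 0ℓ 0ℓ
Stab s t μ = subsetoid (HSetoid s t) (λ f → f · μ ↦ μ)

𝒟∩𝒟 : ℕ → ℕ → Setoid 0ℓ 0ℓ
𝒟∩𝒟 s t = subsetoid partitionSetoid (𝒟 s ∩ 𝒟 t)

∑-id : ∀ n → ∑ℤ (λ (i : Fin n) → + toℕ i) ≡ + (n C 2)
∑-id zero    = refl
∑-id (suc n) = begin
  ∑ℤ (λ (i : Fin (suc n)) → + toℕ i)
    ≡⟨ ∑ℤ-init-last (λ (i : Fin (suc n)) → + toℕ i) ⟩
  ∑ℤ (λ (i : Fin n) → + toℕ (Fin.inject₁ i)) ℤ.+ + toℕ (Fin.fromℕ n)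
    ≡⟨ cong₂ ℤ._+_ (∑ℤ-cong {n} (λ i → cong +_ (toℕ-inject₁ i))) (cong +_ (toℕ-fromℕ n)) ⟩
  ∑ℤ (λ (i : Fin n) → + toℕ i) ℤ.+ + n
    ≡⟨ cong (ℤ._+ + n) (∑-id n) ⟩
  + (n C 2 ℕ.+ n)
    ≡⟨ cong +_ (ℕ.+-comm (n C 2) n) ⟩
  + (n ℕ.+ n C 2)
    ≡⟨ cong (λ k → + (k ℕ.+ n C 2)) (nC1≡n n) ⟨
  + (n C 1 ℕ.+ n C 2)
    ≡⟨ cong +_ (nCk+nC[k+1]≡[n+1]C[k+1] n 1) ⟩
  + (suc n C 2) ∎
  where open ≡.≡-Reasoning

idH : ∀ s t → H s t
idH s t = record
  { permutation = ↔-id ℤ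
  ; shift       = λ m → refl
  ; balanced    = ∑-id s
  ; mod-t       = λ m → subst (+ t ∣ℤ_) (sym (ℤ.+-inverseʳ m)) (t ℕ∣.∣0)
  ; odd         = λ m → refl
  }

id∈Stab : ∀ s t μ → μ ∈ 𝒟 s → Setoid.Carrier (Stab s t μ)
id∈Stab s t μ μ∈𝒟 =
  idH s t , μ∈𝒟 , (λ {x} x∈S → x , x∈S , refl) , λ { (_ , x∈S , refl) → x∈S }

∅ : Partition
∅ = record { part = λ _ → 0 ; decreasing = λ _ → z≤n ; bound = 0 ; vanishing = λ _ → refl }

∅∈𝒟 : ∀ s → ∅ ∈ 𝒟 s
∅∈𝒟 s = (λ _ _ ()) , λ _ → refl

∑ℚ-nonNeg : ∀ {n} (w : Fin n → ℚ) → (∀ i → ℚ.Positive (w i)) → ℚ.NonNegative (∑ℚ w)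
∑ℚ-nonNeg {zero}  w w>0 = _
∑ℚ-nonNeg {suc n} w w>0 = ℚ.nonNeg+nonNeg⇒nonNeg w₀ (∑ℚ ws)
  where
  w₀ = w Fin.zero
  ws = λ i → w (Fin.suc i)
  instance
    w₀≥0 = ℚ.pos⇒nonNeg w₀ {{w>0 Fin.zero}}
    ws≥0 = ∑ℚ-nonNeg ws (λ i → w>0 (Fin.suc i))

∑ℚ-nonZero : ∀ {n} → ℕ.NonZero n →
             (w : Fin n → ℚ) → (∀ i → ℚ.Positive (w i)) → ℚ.NonZero (∑ℚ w)
∑ℚ-nonZero {suc n} _ w w>0 = ℚ.pos⇒nonZero (∑ℚ w) {{ℚ.pos+nonNeg⇒pos w₀ (∑ℚ ws)}}
  where
  w₀ = w Fin.zero
  ws = λ i → w (Fin.suc i)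
  instance
    w₀>0 = w>0 Fin.zero
    ws≥0 = ∑ℚ-nonNeg ws (λ i → w>0 (Fin.suc i))

FiniteStabs : ℕ → ℕ → Set
FiniteStabs s t = (μ : Partition) → μ ∈ 𝒟 s ∩ 𝒟 t → Finite (Stab s t μ)

-- The values below do not depend on the enumerations `cores` and `stabs`: these
-- are bijections with an initial segment of ℕ.

module _ {s t} (cores : Finite (𝒟∩𝒟 s t)) (stabs : FiniteStabs s t) where

  core : Fin (card cores) → Partition
  core i = proj₁ (element cores i)

  stab : (i : Fin (card cores)) → Finite (Stab s t (core i))
  stab i = stabs (core i) (proj₂ (element cores i))

  |Stab|-nonZero : ∀ i → ℕ.NonZero (card (stab i))
  |Stab|-nonZero i =
    inhabited⇒nonZero (stab i) (id∈Stab s t (core i) (proj₁ (proj₂ (element cores i))))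

  |Stab|⁻¹ : Fin (card cores) → ℚ
  |Stab|⁻¹ i = (+ 1 ℚ./ card (stab i)) {{|Stab|-nonZero i}}

  totalWeight-nonZero : ℚ.NonZero (∑ℚ |Stab|⁻¹)
  totalWeight-nonZero =
    ∑ℚ-nonZero (inhabited⇒nonZero cores (∅ , ∅∈𝒟 s , ∅∈𝒟 t)) |Stab|⁻¹
      (λ i → ℚ.normalize-pos 1 (card (stab i)) {{|Stab|-nonZero i}})

  weightedAverageSize : ℚ
  weightedAverageSize =
    (∑ℚ (λ i → |Stab|⁻¹ i ℚ.* (+ size (core i) ℚ./ 1)) ÷ ∑ℚ |Stab|⁻¹)
      {{totalWeight-nonZero}}

-- Let B be the beta-set of a self-conjugate (s,t)-core and c = (s − 1)(t + 1) / 2.  The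
-- integers c − t a − s v lie in B exactly when v > V a, and the function V is weakly
-- decreasing with V (a + s) = V a − t and V (s − 1 − a) = − V a.  So the core is given by
-- the values V a for a < n = ⌊s / 2⌋, an arbitrary weakly decreasing sequence in
-- {0, …, ⌊t / 2⌋}.  The s-set consists of the numbers c − t a − s V a with 0 ≤ a < s, and an
-- element of the stabilizer permutes them, preserving residues modulo t and commuting
-- with x ↦ s − 1 − x.  Hence the stabilizer is the product, over the values h of V, of the
-- symmetric group on the k_h positions a < n with V a = h, replaced by the hyperoctahedral
-- group if h = 0 or 2 h = t.  The weights are therefore Π α_hᵏ / k! with α_h = 1 or 1 / 2, and
-- their sum is (t / 2)ⁿ / n!.  With Y_a = t (s − 1 − 2 a) − 2 s V a, counting principal hooks
-- by residue gives 24 s |λ| + s³ − s = 6 Σ_{a<n} Y_a², which is quadratic in the k_h, and its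
-- weighted sum is read off from products of the series exp (α_h x) and their derivatives.

module Submission where

open import Defs
open import Data.Integer using (+_; _-_; _+_; _*_)
open import Data.Nat using (ℕ; NonZero; _%_)
open import Data.Nat.Coprimality using (Coprime)
open import Data.Product using (Σ-syntax; _×_)
open import Data.Rational using (_/_)
open import Relation.Binary.PropositionalEquality using (_≡_)

open import Level using (0ℓ)
open import Function.Base using (_∘_; id)
open import Function.Bundles using (Inverse; mk↔ₛ′)
import Function.Construct.Composition as Compose
import Function.Construct.Identity as Identity
open import Relation.Binary.Bundles using (Setoid)
import Relation.Binary.Construct.On as On
import Relation.Binary.PropositionalEquality.Properties as ≡
open import Relation.Binary.PropositionalEquality
  using (refl; sym; trans; cong; cong₂; subst; subst₂; _≢_; _≗_; _→-setoid_; module ≡-Reasoning)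
open import Relation.Nullary using (¬_; Dec; does; yes; no; contradiction)
open import Relation.Nullary.Decidable using (_⊎-dec_; dec-true; dec-false)
open import Relation.Unary using (Pred; _∈_; _≐_)
open import Data.Bool.Base using (Bool; true; false; if_then_else_; not; _xor_)
open import Data.Product using (∃-syntax; _,_; proj₁; proj₂)
open import Data.Product.Relation.Binary.Pointwise.NonDependent using (×-setoid)
open import Data.Sum.Base as Sum using (_⊎_; inj₁; inj₂; [_,_]′)
open import Data.Fin.Base as Fin using (Fin; zero; suc; toℕ; _↑ˡ_; _↑ʳ_; fromℕ<; opposite)
import Data.Fin.Properties as Fin
import Data.Fin.Permutation.Components as PC
open import Data.Fin.Permutation as Perm using (Permutation′; _⟨$⟩ʳ_; _⟨$⟩ˡ_)
open import Data.List.Base using (length; filter; applyUpTo)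
import Data.Vec.Functional as Vector
import Data.List.Properties as List
open import Data.Nat.ListAction using (sum)
open import Data.Nat.Base as ℕ using (zero; suc; z≤n; s≤s; _!)
import Data.Nat.Properties as ℕ
import Data.Nat.DivMod as ℕ
open import Data.Nat.Combinatorics using (_C_)
import Data.Nat.Divisibility as ℕ∣
import Data.Nat.Coprimality as Coprimality
import Data.Nat.GCD as GCD
import Data.Nat.Tactic.RingSolver as ℕ-Ring
open import Data.Integer.Base as ℤ using (ℤ; +≤+; +<+; -<+; -≤+; -≤-; -_; -[1+_]; 0ℤ; 1ℤ; -1ℤ)
import Data.Integer.Properties as ℤ
import Data.Integer.DivMod as ℤ
import Data.Integer.Divisibility.Signed as Signed
open import Data.Integer.Tactic.RingSolver using (solve-∀)
open import Data.Rational.Base as ℚ using (ℚ; 0ℚ; 1ℚ; ½)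
import Data.Rational.Properties as ℚ
open import Data.Rational.Solver using (module +-*-Solver)
open +-*-Solver using (Polynomial; con; _:+_; _:*_; _:-_; :-_; _:=_) renaming (solve to solveℚ)
open import Algebra.Properties.CommutativeMonoid.Sum ℤ.+-0-commutativeMonoid
  using () renaming (sum to ∑ℤ; sum-init-last to ∑ℤ-init-last; sum-cong-≗ to ∑ℤ-cong;
                     ∑-comm to ∑ℤ-comm; ∑-distrib-+ to ∑ℤ-distrib-+; sum-permute to ∑ℤ-permute)
open import Algebra.Properties.CommutativeMonoid.Sum ℚ.+-0-commutativeMonoid
  using () renaming (sum to ∑ℚ; sum-cong-≗ to ∑ℚ-cong)
open import Algebra.Properties.AbelianGroup ℤ.+-0-abelianGroup
  using () renaming (∙-cancelʳ to +ℤ-cancelʳ)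
import Data.Rational.Unnormalised.Base as ℚᵘ
import Data.Rational.Unnormalised.Properties as ℚᵘ

-- Self-conjugate partitions and their beta-sets

-- The definitions speak of conjugates and hook lengths. The bridge to beta-sets is that a
-- self-conjugate beta-set contains exactly one of z and -1 - z. This makes membership decidable,
-- turns the absence of hooks of length s into B - s ⊆ B, and allows a partition to be rebuilt from
-- the nonnegative elements of B alone, which are the arm lengths of its principal hooks. The centre
-- c is an integer because coprime s and t are not both even, so s - 1 or t + 1 is even.
--
-- The weights depend only on the multiplicities k_h, whereas Y_a also depends on the position a.
-- Equal values occupy consecutive positions, so once the greatest value is split off its
-- contribution is a polynomial in its multiplicity and in the number of entries left. A weighted
-- sum then becomes a Cauchy product of exponential series. The exponents add up to Σ α_h = t / 2
-- for both parities: ½ + q if t = 2 q + 1, and ½ + (q - 1) + ½ if t = 2 q. The sum of the weighted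
-- sizes is therefore a quadratic polynomial in n times the total weight, and the theorem becomes a
-- polynomial identity for each parity.

private
  parts-sum : ∀ z a b r c → z ≡ a - r → -1ℤ - z ≡ b - c → 1ℤ + a + b ≡ r + c
  parts-sum z a b r c p q = trans (solve₁ a b r c)
    (trans (cong₂ (λ x y → 1ℤ + (x + y) + (r + c)) (sym p) (sym q)) (solve₂ z (r + c)))
    where
    solve₁ : ∀ a b r c → 1ℤ + a + b ≡ 1ℤ + ((a - r) + (b - c)) + (r + c)
    solve₁ = solve-∀
    solve₂ : ∀ z k → 1ℤ + (z + (-1ℤ - z)) + k ≡ k
    solve₂ = solve-∀

-- A predicate inherited by smaller indices holds on an initial segment, so filtering keeps a
-- prefix, and the length of that prefix (the form in which `conj` is given) exceeds `r` exactly
-- when entry `r` is kept.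
filter-initial : ∀ {P : Pred ℕ 0ℓ} (P? : ∀ i → Dec (P i)) (f : ℕ → ℕ) (n : ℕ) →
                 (∀ {i j} → i ℕ.≤ j → P (f j) → P (f i)) → ∀ r →
                 (r ℕ.< length (filter P? (applyUpTo f n)) → r ℕ.< n × P (f r)) ×
                 (r ℕ.< n → P (f r) → r ℕ.< length (filter P? (applyUpTo f n)))
filter-initial P? f zero anti r = (λ ()) , (λ ())
filter-initial P? f (suc n) anti r
  with P? (f 0) | filter-initial P? (f ∘ suc) n (λ i≤j → anti (s≤s i≤j))
filter-initial P? f (suc n) anti zero    | yes p | _  = (λ _ → s≤s z≤n , p) , (λ _ _ → s≤s z≤n)
filter-initial P? f (suc n) anti (suc r) | yes p | ih =
  (λ { (s≤s l) → let (a , b) = proj₁ (ih r) l in s≤s a , b }) ,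
  (λ { (s≤s l) q → s≤s (proj₂ (ih r) l q) })
... | no ¬p | ih =
  (λ l → contradiction (anti z≤n (proj₂ (proj₁ (ih r) l))) ¬p) ,
  (λ _ q → contradiction (anti z≤n q) ¬p)

SymmetricDiagram : (ℕ → ℕ) → Set
SymmetricDiagram f = ∀ {r c} → c ℕ.< f r → r ℕ.< f c

<-conj : ∀ μ r c → (c ℕ.< conj μ r → r ℕ.< part μ c) × (r ℕ.< part μ c → c ℕ.< conj μ r)
<-conj μ r c =
  (λ l → proj₂ (proj₁ (filter-initial P? id (bound μ) anti c) l)) ,
  (λ l → proj₂ (filter-initial P? id (bound μ) anti c) (c<bound l) l)
  where
  P? = λ c → r ℕ.<? part μ c
  anti : ∀ {i j} → i ℕ.≤ j → r ℕ.< part μ j → r ℕ.< part μ i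
  anti i≤j l = ℕ.≤-trans l (decreasing μ i≤j)
  c<bound : r ℕ.< part μ c → c ℕ.< bound μ
  c<bound l = ℕ.≰⇒> λ b≤c → ℕ.n≮0 (subst (r ℕ.<_) (vanishing μ b≤c) l)

<-iff⇒≡ : ∀ {a b} → (∀ {k} → k ℕ.< a → k ℕ.< b) → (∀ {k} → k ℕ.< b → k ℕ.< a) → a ≡ b
<-iff⇒≡ {a} {b} f g = ℕ.≤-antisym (≤-from f) (≤-from g)
  where
  ≤-from : ∀ {a b} → (∀ {k} → k ℕ.< a → k ℕ.< b) → a ℕ.≤ b
  ≤-from {zero}  f = z≤n
  ≤-from {suc a} f = f ℕ.≤-refl

selfConjugate⇒symmetric : ∀ μ → SelfConjugate μ → SymmetricDiagram (part μ)
selfConjugate⇒symmetric μ sc {r} {c} l = proj₁ (<-conj μ r c) (subst (c ℕ.<_) (sc r) l)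

symmetric⇒selfConjugate : ∀ μ → SymmetricDiagram (part μ) → SelfConjugate μ
symmetric⇒selfConjugate μ sy r =
  <-iff⇒≡ (λ {c} l → proj₂ (<-conj μ r c) (sy l)) (λ {c} l → sy (proj₁ (<-conj μ r c) l))

module _ (μ : Partition) (sc : SelfConjugate μ) where

  private
    sy : SymmetricDiagram (part μ)
    sy = selfConjugate⇒symmetric μ sc

  -- By symmetry, either `(r , c)` and `(c , r)` both lie in the diagram, and the two parts sum to
  -- at least r + c + 2, or neither does, and they sum to at most r + c. The value r + c + 1 in
  -- between is skipped.
  part-sum≢ : ∀ r c → suc (part μ r ℕ.+ part μ c) ≢ suc r ℕ.+ suc c
  part-sum≢ r c eq with c ℕ.<? part μ r
  ... | yes l = ℕ.<-irrefl (sym eq) (s≤s (subst (ℕ._≤ part μ r ℕ.+ part μ c)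
                  (ℕ.+-comm (suc c) (suc r)) (ℕ.+-mono-≤ l (sy l))))
  ... | no ¬l = ℕ.<-irrefl eq (s≤s (ℕ.≤-<-trans (ℕ.+-mono-≤ (ℕ.≮⇒≥ ¬l) (ℕ.≮⇒≥ (λ l → ¬l (sy l))))
                  (ℕ.≤-reflexive (trans (cong suc (ℕ.+-comm c r)) (sym (ℕ.+-suc r c))))))

  betaSet-exclusive : ∀ {z} → z ∈ betaSet μ → ¬ (-1ℤ - z ∈ betaSet μ)
  betaSet-exclusive {z} (r , p) (c , q) = part-sum≢ r c (ℤ.+-injective
    (parts-sum z (+ part μ r) (+ part μ c) (+ suc r) (+ suc c) p q))

  -- Let i be the first row with μᵢ ≤ a + 1 + i.  If equality fails, column a + i
  -- has height exactly i, and by self-conjugacy so has row a + i.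
  private
    firstRow : ∀ z j → part μ j ℕ.≤ z ℕ.+ j →
               ∃[ i ] (part μ i ℕ.≤ z ℕ.+ i × (∀ {k} → k ℕ.< i → z ℕ.+ k ℕ.< part μ k))
    firstRow z zero    l = zero , l , λ ()
    firstRow z (suc j) l with part μ j ℕ.≤? z ℕ.+ j
    ... | yes l′ = firstRow z j l′
    ... | no ¬l′ = suc j , l , λ {k} k≤j → ℕ.≤-trans (s≤s (ℕ.+-monoʳ-≤ z (ℕ.s≤s⁻¹ k≤j)))
                     (ℕ.≤-trans (ℕ.≰⇒> ¬l′) (decreasing μ (ℕ.s≤s⁻¹ k≤j)))

  betaSet-nat : ∀ a → (∃[ i ] part μ i ≡ suc (a ℕ.+ i)) ⊎ (∃[ i ] part μ (a ℕ.+ i) ≡ i)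
  betaSet-nat a with firstRow (suc a) (bound μ) (ℕ.≤-trans (ℕ.≤-reflexive (vanishing μ ℕ.≤-refl)) z≤n)
  ... | i , l , m with part μ i ℕ.≟ suc (a ℕ.+ i)
  ... | yes p = inj₁ (i , p)
  ... | no ¬p = inj₂ (i , <-iff⇒≡ below above)
    where
    below : ∀ {k} → k ℕ.< part μ (a ℕ.+ i) → k ℕ.< i
    below {k} l′ = ℕ.≰⇒> λ i≤k → ¬p (ℕ.≤-antisym l
      (ℕ.≤-trans (sy l′) (decreasing μ i≤k)))
    above : ∀ {k} → k ℕ.< i → k ℕ.< part μ (a ℕ.+ i)
    above {k} k<i with ℕ.≤⇒≤′ k<i
    ... | ℕ.≤′-reflexive refl = sy (subst (ℕ._< part μ k) (sym (ℕ.+-suc a k)) (m ℕ.≤-refl))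
    ... | ℕ.≤′-step {i′} k<i′ = sy (ℕ.<-≤-trans
            (subst (ℕ._< part μ i′) (sym (ℕ.+-suc a i′)) (m ℕ.≤-refl)) (decreasing μ (ℕ.≤-trans (ℕ.n≤1+n k) (ℕ.≤′⇒≤ k<i′))))

beta : Partition → ℕ → ℤ
beta μ i = + part μ i - + suc i

beta-intro : ∀ {μ z i} → z + + suc i ≡ + part μ i → z ∈ betaSet μ
beta-intro {μ} {z} {i} eq = i , trans (solve z (+ suc i)) (cong (_- + suc i) eq)
  where
  solve : ∀ z i → z ≡ z + i - i
  solve = solve-∀

beta-strict : ∀ μ {i j} → i ℕ.< j → beta μ j ℤ.< beta μ i
beta-strict μ i<j = ℤ.+-mono-≤-< (+≤+ (decreasing μ (ℕ.<⇒≤ i<j))) (ℤ.neg-mono-< (+<+ (s≤s i<j)))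

beta-antitone : ∀ μ {i j} → i ℕ.≤ j → beta μ j ℤ.≤ beta μ i
beta-antitone μ i≤j = ℤ.+-mono-≤ (+≤+ (decreasing μ i≤j)) (ℤ.neg-mono-≤ (+≤+ (s≤s i≤j)))

-- `beta` is strictly decreasing, so `beta μ r` must be the (r+1)-st greatest element of the set. In
-- the induction, it occurs in the other sequence at some index, and the indices below `r` are
-- already taken by greater elements.
betaSet-≐⇒part-≗ : ∀ μ ν → betaSet μ ≐ betaSet ν → part μ ≗ part ν
betaSet-≐⇒part-≗ μ ν (⊆ , ⊇) r =
  ℤ.+-injective (+ℤ-cancelʳ (- + suc r) _ _ (agree (suc r) ℕ.≤-refl))
  where
  ≤-step : ∀ μ ν r → (∀ {x} → x ∈ betaSet μ → x ∈ betaSet ν) →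
           (∀ {j} → j ℕ.< r → beta μ j ≡ beta ν j) → beta μ r ℤ.≤ beta ν r
  ≤-step μ ν r ⊆ ih with ⊆ (r , refl)
  ... | j , eq with j ℕ.<? r
  ... | yes j<r = contradiction (trans (ih j<r) (sym eq)) (ℤ.<⇒≢ (beta-strict μ j<r) ∘ sym)
  ... | no  j≮r = ℤ.≤-trans (ℤ.≤-reflexive eq) (beta-antitone ν (ℕ.≮⇒≥ j≮r))

  agree : ∀ n {r} → r ℕ.< n → beta μ r ≡ beta ν r
  agree (suc n) {r} (s≤s r≤n) = ℤ.≤-antisym
    (≤-step μ ν r ⊆ (λ j<r → agree n (ℕ.<-≤-trans j<r r≤n)))
    (≤-step ν μ r ⊇ (λ j<r → sym (agree n (ℕ.<-≤-trans j<r r≤n))))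

part-≗⇒betaSet-⊆ : ∀ μ ν → part μ ≗ part ν → ∀ {x} → x ∈ betaSet μ → x ∈ betaSet ν
part-≗⇒betaSet-⊆ μ ν eq (i , p) = i , trans p (cong (λ k → + k - + suc i) (eq i))

betaSet-below : ∀ μ {a} → bound μ ℕ.≤ a → -[1+ a ] ∈ betaSet μ
betaSet-below μ {a} b≤a = a , cong (λ k → + k - + suc a) (sym (vanishing μ b≤a))

betaSet-above : ∀ μ {a} → part μ 0 ℕ.≤ a → ¬ (+ a ∈ betaSet μ)
betaSet-above μ {a} p≤a (i , eq) = ℤ.<-irrefl (sym eq) (begin-strict
  beta μ i  ≤⟨ beta-antitone μ z≤n ⟩
  beta μ 0  ≤⟨ ℤ.+-monoˡ-≤ -1ℤ (+≤+ p≤a) ⟩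
  + a + -1ℤ     <⟨ ℤ.+-monoʳ-< (+ a) -<+ ⟩
  + a + 0ℤ  ≡⟨ ℤ.+-identityʳ (+ a) ⟩
  + a ∎)
  where open ℤ.≤-Reasoning

module _ (μ : Partition) (sc : SelfConjugate μ) where

  private
    arm-eq : ∀ {a i} → part μ i ≡ suc (a ℕ.+ i) → + a + + suc i ≡ + part μ i
    arm-eq {a} {i} p = cong +_ (trans (ℕ.+-suc a i) (sym p))

    leg-eq : ∀ {a i} → part μ (a ℕ.+ i) ≡ i → -[1+ a ] + + suc (a ℕ.+ i) ≡ + part μ (a ℕ.+ i)
    leg-eq {a} {i} p = trans (trans (cong (λ x → -[1+ a ] + + suc x) (ℕ.+-comm a i))
                         (trans (cong (λ x → -[1+ a ] + x) (ℤ.pos-+ (suc i) a)) (solve (+ a) (+ i))))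
                         (cong +_ (sym p))
      where
      solve : ∀ a i → - (1ℤ + a) + (1ℤ + i + a) ≡ i
      solve = solve-∀

    reflect-+ : ∀ a → -1ℤ - + a ≡ -[1+ a ]
    reflect-+ zero    = refl
    reflect-+ (suc a) = refl

  betaSet-total : ∀ z → z ∈ betaSet μ ⊎ -1ℤ - z ∈ betaSet μ
  betaSet-total (+ a) with betaSet-nat μ sc a
  ... | inj₁ (i , p) = inj₁ (beta-intro {μ} (arm-eq {a} p))
  ... | inj₂ (i , p) = inj₂ (subst (_∈ betaSet μ) (sym (reflect-+ a)) (beta-intro {μ} (leg-eq {a} p)))
  betaSet-total (-[1+ a ]) with betaSet-nat μ sc a
  ... | inj₁ (i , p) = inj₂ (beta-intro {μ} (arm-eq {a} p))
  ... | inj₂ (i , p) = inj₁ (beta-intro {μ} (leg-eq {a} p))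

  -- Totality always produces a row for z or for its mirror image, and exclusivity turns the second
  -- outcome into a refutation, so no search through the rows is involved.
  betaSet? : ∀ z → Dec (z ∈ betaSet μ)
  betaSet? z with betaSet-total z
  ... | inj₁ p = yes p
  ... | inj₂ q = no λ p → betaSet-exclusive μ sc p q

  private
    hook-beta : ∀ r c → hookLength μ r c ≡ 1ℤ + beta μ r + beta μ c
    hook-beta r c = cong (λ k → 1ℤ + beta μ r + (+ k - + suc c)) (sym (sc c))

    core-eq₁ : ∀ z s → 1ℤ + z + (-1ℤ - (z - s)) ≡ s
    core-eq₁ = solve-∀

    core-eq₂ : ∀ x y → x - (1ℤ + x + y) ≡ -1ℤ - y
    core-eq₂ = solve-∀

    core-eq₃ : ∀ a b r c → 1ℤ + (a - r) + (b - c) + (r + c) ≡ 1ℤ + a + b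
    core-eq₃ = solve-∀

  -- For a self-conjugate partition the hook at `(r , c)` has length 1 + β_r + β_c, so it has length
  -- s exactly when β_r - s is the mirror image of β_c. If z - s is missing from the beta-set, its
  -- mirror image is some β_c and yields a forbidden hook.
  core⇒closed : ∀ {s} → 𝒞 s μ → ∀ {z} → z ∈ betaSet μ → z - + s ∈ betaSet μ
  core⇒closed {s} core {z} (r , p) with betaSet-total (z - + s)
  ... | inj₁ q = q
  ... | inj₂ (c , q) = contradiction hook≡s (core r c c<part)
    where
    hook≡s : hookLength μ r c ≡ + s
    hook≡s = trans (hook-beta r c) (trans (cong₂ (λ x y → 1ℤ + x + y) (sym p) (sym q)) (core-eq₁ z (+ s)))

    sums : s ℕ.+ (suc r ℕ.+ suc c) ≡ suc (part μ r ℕ.+ part μ c)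
    sums = ℤ.+-injective (trans (cong (_+ (+ suc r + + suc c)) (trans (sym hook≡s) (hook-beta r c)))
             (core-eq₃ (+ part μ r) (+ part μ c) (+ suc r) (+ suc c)))

    -- Outside the diagram both parts are small and the hook formula gives a negative number, which
    -- cannot be s.
    c<part : c ℕ.< part μ r
    c<part with c ℕ.<? part μ r
    ... | yes l = l
    ... | no ¬l = contradiction sums (ℕ.<⇒≢ (ℕ.<-≤-trans (s≤s (s≤s (ℕ.+-mono-≤
            (ℕ.≮⇒≥ ¬l) (ℕ.≮⇒≥ (λ l → ¬l (selfConjugate⇒symmetric μ sc l))))))
            (ℕ.≤-trans (ℕ.≤-reflexive (cong suc (trans (cong suc (ℕ.+-comm c r)) (sym (ℕ.+-suc r c)))))
               (ℕ.m≤n+m _ s))) ∘ sym)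

  closed⇒core : ∀ {s} → (∀ {z} → z ∈ betaSet μ → z - + s ∈ betaSet μ) → 𝒞 s μ
  closed⇒core {s} closed r c _ hook≡s = betaSet-exclusive μ sc (c , refl)
    (subst (_∈ betaSet μ) (trans (cong (λ h → beta μ r - h) (trans (sym hook≡s) (hook-beta r c)))
       (core-eq₂ (beta μ r) (beta μ c))) (closed (r , refl)))

-- Construction from principal hooks

-- Surrounds the diagram of f by a principal hook of arm length M.
hook : ℕ → (ℕ → ℕ) → ℕ → ℕ
hook M f zero = suc M
hook M f (suc i) with i ℕ.<? M
... | yes _ = suc (f i)
... | no  _ = 0

-- The diagram lies in an M by M square, so a hook of arm and leg length M encloses it and the
-- result is again a symmetric diagram, now in a square of side M + 1.
record Fits (M : ℕ) (f : ℕ → ℕ) : Set where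
  field
    antitone  : ∀ {i j} → i ℕ.≤ j → f j ℕ.≤ f i
    small     : ∀ i → f i ℕ.≤ M
    vanishes  : ∀ {i} → M ℕ.≤ i → f i ≡ 0
    symmetric : SymmetricDiagram f

open Fits

fits-suc : ∀ {M f} → Fits M f → Fits (suc M) f
fits-suc fit = record
  { antitone  = antitone fit
  ; small     = λ i → ℕ.m≤n⇒m≤1+n (small fit i)
  ; vanishes  = λ M<i → vanishes fit (ℕ.<⇒≤ M<i)
  ; symmetric = symmetric fit
  }

fits-hook : ∀ {M f} → Fits M f → Fits (suc M) (hook M f)
fits-hook {M} {f} fit = record
  { antitone = anti ; small = sm ; vanishes = van ; symmetric = λ {r} {c} → sy r c }
  where
  sm : ∀ i → hook M f i ℕ.≤ suc M
  sm zero = ℕ.≤-refl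
  sm (suc i) with i ℕ.<? M
  ... | yes _ = s≤s (small fit i)
  ... | no  _ = z≤n

  anti : ∀ {i j} → i ℕ.≤ j → hook M f j ℕ.≤ hook M f i
  anti {zero} {j} _ = sm j
  anti {suc i} {suc j} (s≤s i≤j) with j ℕ.<? M | i ℕ.<? M
  ... | yes _   | yes _   = s≤s (antitone fit i≤j)
  ... | yes j<M | no  i≮M = contradiction (ℕ.≤-<-trans i≤j j<M) i≮M
  ... | no  _   | _       = z≤n

  van : ∀ {i} → suc M ℕ.≤ i → hook M f i ≡ 0
  van {suc i} (s≤s M≤i) with i ℕ.<? M
  ... | yes i<M = contradiction M≤i (ℕ.<⇒≱ i<M)
  ... | no  _   = refl

  sy : ∀ r c → c ℕ.< hook M f r → r ℕ.< hook M f c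
  sy zero zero l = l
  sy zero (suc c) (s≤s l) with c ℕ.<? M
  ... | yes _ = s≤s z≤n
  ... | no ¬l = contradiction l ¬l
  sy (suc r) zero l with r ℕ.<? M
  ... | yes r<M = s≤s r<M
  sy (suc r) (suc c) l with r ℕ.<? M | c ℕ.<? M
  sy (suc r) (suc c) (s≤s l) | yes r<M | yes c<M = s≤s (symmetric fit l)
  sy (suc r) (suc c) (s≤s l) | yes r<M | no c≮M =
    contradiction (ℕ.<-≤-trans l (small fit r)) c≮M

sum-vanish : ∀ (f : ℕ → ℕ) n → (∀ {i} → n ℕ.≤ i → f i ≡ 0) →
             sum (applyUpTo f (suc n)) ≡ sum (applyUpTo f n)
sum-vanish f zero    van = trans (ℕ.+-identityʳ (f 0)) (van z≤n)
sum-vanish f (suc n) van = cong (f 0 ℕ.+_) (sum-vanish (f ∘ suc) n (λ n≤i → van (s≤s n≤i)))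

sum-suc : ∀ (f g : ℕ → ℕ) n → (∀ {i} → i ℕ.< n → g i ≡ suc (f i)) →
          sum (applyUpTo g n) ≡ n ℕ.+ sum (applyUpTo f n)
sum-suc f g zero    eq = refl
sum-suc f g (suc n) eq = trans
  (cong₂ ℕ._+_ (eq (s≤s z≤n)) (sum-suc (f ∘ suc) (g ∘ suc) n (λ i<n → eq (s≤s i<n))))
  (solve (f 0) n (sum (applyUpTo (f ∘ suc) n)))
  where
  solve : ∀ a n b → suc a ℕ.+ (n ℕ.+ b) ≡ suc n ℕ.+ (a ℕ.+ b)
  solve = ℕ-Ring.solve-∀

sum-hook : ∀ M f → sum (applyUpTo (hook M f) (suc M)) ≡ suc (M ℕ.+ M) ℕ.+ sum (applyUpTo f M)
sum-hook M f = trans (cong (suc M ℕ.+_) (sum-suc f (hook M f ∘ suc) M inside))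
                     (sym (ℕ.+-assoc (suc M) M _))
  where
  inside : ∀ {i} → i ℕ.< M → hook M f (suc i) ≡ suc (f i)
  inside {i} i<M with i ℕ.<? M
  ... | yes _  = refl
  ... | no ¬l = contradiction i<M ¬l

-- The self-conjugate partition whose principal hooks have arm lengths
-- { a < M ∣ χ a }; these are the nonnegative elements of its beta-set.
rows : (ℕ → Bool) → ℕ → ℕ → ℕ
rows χ zero    _ = 0
rows χ (suc M) = if χ M then hook M (rows χ M) else rows χ M

rows-fits : ∀ χ M → Fits M (rows χ M)
rows-fits χ zero = record
  { antitone = λ _ → z≤n ; small = λ _ → z≤n ; vanishes = λ _ → refl ; symmetric = λ () }
rows-fits χ (suc M) with χ M
... | true  = fits-hook (rows-fits χ M)
... | false = fits-suc (rows-fits χ M)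

fromArms : (ℕ → Bool) → ℕ → Partition
fromArms χ M = record
  { part = rows χ M ; decreasing = antitone (rows-fits χ M)
  ; bound = M ; vanishing = vanishes (rows-fits χ M) }

fromArms-selfConjugate : ∀ χ M → SelfConjugate (fromArms χ M)
fromArms-selfConjugate χ M = symmetric⇒selfConjugate (fromArms χ M) (symmetric (rows-fits χ M))

-- Principal hooks of a self-conjugate partition have equal arm and leg, here both `a`, together
-- with the corner.
hookSize : ℕ → ℤ
hookSize a = 1ℤ + (+ a + + a)

size-fromArms : ∀ χ M →
  + size (fromArms χ M) ≡ ∑ℤ (λ (a : Fin M) → if χ (toℕ a) then hookSize (toℕ a) else 0ℤ)
size-fromArms χ M = trans (cong (λ l → + sum l) (List.map-upTo (rows χ M) M)) (go M)
  where
  term : ℕ → ℤ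
  term a = if χ a then hookSize a else 0ℤ

  go : ∀ M → + sum (applyUpTo (rows χ M) M) ≡ ∑ℤ (λ (a : Fin M) → term (toℕ a))
  step : ∀ M → + sum (applyUpTo (rows χ (suc M)) (suc M)) ≡ ∑ℤ (λ (a : Fin M) → term (toℕ a)) + term M

  go zero    = refl
  go (suc M) = trans (step M) (sym (trans (∑ℤ-init-last (λ (a : Fin (suc M)) → term (toℕ a)))
    (cong₂ _+_ (∑ℤ-cong (λ (a : Fin M) → cong term (Fin.toℕ-inject₁ a))) (cong term (Fin.toℕ-fromℕ M)))))

  step M with χ M
  ... | true  = trans (cong +_ (sum-hook M (rows χ M))) (trans
                  (ℤ.+-comm (+ suc (M ℕ.+ M)) (+ sum (applyUpTo (rows χ M) M))) (cong (_+ hookSize M) (go M)))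
  ... | false = trans (cong +_ (sum-vanish (rows χ M) M (vanishes (rows-fits χ M))))
                  (trans (go M) (sym (ℤ.+-identityʳ _)))

-- Enclosing a diagram in a hook moves row r to row r + 1 and lengthens it by one, which leaves its
-- arm unchanged. Only the new row 0, of arm `M`, adds an arm.
rows-arm⇒ : ∀ χ M {a r} → rows χ M r ≡ suc (a ℕ.+ r) → a ℕ.< M × χ a ≡ true
rows-arm⇒ χ (suc M) {a} {r} p with χ M in χM
... | false = let (l , e) = rows-arm⇒ χ M p in ℕ.m≤n⇒m≤1+n l , e
rows-arm⇒ χ (suc M) {a} {zero} p | true = subst (λ a → a ℕ.< suc M × χ a ≡ true)
  (trans (ℕ.suc-injective p) (ℕ.+-identityʳ a)) (ℕ.≤-refl , χM)
rows-arm⇒ χ (suc M) {a} {suc r} p | true with r ℕ.<? M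
... | yes _ = let (l , e) = rows-arm⇒ χ M (trans (ℕ.suc-injective p) (ℕ.+-suc a r)) in ℕ.m≤n⇒m≤1+n l , e

rows-arm⇐ : ∀ χ M {a} → a ℕ.< M → χ a ≡ true → ∃[ r ] rows χ M r ≡ suc (a ℕ.+ r)
rows-arm⇐ χ (suc M) {a} a≤M χa with χ M in χM | ℕ.m≤n⇒m<n∨m≡n (ℕ.s≤s⁻¹ a≤M)
... | false | inj₁ a<M  = rows-arm⇐ χ M a<M χa
... | false | inj₂ refl = contradiction (trans (sym χM) χa) λ ()
... | true  | inj₂ refl = 0 , cong suc (sym (ℕ.+-identityʳ a))
... | true  | inj₁ a<M  with rows-arm⇐ χ M a<M χa
... | r , p = suc r , shifted
  where
  shifted : hook M (rows χ M) (suc r) ≡ suc (a ℕ.+ suc r)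
  shifted with r ℕ.<? M
  ... | yes _ = cong suc (trans p (sym (ℕ.+-suc a r)))
  ... | no r≮M = contradiction (trans (sym (vanishes (rows-fits χ M) (ℕ.≮⇒≥ r≮M))) p) λ ()

fromArms-beta⇒ : ∀ χ M {a} → + a ∈ betaSet (fromArms χ M) → a ℕ.< M × χ a ≡ true
fromArms-beta⇒ χ M {a} (r , p) = rows-arm⇒ χ M {a} {r} (ℤ.+-injective
  (trans (sym (solve (+ rows χ M r) (+ suc r)))
    (trans (cong (_+ + suc r) (sym p)) (cong +_ (ℕ.+-suc a r)))))
  where
  solve : ∀ x r → x - r + r ≡ x
  solve = solve-∀

fromArms-beta⇐ : ∀ χ M {a} → a ℕ.< M → χ a ≡ true → + a ∈ betaSet (fromArms χ M)
fromArms-beta⇐ χ M {a} a<M χa with rows-arm⇐ χ M a<M χa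
... | r , p = beta-intro {fromArms χ M} (cong +_ (trans (ℕ.+-suc a r) (sym p)))

-- Lattice paths

-- Weakly decreasing sequences of length n with values at most q, read from the
-- front: `stop` if no further entry equals q, `take` if the next entry does.
data Path : ℕ → ℕ → Set where
  base : ∀ {n} → Path n 0
  stop : ∀ {n q} → Path n q → Path n (suc q)
  take : ∀ {n q} → Path n (suc q) → Path (suc n) (suc q)

height : ∀ {n q} → Path n q → Fin n → ℕ
height base             = λ _ → 0
height (stop p)         = height p
height (take {q = q} p) = suc q Vector.∷ height p

height≤ : ∀ {n q} (p : Path n q) i → height p i ℕ.≤ q
height≤ base     i           = z≤n
height≤ (stop p) i           = ℕ.m≤n⇒m≤1+n (height≤ p i)
height≤ (take p) zero    = ℕ.≤-refl
height≤ (take p) (suc i) = height≤ p i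

height-antitone : ∀ {n q} (p : Path n q) {i j} → i Fin.≤ j → height p j ℕ.≤ height p i
height-antitone base     _ = z≤n
height-antitone (stop p) i≤j = height-antitone p i≤j
height-antitone (take p) {zero}  {j}         _ = height≤ (take p) j
height-antitone (take p) {suc i} {suc j} (s≤s i≤j) = height-antitone p i≤j

height-injective : ∀ {n q} (p p′ : Path n q) → height p ≗ height p′ → p ≡ p′
height-injective base     base      eq = refl
height-injective (stop p) (stop p′) eq = cong stop (height-injective p p′ eq)
height-injective (stop p) (take p′) eq =
  contradiction (ℕ.≤-trans (ℕ.≤-reflexive (sym (eq zero))) (height≤ p zero)) ℕ.1+n≰n
height-injective (take p) (stop p′) eq =
  contradiction (ℕ.≤-trans (ℕ.≤-reflexive (eq zero)) (height≤ p′ zero)) ℕ.1+n≰n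
height-injective (take p) (take p′) eq = cong take (height-injective p p′ (eq ∘ suc))

fromHeights : ∀ {n} q (f : Fin n → ℕ) → (∀ {i j} → i Fin.≤ j → f j ℕ.≤ f i) → (∀ i → f i ℕ.≤ q) →
              Σ[ p ∈ Path n q ] height p ≗ f
fromHeights zero f anti ≤q = base , λ i → sym (ℕ.n≤0⇒n≡0 (≤q i))
fromHeights {zero} (suc q) f anti ≤q = let (p , _) = fromHeights q f anti (λ ()) in stop p , λ ()
fromHeights {suc n} (suc q) f anti ≤q with f zero ℕ.≟ suc q
... | yes top = let (p , eq) = fromHeights (suc q) (f ∘ suc) (λ i≤j → anti (s≤s i≤j)) (≤q ∘ suc)
                in take p , λ { zero → sym top ; (suc i) → eq i }
... | no ¬top = let (p , eq) = fromHeights q f anti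
                      (λ i → ℕ.≤-trans (anti z≤n) (ℕ.s≤s⁻¹ (ℕ.≤∧≢⇒< (≤q zero) ¬top)))
                in stop p , eq

-- The binomial coefficient of n + q over n, by Pascal's rule.
pathCount : ℕ → ℕ → ℕ
pathCount n       zero    = 1
pathCount zero    (suc q) = pathCount zero q
pathCount (suc n) (suc q) = pathCount (suc n) q ℕ.+ pathCount n (suc q)

pathAt : ∀ n q → Fin (pathCount n q) → Path n q
pathAt n       zero    _ = base
pathAt zero    (suc q) i = stop (pathAt zero q i)
pathAt (suc n) (suc q) i =
  [ stop ∘ pathAt (suc n) q , take ∘ pathAt n (suc q) ]′ (Fin.splitAt (pathCount (suc n) q) i)

pathIndex : ∀ {n q} → Path n q → Fin (pathCount n q)
pathIndex base                 = zero
pathIndex (stop {zero}      p) = pathIndex p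
pathIndex (stop {suc n} {q} p) = pathIndex p ↑ˡ pathCount n (suc q)
pathIndex (take {n} {q}     p) = pathCount (suc n) q ↑ʳ pathIndex p

pathAt-index : ∀ {n q} → (p : Path n q) → pathAt n q (pathIndex p) ≡ p
pathAt-index base                 = refl
pathAt-index (stop {zero}      p) = cong stop (pathAt-index p)
pathAt-index (stop {suc n} {q} p)
  rewrite Fin.splitAt-↑ˡ (pathCount (suc n) q) (pathIndex p) (pathCount n (suc q)) =
  cong stop (pathAt-index p)
pathAt-index (take {n} {q} p)
  rewrite Fin.splitAt-↑ʳ (pathCount (suc n) q) (pathCount n (suc q)) (pathIndex p) =
  cong take (pathAt-index p)

pathIndex-at : ∀ n q (i : Fin (pathCount n q)) → pathIndex (pathAt n q i) ≡ i
pathIndex-at n       zero    zero = refl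
pathIndex-at zero    (suc q) i = pathIndex-at zero q i
pathIndex-at (suc n) (suc q) i with Fin.splitAt (pathCount (suc n) q) i in eq
... | inj₁ j = trans (cong (_↑ˡ pathCount n (suc q)) (pathIndex-at (suc n) q j))
                     (Fin.splitAt⁻¹-↑ˡ eq)
... | inj₂ j = trans (cong (pathCount (suc n) q ↑ʳ_) (pathIndex-at n (suc q) j))
                     (Fin.splitAt⁻¹-↑ʳ eq)

-- The multiplicity of the greatest admissible value `suc q`; the entries having it come first.
top : ∀ {n q} → Path n (suc q) → ℕ
top (stop p) = 0
top (take p) = suc (top p)

-- The order of the group of signed permutations fixing a sequence, if the sign
-- of an entry of value v is allowed to take κ v values.
groupOrder : ∀ {n q} → (ℕ → ℕ) → Path n q → ℕ
groupOrder κ (base {n})        = n ! ℕ.* κ 0 ℕ.^ n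
groupOrder κ (stop p)         = groupOrder κ p
groupOrder κ (take {q = q} p) = (κ (suc q) ℕ.* suc (top p)) ℕ.* groupOrder κ p

-- Residues modulo s

x+s*0≡x : ∀ x s → x + s * 0ℤ ≡ x
x+s*0≡x = solve-∀

i+[j-i]≡j : ∀ i j → i + (j - i) ≡ j
i+[j-i]≡j = solve-∀

s-1-x≡-1-x+s : ∀ s x → s - 1ℤ - x ≡ -1ℤ - x + s
s-1-x≡-1-x+s = solve-∀

-- Makes a hypothesis available to the ring solver: the goal is proved as an identity with the
-- correction `m * (x - y)`, which the hypothesis then cancels.
modulo : ∀ {a b} m {x y : ℤ} → x ≡ y → a ≡ b + m * (x - y) → a ≡ b
modulo {a} {b} m {x} refl eq = trans eq (solve b m x)
  where
  solve : ∀ b m x → b + m * (x - x) ≡ b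
  solve = solve-∀

%ℕ-unique : ∀ s .{{_ : NonZero s}} z {r} k → r ℕ.< s → z ≡ + r + k * + s → z ℤ.%ℕ s ≡ r
%ℕ-unique s z {r} k r<s eq with z ℤ.%ℕ s ℕ.≟ r
... | yes p = p
... | no ¬p = contradiction (ℕ∣.∣⇒≤ {{ℕ.≢-nonZero abs≢0}} s∣) (ℕ.<⇒≱ abs<s)
  where
  r′ = z ℤ.%ℕ s
  k′ = z ℤ./ℕ s
  solve : ∀ r r′ k k′ s → r′ - r ≡ (k - k′) * s + 1ℤ * ((r′ + k′ * s) - (r + k * s))
  solve = solve-∀
  s∣ : s ℕ∣.∣ ℤ.∣ + r′ - + r ∣
  s∣ = Signed.∣⇒∣ᵤ (Signed.divides (k - k′)
         (modulo 1ℤ (trans (sym (ℤ.a≡a%ℕn+[a/ℕn]*n z s)) eq) (solve (+ r) (+ r′) k k′ (+ s))))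
  abs≢0 : ℤ.∣ + r′ - + r ∣ ≢ 0
  abs≢0 e = ¬p (ℤ.+-injective (ℤ.i-j≡0⇒i≡j (+ r′) (+ r) (ℤ.∣i∣≡0⇒i≡0 e)))
  abs<s : ℤ.∣ + r′ - + r ∣ ℕ.< s
  abs<s = subst (λ x → ℤ.∣ x ∣ ℕ.< s) (sym (ℤ.m-n≡m⊖n r′ r))
            (ℕ.≤-<-trans (ℤ.∣m⊝n∣≤m⊔n r′ r) (ℕ.⊔-lub (ℤ.n%ℕd<d z s) r<s))

bezout : ∀ {s t} → Coprime s t → Σ[ τ ∈ ℤ ] Σ[ g ∈ ℤ ] τ * + t ≡ 1ℤ + + s * g
bezout {s} {t} coprime with Coprimality.coprime-Bézout coprime
... | GCD.Bézout.-+ x y eq = + y , + x , trans (sym (ℤ.pos-* y t)) (trans (cong +_ (sym eq))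
        (cong (λ y → 1ℤ + y) (trans (ℤ.pos-* x s) (ℤ.*-comm (+ x) (+ s)))))
... | GCD.Bézout.+- x y eq = - + y , - + x , modulo -1ℤ
        (trans (cong (λ y → 1ℤ + y) (sym (ℤ.pos-* y t))) (trans (cong +_ eq) (ℤ.pos-* x s)))
        (solve (+ x) (+ y) (+ s) (+ t))
  where
  solve : ∀ x y s t → - y * t ≡ 1ℤ + s * - x + -1ℤ * ((1ℤ + y * t) - (x * s))
  solve = solve-∀

-- s = 2 n + ε and t = 2 q + δ with ε , δ ≤ 1.  The residue of c = (s − 1)(t + 1) / 2
-- modulo s is the origin from which residues are counted in steps of − t.
record Setting : Set where
  field
    n ε q δ : ℕ
    ε≤1     : ε ℕ.≤ 1
    δ≤1     : δ ℕ.≤ 1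

  s = n ℕ.+ (ε ℕ.+ n)
  t = q ℕ.+ (δ ℕ.+ q)

  field
    s-nonZero : NonZero s
    t-nonZero : NonZero t
    coprime   : Coprime s t
    c         : ℤ
    c+c       : c + c ≡ (+ s - 1ℤ) * (+ t + 1ℤ)
    τ g     : ℤ
    τ*t     : τ * + t ≡ 1ℤ + + s * g

pattern upper i = inj₁ (i , false)
pattern lower i = inj₁ (i , true)

-- An s-set is invariant under x ↦ s − 1 − x.  Its elements are indexed by cells:
-- n pairs exchanged by the involution and, for odd s, its fixed point.
module Cells (𝕊 : Setting) where
  open Setting 𝕊 public

  instance
    s≢0 = s-nonZero
    t≢0 = t-nonZero

  Cell : Set
  Cell = (Fin n × Bool) ⊎ Fin ε

  ι : Cell → Cell
  ι (inj₁ (i , b)) = inj₁ (i , not b)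
  ι (inj₂ m)       = inj₂ m

  -- The cells `lower i` are placed in reverse order after the middle, so that `ι` becomes a ↦ s - 1
  -- - a on positions.
  position : Cell → Fin s
  position (upper i) = i ↑ˡ (ε ℕ.+ n)
  position (lower i)  = n ↑ʳ (ε ↑ʳ opposite i)
  position (inj₂ m)           = n ↑ʳ (m ↑ˡ n)

  cellAt : Fin s → Cell
  cellAt r = [ (λ i → upper i) ,
               (λ r → [ inj₂ , (λ i → inj₁ (opposite i , true)) ]′ (Fin.splitAt ε r)) ]′ (Fin.splitAt n r)

  cellAt-position : ∀ x → cellAt (position x) ≡ x
  cellAt-position (upper i) rewrite Fin.splitAt-↑ˡ n i (ε ℕ.+ n) = refl
  cellAt-position (lower i)
    rewrite Fin.splitAt-↑ʳ n (ε ℕ.+ n) (ε ↑ʳ opposite i) | Fin.splitAt-↑ʳ ε n (opposite i) =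
    cong (λ i → lower i) (Fin.opposite-involutive i)
  cellAt-position (inj₂ m)
    rewrite Fin.splitAt-↑ʳ n (ε ℕ.+ n) (m ↑ˡ n) | Fin.splitAt-↑ˡ ε m n = refl

  position-cellAt : ∀ r → position (cellAt r) ≡ r
  position-cellAt r with Fin.splitAt n r in eq
  ... | inj₁ i = Fin.splitAt⁻¹-↑ˡ eq
  ... | inj₂ r′ with Fin.splitAt ε r′ in eq′
  ... | inj₁ m = trans (cong (n ↑ʳ_) (Fin.splitAt⁻¹-↑ˡ eq′)) (Fin.splitAt⁻¹-↑ʳ eq)
  ... | inj₂ i = trans (cong (λ i → n ↑ʳ (ε ↑ʳ i)) (Fin.opposite-involutive i))
                   (trans (cong (n ↑ʳ_) (Fin.splitAt⁻¹-↑ʳ eq′)) (Fin.splitAt⁻¹-↑ʳ eq))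

  S T : ℤ
  S = + s
  T = + t

  P : Cell → ℤ
  P x = + toℕ (position x)

  P-pos : ∀ i → P (upper i) ≡ + toℕ i
  P-pos i = cong +_ (Fin.toℕ-↑ˡ i (ε ℕ.+ n))

  P-ι : ∀ x → P (ι x) ≡ S - 1ℤ - P x
  private
    P-neg : ∀ i → P (lower i) ≡ S - 1ℤ - P (upper i)
    P-neg i = modulo 1ℤ (cong +_ total) (solve (P (lower i)) S (P (upper i)))
      where
      solve : ∀ x s y → x ≡ s - 1ℤ - y + 1ℤ * (x + (1ℤ + y) - s)
      solve = solve-∀
      total : toℕ (position (lower i)) ℕ.+ suc (toℕ (position (upper i))) ≡ s
      total = trans (cong₂ (λ x y → x ℕ.+ suc y)
          (trans (Fin.toℕ-↑ʳ n (ε ↑ʳ opposite i)) (cong (n ℕ.+_) (trans (Fin.toℕ-↑ʳ ε (opposite i))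
            (cong (ε ℕ.+_) (Fin.opposite-prop i)))))
          (Fin.toℕ-↑ˡ i (ε ℕ.+ n)))
        (trans (ℕ.+-assoc n (ε ℕ.+ (n ℕ.∸ suc (toℕ i))) (suc (toℕ i)))
          (cong (n ℕ.+_) (trans (ℕ.+-assoc ε (n ℕ.∸ suc (toℕ i)) (suc (toℕ i)))
            (cong (ε ℕ.+_) (ℕ.m∸n+n≡m (Fin.toℕ<n i))))))

    solve-neg : ∀ s x y → y ≡ s - 1ℤ - x + 1ℤ * (x - (s - 1ℤ - y))
    solve-neg = solve-∀

  P-ι (upper i) = P-neg i
  P-ι (lower i)  = modulo 1ℤ (P-neg i) (solve-neg S (P (lower i)) (P (upper i)))
  P-ι (inj₂ m) = modulo 1ℤ (cong +_ total) (solve (P (inj₂ m)) S)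
    where
    solve : ∀ x s → x ≡ s - 1ℤ - x + 1ℤ * (x + (1ℤ + x) - s)
    solve = solve-∀
    m≡0 : toℕ m ≡ 0
    m≡0 = ℕ.n<1⇒n≡0 (ℕ.<-≤-trans (Fin.toℕ<n m) ε≤1)
    ε≡1 : ε ≡ 1
    ε≡1 = ℕ.≤-antisym ε≤1 (ℕ.≤-trans (s≤s z≤n) (Fin.toℕ<n m))
    pos≡n : toℕ (position (inj₂ m)) ≡ n
    pos≡n = trans (Fin.toℕ-↑ʳ n (m ↑ˡ n)) (trans (cong (n ℕ.+_) (trans (Fin.toℕ-↑ˡ m n) m≡0)) (ℕ.+-identityʳ n))
    total : toℕ (position (inj₂ m)) ℕ.+ suc (toℕ (position (inj₂ m))) ≡ s
    total = trans (cong (λ x → x ℕ.+ suc x) pos≡n) (cong (λ e → n ℕ.+ (e ℕ.+ n)) (sym ε≡1))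

  -- Solves z ≡ c - t a modulo s for the position a; `τ` is an inverse of t modulo s.
  residue : ℤ → Fin s
  residue z = fromℕ< (ℤ.n%ℕd<d (τ * (c - z)) s)

  cell : ℤ → Cell
  cell z = cellAt (residue z)

  cell-unique : ∀ x k {z} → z ≡ c - T * P x + S * k → cell z ≡ x
  cell-unique x k {z} eq = trans (cong cellAt (Fin.toℕ-injective (trans (Fin.toℕ-fromℕ< _)
      (%ℕ-unique s (τ * (c - z)) (g * P x - τ * k) (Fin.toℕ<n (position x)) product))))
    (cellAt-position x)
    where
    solve : ∀ τ c t p s k g → τ * (c - (c - t * p + s * k)) ≡ p + (g * p - τ * k) * s + p * (τ * t - (1ℤ + s * g))
    solve = solve-∀
    product : τ * (c - z) ≡ P x + (g * P x - τ * k) * S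
    product = trans (cong (λ z → τ * (c - z)) eq)
      (modulo (P x) τ*t (solve τ c T (P x) S k g))

  cell-position : ∀ z → Σ[ k ∈ ℤ ] z ≡ c - T * P (cell z) + S * k
  cell-position z = g * (c - z) - T * h ,
    modulo (- T) division (modulo (c - z) τ*t (solve c z T (P (cell z)) S g τ h))
    where
    h = τ * (c - z) ℤ./ℕ s
    division : τ * (c - z) ≡ P (cell z) + h * S
    division = trans (ℤ.a≡a%ℕn+[a/ℕn]*n (τ * (c - z)) s) (cong (λ r → + r + h * S)
      (sym (trans (cong toℕ (position-cellAt (residue z))) (Fin.toℕ-fromℕ< _))))
    solve : ∀ c z t p s g τ h → z ≡ c - t * p + s * (g * (c - z) - t * h)
              + - t * (τ * (c - z) - (p + h * s)) + (c - z) * (τ * t - (1ℤ + s * g))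
    solve = solve-∀

  cell-+S : ∀ z → cell (z + S) ≡ cell z
  cell-+S z = let (k , eq) = cell-position z in cell-unique (cell z) (k + 1ℤ)
    (trans (cong (_+ S) eq) (solve c (T * P (cell z)) S k))
    where
    solve : ∀ c a s k → c - a + s * k + s ≡ c - a + s * (k + 1ℤ)
    solve = solve-∀

  -- This determines the choice of c: the point -1 - (c - t p + s k) has the form c - t (s - 1 - p)
  -- + s (-1 - k) exactly because 2 c = (s - 1)(t + 1).
  cell-reflect : ∀ z → cell (-1ℤ - z) ≡ ι (cell z)
  cell-reflect z = let (k , eq) = cell-position z in cell-unique (ι (cell z)) (-1ℤ - k)
    (trans (cong (λ y → -1ℤ - y) eq) (trans (modulo -1ℤ c+c (solve c T (P (cell z)) S k))
      (cong (λ p → c - T * p + S * (-1ℤ - k)) (sym (P-ι (cell z))))))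
    where
    solve : ∀ c t p s k → -1ℤ - (c - t * p + s * k) ≡
              c - t * (s - 1ℤ - p) + s * (-1ℤ - k) + -1ℤ * (c + c - (s - 1ℤ) * (t + 1ℤ))
    solve = solve-∀

-- Cores from paths

-1-neg⇒nonNeg : ∀ k → k ℤ.< 0ℤ → ¬ (-1ℤ - k ℤ.< 0ℤ)
-1-neg⇒nonNeg -[1+ a ] _ (+<+ ())
-1-neg⇒nonNeg (+ a) (+<+ ())

nonNeg⇒-1-neg : ∀ k → ¬ (k ℤ.< 0ℤ) → -1ℤ - k ℤ.< 0ℤ
nonNeg⇒-1-neg (+ zero)  _ = -<+
nonNeg⇒-1-neg (+ suc a) _ = -<+
nonNeg⇒-1-neg -[1+ a ]  k = contradiction -<+ k

i≤+∣i∣ : ∀ i → i ℤ.≤ + ℤ.∣ i ∣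
i≤+∣i∣ (+ a)    = ℤ.≤-refl
i≤+∣i∣ -[1+ a ] = -≤+

-- The beta-set and the set of integers of negative level each contain exactly one of z and -1 - z.
-- They coincide as soon as they agree on nonnegative integers, where `fromArms` prescribes
-- membership.
realize-by-nonneg : ∀ μ → SelfConjugate μ → (ℓ : ℤ → ℤ) → (∀ z → ℓ (-1ℤ - z) ≡ -1ℤ - ℓ z) →
  (∀ a → (+ a ∈ betaSet μ → ℓ (+ a) ℤ.< 0ℤ) × (ℓ (+ a) ℤ.< 0ℤ → + a ∈ betaSet μ)) →
  ∀ z → (z ∈ betaSet μ → ℓ z ℤ.< 0ℤ) × (ℓ z ℤ.< 0ℤ → z ∈ betaSet μ)
realize-by-nonneg μ sc ℓ reflect nonneg (+ a) = nonneg a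
realize-by-nonneg μ sc ℓ reflect nonneg z@(-[1+ a ]) = to , from
  where
  to : z ∈ betaSet μ → ℓ z ℤ.< 0ℤ
  to ∈B with ℓ z ℤ.<? 0ℤ
  ... | yes l = l
  ... | no ¬l = contradiction
          (proj₂ (nonneg a) (subst (ℤ._< 0ℤ) (sym (reflect z)) (nonNeg⇒-1-neg (ℓ z) ¬l)))
          (betaSet-exclusive μ sc ∈B)
  from : ℓ z ℤ.< 0ℤ → z ∈ betaSet μ
  from l with betaSet-total μ sc z
  ... | inj₁ ∈B = ∈B
  ... | inj₂ ∈B = contradiction (subst (ℤ._< 0ℤ) (reflect z) (proj₁ (nonneg a) ∈B))
                    (-1-neg⇒nonNeg (ℓ z) l)

-- The s-set of the core of a path p consists of the integers e x, and its
-- beta-set of the integers of negative level.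
module PathCore (𝕊 : Setting) (p : Path (Setting.n 𝕊) (Setting.q 𝕊)) where
  open Cells 𝕊

  d : Cell → ℤ
  d (upper i) = + height p i
  d (lower i)  = - + height p i
  d (inj₂ m)           = 0ℤ

  d-ι : ∀ x → d (ι x) ≡ - d x
  d-ι (upper i) = refl
  d-ι (lower i)  = sym (ℤ.neg-involutive (+ height p i))
  d-ι (inj₂ m)           = refl

  d-antitone : ∀ x y → position x Fin.≤ position y → d y ℤ.≤ d x
  d-antitone (upper i) (upper j) l = +≤+ (height-antitone p
    (subst₂ ℕ._≤_ (Fin.toℕ-↑ˡ i (ε ℕ.+ n)) (Fin.toℕ-↑ˡ j (ε ℕ.+ n)) l))
  d-antitone (upper i) (lower j)  l = ℤ.neg-≤-pos {height p j} {height p i}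
  d-antitone (upper i) (inj₂ _)           l = +≤+ z≤n
  d-antitone (inj₂ _)           (lower j)  l = ℤ.neg-≤-pos {height p j} {0}
  d-antitone (inj₂ _)           (inj₂ _)           l = ℤ.≤-refl
  d-antitone (lower i)  (lower j)  l = ℤ.neg-mono-≤ (+≤+ (height-antitone p
    (ℕ.s≤s⁻¹ (ℕ.∸-cancelʳ-≤ (Fin.toℕ<n j) (subst₂ ℕ._≤_ (Fin.opposite-prop i) (Fin.opposite-prop j)
      (ℕ.+-cancelˡ-≤ ε _ _ (subst₂ ℕ._≤_ (Fin.toℕ-↑ʳ ε (opposite i)) (Fin.toℕ-↑ʳ ε (opposite j))
        (ℕ.+-cancelˡ-≤ n _ _ (subst₂ ℕ._≤_ (Fin.toℕ-↑ʳ n (ε ↑ʳ opposite i)) (Fin.toℕ-↑ʳ n (ε ↑ʳ opposite j)) l)))))))))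
  d-antitone (lower i)  (inj₂ m) l = contradiction
    (ℕ.≤-trans (ℕ.m≤m+n ε (toℕ (opposite i)))
      (subst₂ ℕ._≤_ (Fin.toℕ-↑ʳ ε (opposite i)) (Fin.toℕ-↑ˡ m n)
        (ℕ.+-cancelˡ-≤ n _ _ (subst₂ ℕ._≤_ (Fin.toℕ-↑ʳ n (ε ↑ʳ opposite i)) (Fin.toℕ-↑ʳ n (m ↑ˡ n)) l))))
    (ℕ.<⇒≱ (Fin.toℕ<n m))
  d-antitone (lower i)  (upper j) l = contradiction
    (ℕ.≤-trans (ℕ.m≤m+n n _) (subst₂ ℕ._≤_ (Fin.toℕ-↑ʳ n (ε ↑ʳ opposite i)) (Fin.toℕ-↑ˡ j (ε ℕ.+ n)) l))
    (ℕ.<⇒≱ (Fin.toℕ<n j))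
  d-antitone (inj₂ m)           (upper j) l = contradiction
    (ℕ.≤-trans (ℕ.m≤m+n n _) (subst₂ ℕ._≤_ (Fin.toℕ-↑ʳ n (m ↑ˡ n)) (Fin.toℕ-↑ˡ j (ε ℕ.+ n)) l))
    (ℕ.<⇒≱ (Fin.toℕ<n j))

  d≤q : ∀ x → d x ℤ.≤ + q
  d≤q (upper i) = +≤+ (height≤ p i)
  d≤q (lower i)  = ℤ.neg-≤-pos {height p i} {q}
  d≤q (inj₂ m)           = +≤+ z≤n

  -d≤q : ∀ x → - d x ℤ.≤ + q
  -d≤q x = subst (ℤ._≤ + q) (d-ι x) (d≤q (ι x))

  e : Cell → ℤ
  e x = c - T * P x - S * d x

  e-ι : ∀ x → e (ι x) ≡ S - 1ℤ - e x
  e-ι x = trans (cong₂ (λ P d → c - T * P - S * d) (P-ι x) (d-ι x))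
            (modulo 1ℤ c+c (solve c T (P x) S (d x)))
    where
    solve : ∀ c t p s d → c - t * (s - 1ℤ - p) - s * - d ≡
              s - 1ℤ - (c - t * p - s * d) + 1ℤ * (c + c - (s - 1ℤ) * (t + 1ℤ))
    solve = solve-∀

  cell-e+ : ∀ x k → cell (e x + S * k) ≡ x
  cell-e+ x k = cell-unique x (k - d x) (solve (c - T * P x) S (d x) k)
    where
    solve : ∀ a s d k → a - s * d + s * k ≡ a + s * (k - d)
    solve = solve-∀

  cell-e : ∀ x → cell (e x) ≡ x
  cell-e x = trans (cong cell (sym (x+s*0≡x (e x) S))) (cell-e+ x 0ℤ)

  level : ℤ → ℤ
  level z = proj₁ (cell-position z) + d (cell z)

  level-spec : ∀ z → z ≡ e (cell z) + S * level z
  level-spec z = let (k , eq) = cell-position z in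
    trans eq (solve (c - T * P (cell z)) S (d (cell z)) k)
    where
    solve : ∀ a s d k → a + s * k ≡ a - s * d + s * (k + d)
    solve = solve-∀

  level-unique : ∀ x k {z} → z ≡ e x + S * k → level z ≡ k
  level-unique x k {z} eq = ℤ.*-cancelˡ-≡ S (level z) k (ℤ-cancel (e x)
    (trans (cong (λ x → e x + S * level z) (sym (trans (cong cell eq) (cell-e+ x k))))
      (trans (sym (level-spec z)) eq)))
    where
    ℤ-cancel : ∀ a {b c} → a + b ≡ a + c → b ≡ c
    ℤ-cancel a {b} {c} eq = trans (solve a b) (trans (cong (_- a) eq) (sym (solve a c)))
      where
      solve : ∀ a b → b ≡ a + b - a
      solve = solve-∀

  level-e : ∀ x → level (e x) ≡ 0ℤ
  level-e x = level-unique x 0ℤ (sym (x+s*0≡x (e x) S))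

  level-−S : ∀ z → level (z - S) ≡ level z - 1ℤ
  level-−S z = level-unique (cell z) (level z - 1ℤ)
    (trans (cong (_- S) (level-spec z)) (solve (e (cell z)) S (level z)))
    where
    solve : ∀ e s k → e + s * k - s ≡ e + s * (k - 1ℤ)
    solve = solve-∀

  level-reflect : ∀ z → level (-1ℤ - z) ≡ -1ℤ - level z
  level-reflect z = level-unique (ι (cell z)) (-1ℤ - level z)
    (trans (cong (λ y → -1ℤ - y) (level-spec z)) (trans (solve (e (cell z)) S (level z))
      (cong (_+ S * (-1ℤ - level z)) (sym (e-ι (cell z))))))
    where
    solve : ∀ e s k → -1ℤ - (e + s * k) ≡ s - 1ℤ - e + s * (-1ℤ - k)
    solve = solve-∀

  -- Subtracting t advances the position by one, and `d` does not increase along positions. From the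
  -- last position one returns to the first: `d` may then grow by up to 2 q, but the passage through
  -- a full period lowers the level by t ≥ 2 q.
  level-−T : ∀ z → level (z - T) ℤ.≤ level z
  level-−T z with suc (toℕ (position (cell z))) ℕ.<? s
  ... | yes l = ℤ.≤-trans (ℤ.≤-reflexive (level-unique y (d y - d x + level z)
          (trans (cong (_- T) (level-spec z)) (modulo T P-y (solve c T S (P x) (P y) (d x) (d y) (level z))))))
        (ℤ.≤-trans (ℤ.+-monoˡ-≤ (level z) (ℤ.i≤j⇒i-j≤0 (d-antitone x y x≤y)))
          (ℤ.≤-reflexive (ℤ.+-identityˡ (level z))))
    where
    x = cell z
    y = cellAt (fromℕ< l)
    toℕ-y : toℕ (position y) ≡ suc (toℕ (position x))
    toℕ-y = trans (cong toℕ (position-cellAt (fromℕ< l))) (Fin.toℕ-fromℕ< l)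
    P-y : P y ≡ 1ℤ + P x
    P-y = cong +_ toℕ-y
    x≤y : position x Fin.≤ position y
    x≤y = subst (toℕ (position x) ℕ.≤_) (sym toℕ-y) (ℕ.n≤1+n _)
    solve : ∀ c t s x y dx dy k → c - t * x - s * dx + s * k - t ≡
              c - t * y - s * dy + s * (dy - dx + k) + t * (y - (1ℤ + x))
    solve = solve-∀
  ... | no ¬l = ℤ.≤-trans (ℤ.≤-reflexive (level-unique y (d y + - d x - T + level z)
          (trans (cong (_- T) (level-spec z)) (modulo (- T) P-x (modulo T P-y (solve c T S (P x) (P y) (d x) (d y) (level z)))))))
        (ℤ.≤-trans (ℤ.+-monoˡ-≤ (level z) (ℤ.i≤j⇒i-j≤0 (ℤ.≤-trans (ℤ.+-mono-≤ (d≤q y) (-d≤q x)) 2q≤T)))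
          (ℤ.≤-reflexive (ℤ.+-identityˡ (level z))))
    where
    x = cell z
    0<s : 0 ℕ.< s
    0<s = ℕ.>-nonZero⁻¹ s
    y = cellAt (fromℕ< 0<s)
    P-y : P y ≡ 0ℤ
    P-y = cong +_ (trans (cong toℕ (position-cellAt (fromℕ< 0<s))) (Fin.toℕ-fromℕ< 0<s))
    P-x : 1ℤ + P x ≡ S
    P-x = cong +_ (ℕ.≤-antisym (Fin.toℕ<n (position x)) (ℕ.≮⇒≥ ¬l))
    2q≤T : + q + + q ℤ.≤ T
    2q≤T = +≤+ (ℕ.+-monoʳ-≤ q (ℕ.m≤n+m q δ))
    solve : ∀ c t s x y dx dy k → c - t * x - s * dx + s * k - t ≡
              c - t * y - s * dy + s * (dy + - dx - t + k) + - t * (1ℤ + x - s) + t * (y - 0ℤ)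
    solve = solve-∀

  -- A crude bound: no arm reaches R s. Taking a multiple of s lets the sum over arms split evenly
  -- into residue classes later.
  R : ℕ
  R = ℤ.∣ c ∣ ℕ.+ q

  e≤ : ∀ x → e x ℤ.≤ S * + R
  e≤ x = begin
    c - T * P x - S * d x  ≡⟨ solve₁ c (T * P x) S (d x) ⟩
    c - T * P x + S * - d x  ≤⟨ ℤ.+-mono-≤ (ℤ.+-mono-≤ (i≤+∣i∣ c) T*P≥0) (ℤ.*-monoˡ-≤-nonNeg S (-d≤q x)) ⟩
    + ℤ.∣ c ∣ + 0ℤ + S * + q  ≡⟨ cong (_+ S * + q) (ℤ.+-identityʳ (+ ℤ.∣ c ∣)) ⟩
    + ℤ.∣ c ∣ + S * + q  ≤⟨ ℤ.+-monoˡ-≤ (S * + q) (+≤+ (ℕ.m≤n*m ℤ.∣ c ∣ s)) ⟩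
    + (s ℕ.* ℤ.∣ c ∣) + S * + q  ≡⟨ cong (_+ S * + q) (ℤ.pos-* s ℤ.∣ c ∣) ⟩
    S * + ℤ.∣ c ∣ + S * + q  ≡⟨ ℤ.*-distribˡ-+ S (+ ℤ.∣ c ∣) (+ q) ⟨
    S * + R ∎
    where
    open ℤ.≤-Reasoning
    solve₁ : ∀ c a s d → c - a - s * d ≡ c - a + s * - d
    solve₁ = solve-∀
    T*P≥0 : - (T * P x) ℤ.≤ 0ℤ
    T*P≥0 = ℤ.≤-trans (ℤ.neg-mono-≤ (ℤ.≤-reflexive (ℤ.pos-* t (toℕ (position x)))))
              (ℤ.neg-≤-pos {t ℕ.* toℕ (position x)} {0})

  χ : ℕ → Bool
  χ a = does (level (+ a) ℤ.<? 0ℤ)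

  χ-true : ∀ {a} → χ a ≡ true → level (+ a) ℤ.< 0ℤ
  χ-true {a} eq with level (+ a) ℤ.<? 0ℤ
  ... | yes l = l

  χ-below : ∀ {a} → level (+ a) ℤ.< 0ℤ → χ a ≡ true
  χ-below {a} l with level (+ a) ℤ.<? 0ℤ
  ... | yes _ = refl
  ... | no ¬l = contradiction l ¬l

  arm<Rs : ∀ {a} → level (+ a) ℤ.< 0ℤ → a ℕ.< R ℕ.* s
  arm<Rs {a} l = ℤ.drop‿+<+ (begin-strict
    + a  ≡⟨ level-spec (+ a) ⟩
    e (cell (+ a)) + S * level (+ a)  <⟨ ℤ.+-monoʳ-< (e (cell (+ a))) (ℤ.*-monoˡ-<-pos S {{ℤ.positive (+<+ (ℕ.>-nonZero⁻¹ s))}} l) ⟩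
    e (cell (+ a)) + S * 0ℤ  ≡⟨ x+s*0≡x (e (cell (+ a))) S ⟩
    e (cell (+ a))  ≤⟨ e≤ (cell (+ a)) ⟩
    S * + R  ≡⟨ ℤ.*-comm S (+ R) ⟩
    + R * S  ≡⟨ ℤ.pos-* R s ⟨
    + (R ℕ.* s) ∎)
    where
    open ℤ.≤-Reasoning

  pathCore : Partition
  pathCore = fromArms χ (R ℕ.* s)

  Realizes : Pred Partition 0ℓ
  Realizes μ = ∀ z → (z ∈ betaSet μ → level z ℤ.< 0ℤ) × (level z ℤ.< 0ℤ → z ∈ betaSet μ)

  pathCore-selfConjugate : SelfConjugate pathCore
  pathCore-selfConjugate = fromArms-selfConjugate χ (R ℕ.* s)

  pathCore-realizes : Realizes pathCore
  pathCore-realizes = realize-by-nonneg pathCore pathCore-selfConjugate level level-reflect λ a →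
    (λ ∈B → χ-true (proj₂ (fromArms-beta⇒ χ (R ℕ.* s) ∈B))) ,
    (λ l → fromArms-beta⇐ χ (R ℕ.* s) (arm<Rs l) (χ-below l))

  pathCore∈𝒟∩𝒟 : pathCore ∈ 𝒟 s × pathCore ∈ 𝒟 t
  pathCore∈𝒟∩𝒟 =
    (closed⇒core pathCore pathCore-selfConjugate closed-s , pathCore-selfConjugate) ,
    (closed⇒core pathCore pathCore-selfConjugate closed-t , pathCore-selfConjugate)
    where
    closed-s : ∀ {z} → z ∈ betaSet pathCore → z - S ∈ betaSet pathCore
    closed-s {z} ∈B = proj₂ (pathCore-realizes (z - S)) (subst (ℤ._< 0ℤ) (sym (level-−S z))
      (ℤ.≤-<-trans (ℤ.i-j≤i (level z) 1ℤ) (proj₁ (pathCore-realizes z) ∈B)))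
    closed-t : ∀ {z} → z ∈ betaSet pathCore → z - T ∈ betaSet pathCore
    closed-t {z} ∈B = proj₂ (pathCore-realizes (z - T))
      (ℤ.≤-<-trans (level-−T z) (proj₁ (pathCore-realizes z) ∈B))

-- Paths from cores

search : ∀ {Φ : Pred ℤ 0ℓ} → (∀ v → Dec (Φ v)) → ∀ lo m → ¬ Φ lo → Φ (lo + + m) →
         Σ[ v ∈ ℤ ] (¬ Φ v × Φ (v + 1ℤ))
search {Φ} Φ? lo zero    ¬lo hi = contradiction (subst Φ (ℤ.+-identityʳ lo) hi) ¬lo
search {Φ} Φ? lo (suc m) ¬lo hi with Φ? (lo + 1ℤ)
... | yes next = lo , ¬lo , next
... | no ¬next = search Φ? (lo + 1ℤ) m ¬next (subst Φ (sym (ℤ.+-assoc lo 1ℤ (+ m))) hi)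

-∣i∣≤i : ∀ i → - + ℤ.∣ i ∣ ℤ.≤ i
-∣i∣≤i (+ a)    = ℤ.neg-≤-pos {a} {a}
-∣i∣≤i -[1+ a ] = ℤ.≤-refl

0≤i+i⇒0≤i : ∀ i → 0ℤ ℤ.≤ i + i → 0ℤ ℤ.≤ i
0≤i+i⇒0≤i (+ a) _ = +≤+ z≤n

i≡-i⇒i≡0 : ∀ i → i ≡ - i → i ≡ 0ℤ
i≡-i⇒i≡0 (+ zero) _ = refl

≤-halve : ∀ a q δ → δ ℕ.≤ 1 → a ℕ.+ a ℕ.≤ q ℕ.+ (δ ℕ.+ q) → a ℕ.≤ q
≤-halve a q δ δ≤1 l = ℕ.≮⇒≥ λ q<a → ℕ.<⇒≱ (s≤s (ℕ.+-monoʳ-≤ q (ℕ.+-monoˡ-≤ q δ≤1)))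
  (ℕ.≤-trans (ℕ.+-mono-≤ q<a q<a) l)

module Thresholds (𝕊 : Setting) (μ : Partition)
  (μ∈𝒟s : μ ∈ 𝒟 (Setting.s 𝕊)) (μ∈𝒟t : μ ∈ 𝒟 (Setting.t 𝕊)) where
  open Cells 𝕊

  Φ : ℤ → ℤ → Set
  Φ a v = c - T * a - S * v ∈ betaSet μ

  private
    sc : SelfConjugate μ
    sc = proj₂ μ∈𝒟s

    Φ-suc : ∀ a v → Φ a v → Φ a (v + 1ℤ)
    Φ-suc a v φ = subst (_∈ betaSet μ) (solve (c - T * a) S v) (core⇒closed μ sc (proj₁ μ∈𝒟s) φ)
      where
      solve : ∀ x s v → x - s * v - s ≡ x - s * (v + 1ℤ)
      solve = solve-∀

    Φ-+ : ∀ a v m → Φ a v → Φ a (v + + m)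
    Φ-+ a v zero    φ = subst (Φ a) (sym (ℤ.+-identityʳ v)) φ
    Φ-+ a v (suc m) φ = subst (Φ a) (solve v (+ m)) (Φ-suc a (v + + m) (Φ-+ a v m φ))
      where
      solve : ∀ v m → v + m + 1ℤ ≡ v + (1ℤ + m)
      solve = solve-∀

  Φ-≤ : ∀ a {v w} → v ℤ.≤ w → Φ a v → Φ a w
  Φ-≤ a {v} {w} v≤w φ = subst (Φ a)
    (trans (cong (λ x → v + x) (ℤ.0≤i⇒+∣i∣≡i (ℤ.i≤j⇒0≤j-i v≤w))) (i+[j-i]≡j v w))
    (Φ-+ a v ℤ.∣ w - v ∣ φ)

  private
    above : ∀ z → + part μ 0 ℤ.≤ z → ¬ (z ∈ betaSet μ)
    above (+ b) (+≤+ l) = betaSet-above μ l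

    below : ∀ z → z ℤ.≤ -[1+ bound μ ] → z ∈ betaSet μ
    below -[1+ b ] (-≤- l) = betaSet-below μ l

  threshold : ∀ a → Σ[ v ∈ ℤ ] (¬ Φ a v × Φ a (v + 1ℤ))
  threshold a = search (λ v → betaSet? μ sc _) (- + N₀) (N₀ ℕ.+ N₁)
    (above _ (begin
      + part μ 0  ≡⟨ solve₀ (+ ℤ.∣ w ∣) (+ part μ 0) ⟩
      - + ℤ.∣ w ∣ + + N₀  ≤⟨ ℤ.+-mono-≤ (-∣i∣≤i w) (+≤+ (ℕ.m≤n*m N₀ s)) ⟩
      w + + (s ℕ.* N₀)  ≡⟨ cong (λ x → w + x) (ℤ.pos-* s N₀) ⟩
      w + S * + N₀  ≡⟨ solve₁ w S (+ N₀) ⟩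
      w - S * - + N₀ ∎))
    (subst (Φ a) (solve₂ (+ N₀) (+ N₁)) (below _ (begin
      w - S * + N₁  ≡⟨ cong (λ x → w - x) (ℤ.pos-* s N₁) ⟨
      w - + (s ℕ.* N₁)  ≤⟨ ℤ.+-mono-≤ (i≤+∣i∣ w) (ℤ.neg-mono-≤ (+≤+ (ℕ.m≤n*m N₁ s))) ⟩
      + ℤ.∣ w ∣ - + N₁  ≡⟨ solve₃ (+ ℤ.∣ w ∣) (+ bound μ) ⟩
      -[1+ bound μ ] ∎)))
    where
    open ℤ.≤-Reasoning
    w = c - T * a
    -- The starting value -N₀ puts the point w + s N₀ at or above μ₀, hence beyond the greatest
    -- element of the beta-set. The final value N₁ puts w - s N₁ so low that only empty rows are
    -- met, where every integer belongs to it.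
    N₀ = ℤ.∣ w ∣ ℕ.+ part μ 0
    N₁ = suc (ℤ.∣ w ∣ ℕ.+ bound μ)
    solve₀ : ∀ w p → p ≡ - w + (w + p)
    solve₀ = solve-∀
    solve₁ : ∀ w s p → w + s * p ≡ w - s * - p
    solve₁ = solve-∀
    solve₂ : ∀ x y → y ≡ - x + (x + y)
    solve₂ = solve-∀
    solve₃ : ∀ w b → w - (1ℤ + (w + b)) ≡ - (1ℤ + b)
    solve₃ = solve-∀

-- A self-conjugate (s,t)-core is described by the function V for which
-- c − T a − S v belongs to the beta-set exactly when v > V a.
module CorePath (𝕊 : Setting) (μ : Partition)
  (μ∈𝒟s : μ ∈ 𝒟 (Setting.s 𝕊)) (μ∈𝒟t : μ ∈ 𝒟 (Setting.t 𝕊))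
  (V : ℤ → ℤ) (¬Φ-V : ∀ a → ¬ Thresholds.Φ 𝕊 μ μ∈𝒟s μ∈𝒟t a (V a))
  (Φ-V+1 : ∀ a → Thresholds.Φ 𝕊 μ μ∈𝒟s μ∈𝒟t a (V a + 1ℤ)) where
  open Cells 𝕊
  open Thresholds 𝕊 μ μ∈𝒟s μ∈𝒟t using (Φ; Φ-≤)

  private
    sc : SelfConjugate μ
    sc = proj₂ μ∈𝒟s

    V<⇒Φ : ∀ a {v} → V a ℤ.< v → Φ a v
    V<⇒Φ a {v} V<v = Φ-≤ a (ℤ.≤-trans (ℤ.≤-reflexive (ℤ.+-comm (V a) 1ℤ)) (ℤ.i<j⇒suc[i]≤j V<v))
                       (Φ-V+1 a)

    Φ⇒V< : ∀ a {v} → Φ a v → V a ℤ.< v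
    Φ⇒V< a φ = ℤ.≰⇒> λ v≤V → ¬Φ-V a (Φ-≤ a v≤V φ)

    -- The values v with `Φ a v` form the ray above `V a`; an inclusion of one ray, translated by
    -- `j`, in another is an inequality between their thresholds.
    V-≤ : ∀ a b j → (∀ v → Φ a v → Φ b (v + j)) → V b ℤ.≤ V a + j
    V-≤ a b j f = ℤ.≮⇒≥ λ l → ℤ.<-irrefl refl
      (Φ⇒V< b (subst (Φ b) (solve (V b) j) (f _ (V<⇒Φ a (Va<Vb-j l)))))
      where
      solve : ∀ v j → v - j + j ≡ v
      solve = solve-∀
      Va<Vb-j : V a + j ℤ.< V b → V a ℤ.< V b - j
      Va<Vb-j l = subst (ℤ._< V b - j) (trans (ℤ.+-assoc (V a) j (- j))
        (trans (cong (λ x → V a + x) (ℤ.+-inverseʳ j)) (ℤ.+-identityʳ (V a)))) (ℤ.+-monoˡ-< (- j) l)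

    V-suc : ∀ a → V (a + 1ℤ) ℤ.≤ V a
    V-suc a = ℤ.≤-trans (V-≤ a (a + 1ℤ) 0ℤ λ v φ → subst (_∈ betaSet μ) (solve c T S a v)
                (core⇒closed μ sc (proj₁ μ∈𝒟t) φ)) (ℤ.≤-reflexive (ℤ.+-identityʳ (V a)))
      where
      solve : ∀ c t s a v → c - t * a - s * v - t ≡ c - t * (a + 1ℤ) - s * (v + 0ℤ)
      solve = solve-∀

    V-+ : ∀ a m → V (a + + m) ℤ.≤ V a
    V-+ a zero    = ℤ.≤-reflexive (cong V (ℤ.+-identityʳ a))
    V-+ a (suc m) = ℤ.≤-trans (ℤ.≤-reflexive (cong V (solve a (+ m)))) (ℤ.≤-trans (V-suc (a + + m)) (V-+ a m))
      where
      solve : ∀ a m → a + (1ℤ + m) ≡ a + m + 1ℤ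
      solve = solve-∀

    V-antitone : ∀ {a b} → a ℤ.≤ b → V b ℤ.≤ V a
    V-antitone {a} {b} a≤b = subst (λ x → V x ℤ.≤ V a)
      (trans (cong (λ x → a + x) (ℤ.0≤i⇒+∣i∣≡i (ℤ.i≤j⇒0≤j-i a≤b))) (i+[j-i]≡j a b)) (V-+ a ℤ.∣ b - a ∣)

    V-period : ∀ a → V a ℤ.≤ V (a + S) + T
    V-period a = V-≤ (a + S) a T λ v φ → subst (_∈ betaSet μ) (solve c T S a v) φ
      where
      solve : ∀ c t s a v → c - t * (a + s) - s * v ≡ c - t * a - s * (v + t)
      solve = solve-∀

    reflect-point : ∀ a v → -1ℤ - (c - T * a - S * v) ≡ c - T * (S - 1ℤ - a) - S * (1ℤ - v)
    reflect-point a v = modulo -1ℤ c+c (solve c T S a v)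
      where
      solve : ∀ c t s a v → -1ℤ - (c - t * a - s * v) ≡
        c - t * (s - 1ℤ - a) - s * (1ℤ - v) + -1ℤ * (c + c - (s - 1ℤ) * (t + 1ℤ))
      solve = solve-∀

    Φ-reflect : ∀ a v → Φ a v → ¬ Φ (S - 1ℤ - a) (1ℤ - v)
    Φ-reflect a v φ φ′ = betaSet-exclusive μ sc φ (subst (_∈ betaSet μ) (sym (reflect-point a v)) φ′)

    ¬Φ-reflect : ∀ a v → ¬ Φ a v → Φ (S - 1ℤ - a) (1ℤ - v)
    ¬Φ-reflect a v ¬φ = [ (λ φ → contradiction φ ¬φ) , subst (_∈ betaSet μ) (reflect-point a v) ]′
      (betaSet-total μ sc _)

  V-reflect : ∀ a → V (S - 1ℤ - a) ≡ - V a
  V-reflect a = ℤ.≤-antisym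
    (ℤ.≮⇒≥ λ l → ℤ.<-irrefl refl (ℤ.<-≤-trans
      (Φ⇒V< _ (¬Φ-reflect a (V a) (¬Φ-V a))) (ℤ.i<j⇒suc[i]≤j l)))
    (ℤ.≮⇒≥ λ l → Φ-reflect a (V a + 1ℤ) (Φ-V+1 a)
      (subst (Φ (S - 1ℤ - a)) (solve (V a)) (V<⇒Φ _ l)))
    where
    solve : ∀ v → - v ≡ 1ℤ - (v + 1ℤ)
    solve = solve-∀

  private
    -- As i ≤ s - 1 - i in the first half, monotonicity and reflection give V i ≥ -V i.
    V≥0 : ∀ i → 0ℤ ℤ.≤ V (+ toℕ {n} i)
    V≥0 i = 0≤i+i⇒0≤i v (ℤ.≤-trans (ℤ.i≤j⇒0≤j-i (ℤ.≤-trans (ℤ.≤-reflexive (sym (V-reflect (+ toℕ i)))) (V-antitone i≤)))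
              (ℤ.≤-reflexive (cong (λ x → v + x) (ℤ.neg-involutive v))))
      where
      v = V (+ toℕ i)
      i≤ : + toℕ i ℤ.≤ S - 1ℤ - + toℕ i
      i≤ = subst₂ ℤ._≤_ (solve₁ (+ toℕ i)) (solve₂ S (+ toℕ i)) (ℤ.+-monoˡ-≤ (-1ℤ - + toℕ i) 2i<s)
        where
        solve₁ : ∀ i → 1ℤ + (i + i) + (-1ℤ - i) ≡ i
        solve₁ = solve-∀
        solve₂ : ∀ s i → s + (-1ℤ - i) ≡ s - 1ℤ - i
        solve₂ = solve-∀
        2i<s : + suc (toℕ i ℕ.+ toℕ i) ℤ.≤ S
        2i<s = +≤+ (ℕ.+-mono-≤ (Fin.toℕ<n i) (ℕ.≤-trans (ℕ.<⇒≤ (Fin.toℕ<n i)) (ℕ.m≤n+m n ε)))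

    f : Fin n → ℕ
    f i = ℤ.∣ V (+ toℕ i) ∣

    +f : ∀ i → + f i ≡ V (+ toℕ i)
    +f i = ℤ.0≤i⇒+∣i∣≡i (V≥0 i)

    f-antitone : ∀ {i j} → i Fin.≤ j → f j ℕ.≤ f i
    f-antitone {i} {j} i≤j = ℤ.drop‿+≤+ (subst₂ ℤ._≤_ (sym (+f j)) (sym (+f i)) (V-antitone (+≤+ i≤j)))

    -- Since s - 1 - a ≤ a + s, one has V a ≤ V (a + s) + t ≤ V (s - 1 - a) + t = t - V a, that is,
    -- 2 V a ≤ t.
    f≤q : ∀ i → f i ℕ.≤ q
    f≤q i = ≤-halve (f i) q δ δ≤1 (ℤ.drop‿+≤+ (begin
      + f i + + f i  ≡⟨ cong₂ _+_ (+f i) (+f i) ⟩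
      v + v  ≤⟨ ℤ.+-monoˡ-≤ v (ℤ.≤-trans (V-period a) (ℤ.+-monoˡ-≤ T (V-antitone far))) ⟩
      V (S - 1ℤ - a) + T + v  ≡⟨ cong (λ x → x + T + v) (V-reflect a) ⟩
      - v + T + v  ≡⟨ solve v T ⟩
      T ∎))
      where
      open ℤ.≤-Reasoning
      a = + toℕ i
      v = V a
      solve : ∀ v t → - v + t + v ≡ t
      solve = solve-∀
      far : S - 1ℤ - a ℤ.≤ a + S
      far = ℤ.≤-trans (ℤ.i-j≤i (S - 1ℤ) a) (ℤ.≤-trans (ℤ.i-j≤i S 1ℤ) (ℤ.i≤j+i S a))

  path : Path n q
  path = proj₁ (fromHeights q f f-antitone f≤q)

  height-path : ∀ i → + height path i ≡ V (+ toℕ i)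
  height-path i = trans (cong +_ (proj₂ (fromHeights q f f-antitone f≤q) i)) (+f i)

  open PathCore 𝕊 path using (d; e; level; level-spec; Realizes)

  private
    V-P : ∀ x → V (P x) ≡ d x
    V-P (upper i) = trans (cong V (P-pos i)) (sym (height-path i))
    V-P (lower i)  = trans (cong V (P-ι (upper i)))
                               (trans (V-reflect _) (cong -_ (V-P (upper i))))
    V-P x@(inj₂ m) = i≡-i⇒i≡0 _ (trans (cong V (P-ι x)) (V-reflect (P x)))

    point : ∀ z → c - T * P (cell z) - S * (d (cell z) - level z) ≡ z
    point z = trans (solve (c - T * P (cell z)) S (d (cell z)) (level z)) (sym (level-spec z))
      where
      solve : ∀ x s d k → x - s * (d - k) ≡ x - s * d + s * k
      solve = solve-∀

  path-realizes : Realizes μ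
  path-realizes z =
    (λ ∈B → neg (level z) (subst (ℤ._< d x - level z) (V-P x)
       (Φ⇒V< (P x) (subst (_∈ betaSet μ) (sym (point z)) ∈B)))) ,
    (λ l → subst (_∈ betaSet μ) (point z) (V<⇒Φ (P x)
       (subst (ℤ._< d x - level z) (sym (V-P x)) (pos (level z) l))))
    where
    x = cell z
    pos : ∀ k → k ℤ.< 0ℤ → d x ℤ.< d x - k
    pos k l = subst (ℤ._< d x - k) (ℤ.+-identityʳ (d x)) (ℤ.+-monoʳ-< (d x) (ℤ.neg-mono-< l))
    neg : ∀ k → d x ℤ.< d x - k → k ℤ.< 0ℤ
    neg (+ k)    l = contradiction (ℤ.i-j≤i (d x) (+ k)) (ℤ.<⇒≱ l)
    neg -[1+ k ] l = -<+

-- Enumeration of the simultaneous cores by paths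

module CoreEnumeration (𝕊 : Setting) where
  open Cells 𝕊
  private module C = PathCore 𝕊

  -- The integer `C.e p x` has level 0 for p, so it is outside the beta-set. Its level for p′ is the
  -- difference of the two values of `d` at x, which therefore cannot be negative; exchanging the
  -- paths gives equality.
  realizes-injective : ∀ {p p′ μ} → C.Realizes p μ → C.Realizes p′ μ → p ≡ p′
  realizes-injective {p} {p′} {μ} rp rp′ = height-injective p p′ λ i →
    ℕ.≤-antisym (height-≤ p p′ rp rp′ i) (height-≤ p′ p rp′ rp i)
    where
    height-≤ : ∀ p p′ → C.Realizes p μ → C.Realizes p′ μ → ∀ i → height p i ℕ.≤ height p′ i
    height-≤ p p′ rp rp′ i = ℤ.drop‿+≤+ (ℤ.0≤i-j⇒j≤i (ℤ.≮⇒≥ λ l →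
      ℤ.<-irrefl (C.level-e p x) (proj₁ (rp (C.e p x)) (proj₂ (rp′ (C.e p x))
        (subst (ℤ._< 0ℤ) (sym (C.level-unique p′ x (C.d p′ x - C.d p x)
          (solve (c - T * P x) S (C.d p x) (C.d p′ x)))) l)))))
      where
      x = upper i
      solve : ∀ a s d d′ → a - s * d ≡ a - s * d′ + s * (d′ - d)
      solve = solve-∀

  realizes-part : ∀ {p μ ν} → C.Realizes p μ → C.Realizes p ν → part μ ≗ part ν
  realizes-part {p} {μ} {ν} rμ rν = betaSet-≐⇒part-≗ μ ν
    ((λ {z} ∈B → proj₂ (rν z) (proj₁ (rμ z) ∈B)) , (λ {z} ∈B → proj₂ (rμ z) (proj₁ (rν z) ∈B)))

  realizes-resp : ∀ {p μ ν} → part μ ≗ part ν → C.Realizes p μ → C.Realizes p ν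
  realizes-resp {p} {μ} {ν} eq r z =
    (λ ∈B → proj₁ (r z) (part-≗⇒betaSet-⊆ ν μ (λ i → sym (eq i)) ∈B)) ,
    (λ l → part-≗⇒betaSet-⊆ μ ν eq (proj₂ (r z) l))

  pathOf : ∀ μ → μ ∈ 𝒟 s × μ ∈ 𝒟 t → Σ[ p ∈ Path n q ] C.Realizes p μ
  pathOf μ (μ∈𝒟s , μ∈𝒟t) = CorePath.path 𝕊 μ μ∈𝒟s μ∈𝒟t V ¬Φ-V Φ-V+1 ,
                           CorePath.path-realizes 𝕊 μ μ∈𝒟s μ∈𝒟t V ¬Φ-V Φ-V+1
    where
    threshold = Thresholds.threshold 𝕊 μ μ∈𝒟s μ∈𝒟t
    V = λ a → proj₁ (threshold a)
    ¬Φ-V = λ a → proj₁ (proj₂ (threshold a))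
    Φ-V+1 = λ a → proj₂ (proj₂ (threshold a))

  cores : Finite (𝒟∩𝒟 s t)
  cores = record
    { card = pathCount n q
    ; enumeration = record
      { to        = λ i → C.pathCore (pathAt n q i) , C.pathCore∈𝒟∩𝒟 (pathAt n q i)
      ; from      = λ { (μ , μ∈) → pathIndex (proj₁ (pathOf μ μ∈)) }
      ; to-cong   = λ { refl r → refl }
      ; from-cong = λ { {μ , μ∈} {ν , ν∈} eq → cong pathIndex (realizes-injective {μ = ν}
                      (realizes-resp {μ = μ} {ν} eq (proj₂ (pathOf μ μ∈))) (proj₂ (pathOf ν ν∈))) }
      ; inverse   =
        (λ { {μ , μ∈} refl → realizes-part {μ = C.pathCore (pathAt n q (pathIndex (proj₁ (pathOf μ μ∈))))} {μ}
               (C.pathCore-realizes _)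
               (subst (λ p → C.Realizes p μ) (sym (pathAt-index (proj₁ (pathOf μ μ∈)))) (proj₂ (pathOf μ μ∈))) }) ,
        (λ { {i} {μ , μ∈} eq → trans (cong pathIndex (realizes-injective {μ = μ} (proj₂ (pathOf μ μ∈))
               (realizes-resp {μ = C.pathCore (pathAt n q i)} {μ} (λ r → sym (eq r)) (C.pathCore-realizes (pathAt n q i)))))
               (pathIndex-at n q i) })
      }
    }

-- Counting signed permutations

HasCard : Setoid 0ℓ 0ℓ → ℕ → Set
HasCard A N = Σ[ F ∈ Finite A ] card F ≡ N

hasCard-via : ∀ {A B N} → HasCard A N → Inverse A B → HasCard B N
hasCard-via (F , eq) A↔B = record { card = card F ; enumeration = Compose.inverse (enumeration F) A↔B } , eq

hasCard-× : ∀ {A B M N} → HasCard A M → HasCard B N → HasCard (×-setoid A B) (M ℕ.* N)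
hasCard-× {A} {B} (F , refl) (G , refl) = record { card = card F ℕ.* card G ; enumeration = record
  { to        = λ k → let (i , j) = Fin.remQuot (card G) k in F.to i , G.to j
  ; from      = λ { (a , b) → Fin.combine (F.from a) (G.from b) }
  ; to-cong   = λ { refl → Setoid.refl A , Setoid.refl B }
  ; from-cong = λ { (p , q) → cong₂ Fin.combine (F.from-cong p) (G.from-cong q) }
  ; inverse   = (λ { {a , b} refl → subst (λ ij → Setoid._≈_ (×-setoid A B) (F.to (proj₁ ij) , G.to (proj₂ ij)) (a , b))
                      (sym (Fin.remQuot-combine (F.from a) (G.from b))) (F.inverseˡ refl , G.inverseˡ refl) })
              , (λ { {k} (p , q) → trans (cong₂ Fin.combine (F.inverseʳ p) (G.inverseʳ q))
                      (Fin.combine-remQuot {card F} (card G) k) }) } } , refl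
  where
  module F = Inverse (enumeration F)
  module G = Inverse (enumeration G)

hasCard-Fin : ∀ N → HasCard (≡.setoid (Fin N)) N
hasCard-Fin N = record { card = N ; enumeration = Identity.inverse (≡.setoid (Fin N)) } , refl

Perms : ∀ {n} → (Fin n → ℕ) → Setoid 0ℓ 0ℓ
Perms {n} v = subsetoid (On.setoid (Fin n →-setoid Fin n) _⟨$⟩ʳ_) (λ ρ → ∀ i → v (ρ ⟨$⟩ʳ i) ≡ v i)

Signs : ∀ {n} → (ℕ → Bool) → (Fin n → ℕ) → Setoid 0ℓ 0ℓ
Signs {n} free v = subsetoid (Fin n →-setoid Bool) (λ σ → ∀ i → free (v i) ≡ false → σ i ≡ false)

transpose-second : ∀ {n} (i j : Fin n) → PC.transpose i j j ≡ i
transpose-second i j with j Fin.≟ i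
... | yes j≡i = j≡i
... | no _ with j Fin.≟ j
... | yes _  = refl
... | no j≢j = contradiction refl j≢j

transpose-colour : ∀ {n} (v : Fin n → ℕ) {i j} → v i ≡ v j → ∀ k → v (PC.transpose i j k) ≡ v k
transpose-colour v {i} {j} eq k with k Fin.≟ i
... | yes refl = sym eq
... | no _ with k Fin.≟ j
... | yes refl = eq
... | no _     = refl

module _ {n m} (v : Fin (suc n) → ℕ) (J : Fin m → Fin (suc n)) (v-J : ∀ j → v (J j) ≡ v zero)
         (J⁻¹ : ∀ k → v k ≡ v zero → Fin m) (J-J⁻¹ : ∀ k eq → J (J⁻¹ k eq) ≡ k)
         (J-injective : ∀ {i j} → J i ≡ J j → i ≡ j) where

  -- Orbit and stabilizer of the index 0: its image is one of the m indices of the same colour,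
  -- listed by `J`, and composing with a transposition reduces to a permutation fixing 0. The
  -- transposition joins two indices of equal colour and so preserves the colouring.
  perms-step : ∀ {N} → HasCard (Perms (v ∘ suc)) N → HasCard (Perms v) (m ℕ.* N)
  perms-step F = hasCard-via (hasCard-× (hasCard-Fin m) F) (record
    { to        = to
    ; from      = from
    ; to-cong   = λ {x} {y} → to-cong {x} {y}
    ; from-cong = λ { {ρ , ρ-v} {ρ′ , ρ-v′} eq → J-injective (trans (J-J⁻¹ _ (ρ-v zero))
                      (trans (eq zero) (sym (J-J⁻¹ _ (ρ-v′ zero))))) ,
                    λ k → Fin.suc-injective (trans (fix ρ (suc k)) (trans
                      (cong₂ (λ y z → PC.transpose zero y z) (eq zero) (eq (suc k))) (sym (fix ρ′ (suc k))))) }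
    ; inverse   = (λ { {ρ , ρ-v} {y} eq k → trans (to-cong {y} {from (ρ , ρ-v)} eq k) (trans
                      (cong₂ (λ y z → PC.transpose y zero z) (J-J⁻¹ _ (ρ-v zero)) (fix ρ k))
                      (PC.transpose-inverse (ρ ⟨$⟩ʳ zero) zero)) })
                , (λ { {j , ρ , _} {ρ′ , ρ-v′} eq → J-injective (trans (J-J⁻¹ _ (ρ-v′ zero)) (head j ρ ρ′ eq)) ,
                      λ k → Fin.suc-injective (trans (fix ρ′ (suc k)) (trans
                        (cong₂ (λ y z → PC.transpose zero y z) (head j ρ ρ′ eq) (eq (suc k)))
                        (PC.transpose-inverse zero (J j)))) })
    })
    where
    to : Fin m × Setoid.Carrier (Perms (v ∘ suc)) → Setoid.Carrier (Perms v)
    to (j , ρ , ρ-v) = Perm.lift₀ ρ Perm.∘ₚ Perm.transpose (J j) zero , λ k →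
      trans (transpose-colour v (v-J j) (Perm.lift₀ ρ ⟨$⟩ʳ k)) (lifted k)
      where
      lifted : ∀ k → v (Perm.lift₀ ρ ⟨$⟩ʳ k) ≡ v k
      lifted zero    = refl
      lifted (suc k) = ρ-v k

    to-cong : ∀ {x y} → Setoid._≈_ (×-setoid (≡.setoid (Fin m)) (Perms (v ∘ suc))) x y →
              Setoid._≈_ (Perms v) (to x) (to y)
    to-cong {j , ρ , _} {_ , ρ′ , _} (refl , eq) k =
      cong (PC.transpose (J j) zero) (Perm.lift₀-cong ρ ρ′ eq k)

    straighten : Permutation′ (suc n) → Permutation′ (suc n)
    straighten ρ = ρ Perm.∘ₚ Perm.transpose zero (ρ ⟨$⟩ʳ zero)

    fix : ∀ ρ k → Perm.lift₀ (Perm.remove zero (straighten ρ)) ⟨$⟩ʳ k ≡ straighten ρ ⟨$⟩ʳ k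
    fix ρ = Perm.lift₀-remove (straighten ρ) (transpose-second zero (ρ ⟨$⟩ʳ zero))

    from : Setoid.Carrier (Perms v) → Fin m × Setoid.Carrier (Perms (v ∘ suc))
    from (ρ , ρ-v) = J⁻¹ (ρ ⟨$⟩ʳ zero) (ρ-v zero) , Perm.remove zero (straighten ρ) , λ k →
      trans (cong v (fix ρ (suc k)))
        (trans (transpose-colour v (sym (ρ-v zero)) (ρ ⟨$⟩ʳ suc k)) (ρ-v (suc k)))

    head : ∀ j ρ ρ′ → (∀ k → ρ′ ⟨$⟩ʳ k ≡ (Perm.lift₀ ρ Perm.∘ₚ Perm.transpose (J j) zero) ⟨$⟩ʳ k) →
           ρ′ ⟨$⟩ʳ zero ≡ J j
    head j ρ ρ′ eq = trans (eq zero) (transpose-second (J j) zero)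

perms-empty : ∀ (v : Fin 0 → ℕ) → HasCard (Perms v) 1
perms-empty v = record { card = 1 ; enumeration = record
  { to        = λ _ → Perm.id , λ ()
  ; from      = λ _ → zero
  ; to-cong   = λ _ ()
  ; from-cong = λ _ → refl
  ; inverse   = (λ _ ()) , λ { {zero} _ → refl } } } , refl

signs-empty : ∀ free (v : Fin 0 → ℕ) → HasCard (Signs free v) 1
signs-empty free v = record { card = 1 ; enumeration = record
  { to        = λ _ → (λ ()) , λ ()
  ; from      = λ _ → zero
  ; to-cong   = λ _ ()
  ; from-cong = λ _ → refl
  ; inverse   = (λ _ ()) , λ { {zero} _ → refl } } } , refl

signCount : Bool → ℕ
signCount free = if free then 2 else 1

Sign : Bool → Setoid 0ℓ 0ℓ
Sign free = subsetoid (≡.setoid Bool) (λ b → free ≡ false → b ≡ false)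

hasCard-Sign : ∀ free → HasCard (Sign free) (signCount free)
hasCard-Sign true = record { card = 2 ; enumeration = record
  { to        = λ { zero → false , λ _ → refl ; (suc _) → true , λ () }
  ; from      = λ { (false , _) → zero ; (true , _) → suc zero }
  ; to-cong   = λ { refl → refl }
  ; from-cong = λ { {false , _} {false , _} _ → refl ; {true , _} {true , _} _ → refl }
  ; inverse   = (λ { {false , _} refl → refl ; {true , _} refl → refl })
              , λ { {zero} {false , _} _ → refl ; {suc zero} {true , _} _ → refl } } } , refl
hasCard-Sign false = record { card = 1 ; enumeration = record
  { to        = λ _ → false , λ _ → refl
  ; from      = λ _ → zero
  ; to-cong   = λ _ → refl
  ; from-cong = λ _ → refl
  ; inverse   = (λ { {b , b≡} _ → sym (b≡ refl) }) , λ { {zero} _ → refl } } } , refl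

signs-step : ∀ {n N} free (v : Fin (suc n) → ℕ) → HasCard (Signs free (v ∘ suc)) N →
             HasCard (Signs free v) (signCount (free (v zero)) ℕ.* N)
signs-step free v F = hasCard-via (hasCard-× (hasCard-Sign (free (v zero))) F) (record
  { to        = λ { ((b , b≡) , (σ , σ≡)) → (λ { zero → b ; (suc i) → σ i }) ,
                                            (λ { zero → b≡ ; (suc i) → σ≡ i }) }
  ; from      = λ { (σ , σ≡) → (σ zero , σ≡ zero) , (σ ∘ suc , σ≡ ∘ suc) }
  ; to-cong   = λ { (p , q) zero → p ; (p , q) (suc i) → q i }
  ; from-cong = λ eq → eq zero , eq ∘ suc
  ; inverse   = (λ { (p , q) zero → p ; (p , q) (suc i) → q i }) , λ eq → eq zero , eq ∘ suc
  })

top≤ : ∀ {n q} (p : Path n (suc q)) → top p ℕ.≤ n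
top≤ (stop p) = z≤n
top≤ (take p) = s≤s (top≤ p)

height-top : ∀ {n q} (p : Path n (suc q)) i → toℕ i ℕ.< top p → height p i ≡ suc q
height-top (take p) zero    _       = refl
height-top (take p) (suc i) (s≤s l) = height-top p i l

top-height : ∀ {n q} (p : Path n (suc q)) i → height p i ≡ suc q → toℕ i ℕ.< top p
top-height (stop p) i           eq = contradiction (height≤ p i) (ℕ.<⇒≱ (ℕ.≤-reflexive (sym eq)))
top-height (take p) zero    _  = s≤s z≤n
top-height (take p) (suc i) eq = s≤s (top-height p i eq)

permCount : ∀ {n q} → Path n q → ℕ
permCount (base {n}) = n !
permCount (stop p)       = permCount p
permCount (take p)       = suc (top p) ℕ.* permCount p

hasCard-Perms-base : ∀ {n} → HasCard (Perms {n} (λ _ → 0)) (n !)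
hasCard-Perms-base {zero}  = perms-empty _
hasCard-Perms-base {suc n} =
  perms-step _ id (λ _ → refl) (λ k _ → k) (λ _ _ → refl) id (hasCard-Perms-base {n})

hasCard-Perms : ∀ {n q} (p : Path n q) → HasCard (Perms (height p)) (permCount p)
hasCard-Perms base     = hasCard-Perms-base
hasCard-Perms (stop p) = hasCard-Perms p
-- Since heights decrease, the indices sharing the colour of the first entry are exactly the first
-- `suc (top p)` ones.
hasCard-Perms (take {n} {q} p) = perms-step (height (take p)) J
  (λ j → height-top (take p) (J j) (subst (ℕ._< suc (top p)) (sym (Fin.toℕ-inject≤ j _)) (Fin.toℕ<n j)))
  (λ k eq → fromℕ< (top-height (take p) k eq))
  (λ k eq → Fin.toℕ-injective (trans (Fin.toℕ-inject≤ _ _) (Fin.toℕ-fromℕ< _)))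
  (λ {i} {j} eq → Fin.toℕ-injective (trans (sym (Fin.toℕ-inject≤ i _)) (trans (cong toℕ eq) (Fin.toℕ-inject≤ j _))))
  (hasCard-Perms p)
  where
  J : Fin (suc (top p)) → Fin (suc n)
  J j = Fin.inject≤ j (s≤s (top≤ p))

module _ (free : ℕ → Bool) where

  signsCount : ∀ {n q} → Path n q → ℕ
  signsCount (base {n})       = signCount (free 0) ℕ.^ n
  signsCount (stop p)         = signsCount p
  signsCount (take {q = q} p) = signCount (free (suc q)) ℕ.* signsCount p

  hasCard-Signs-base : ∀ {n} → HasCard (Signs {n} free (λ _ → 0)) (signCount (free 0) ℕ.^ n)
  hasCard-Signs-base {zero}  = signs-empty free _
  hasCard-Signs-base {suc n} = signs-step free _ (hasCard-Signs-base {n})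

  hasCard-Signs : ∀ {n q} (p : Path n q) → HasCard (Signs free (height p)) (signsCount p)
  hasCard-Signs base           = hasCard-Signs-base
  hasCard-Signs (stop p)       = hasCard-Signs p
  hasCard-Signs (take p)       = signs-step free (height (take p)) (hasCard-Signs p)

  private
    interchange : ∀ a b c d → a ℕ.* b ℕ.* (c ℕ.* d) ≡ c ℕ.* a ℕ.* (b ℕ.* d)
    interchange = ℕ-Ring.solve-∀

  groupOrder-× : ∀ {n q} (p : Path n q) → permCount p ℕ.* signsCount p ≡ groupOrder (signCount ∘ free) p
  groupOrder-× base     = refl
  groupOrder-× (stop p) = groupOrder-× p
  groupOrder-× (take {q = q} p) = trans
    (interchange (suc (top p)) (permCount p) (signCount (free (suc q))) (signsCount p))
    (cong (signCount (free (suc q)) ℕ.* suc (top p) ℕ.*_) (groupOrder-× p))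

-- Stabilizers

i+i≡j+j⇒i≡j : ∀ i j → i + i ≡ j + j → i ≡ j
i+i≡j+j⇒i≡j i j eq = ℤ.*-cancelˡ-≡ (+ 2) i j (trans (double i) (trans eq (sym (double j))))
  where
  double : ∀ i → + 2 * i ≡ i + i
  double = solve-∀

antisymmetric-sum : ∀ s (F : Fin s → ℤ) → (∀ i → F (opposite i) ≡ + s - 1ℤ - F i) →
                    ∑ℤ F + ∑ℤ F ≡ ∑ℤ (λ (_ : Fin s) → + s - 1ℤ)
antisymmetric-sum s F anti = begin
  ∑ℤ F + ∑ℤ F  ≡⟨ cong (λ x → ∑ℤ F + x) (∑ℤ-permute F Perm.reverse) ⟩
  ∑ℤ F + ∑ℤ (λ i → F (opposite i))    ≡⟨ ∑ℤ-distrib-+ F (λ i → F (opposite i)) ⟨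
  ∑ℤ (λ i → F i + F (opposite i))     ≡⟨ ∑ℤ-cong (λ i → trans (cong (λ x → F i + x) (anti i)) (cancel (F i) (+ s))) ⟩
  ∑ℤ (λ (_ : Fin s) → + s - 1ℤ) ∎
  where
  open ≡-Reasoning
  cancel : ∀ x s → x + (s - 1ℤ - x) ≡ s - 1ℤ
  cancel = solve-∀

+opposite : ∀ {s} (i : Fin s) → + toℕ (opposite i) ≡ + s - 1ℤ - + toℕ i
+opposite {s} i = modulo 1ℤ (cong +_ (trans (cong (ℕ._+ suc (toℕ i)) (Fin.opposite-prop i))
    (ℕ.m∸n+n≡m (Fin.toℕ<n i)))) (solve (+ toℕ (opposite i)) (+ toℕ i) (+ s))
  where
  solve : ∀ o i s → o ≡ s - 1ℤ - i + 1ℤ * (o + (1ℤ + i) - s)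
  solve = solve-∀

-- Pairing i with s - 1 - i makes twice the sum the same for every antisymmetric `F`. The inclusion
-- of residues is one such function, and its sum is known from `∑-id`.
antisymmetric-balanced : ∀ s (F : Fin s → ℤ) → (∀ i → F (opposite i) ≡ + s - 1ℤ - F i) →
                         ∑ℤ F ≡ + (s C 2)
antisymmetric-balanced s F anti = trans
  (i+i≡j+j⇒i≡j _ _ (trans (antisymmetric-sum s F anti) (sym (antisymmetric-sum s (+_ ∘ toℕ) +opposite))))
  (∑-id s)

∣-small : ∀ t {a b k} → a ℕ.≤ k → b ℕ.≤ k → k ℕ.+ k ℕ.≤ t → .{{NonZero t}} → t ℕ∣.∣ ℤ.∣ + a - + b ∣ → a ≡ b
∣-small t {a} {b} {k} a≤k b≤k 2k≤t t∣ with a ℕ.≟ b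
... | yes p = p
... | no ¬p = contradiction (ℕ.≤-trans (ℕ∣.∣⇒≤ {{ℕ.≢-nonZero abs≢0}} t∣) abs≤k) (ℕ.<⇒≱ k<t)
  where
  abs≢0 : ℤ.∣ + a - + b ∣ ≢ 0
  abs≢0 e = ¬p (ℤ.+-injective (ℤ.i-j≡0⇒i≡j (+ a) (+ b) (ℤ.∣i∣≡0⇒i≡0 e)))
  abs≤k : ℤ.∣ + a - + b ∣ ℕ.≤ k
  abs≤k = subst (λ x → ℤ.∣ x ∣ ℕ.≤ k) (sym (ℤ.m-n≡m⊖n a b)) (ℕ.≤-trans (ℤ.∣m⊝n∣≤m⊔n a b) (ℕ.⊔-lub a≤k b≤k))
  k<t : k ℕ.< t
  k<t = ℕ.<-≤-trans (ℕ.m<m+n k (ℕ.≤-trans (ℕ.n≢0⇒n>0 abs≢0) abs≤k)) 2k≤t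

-- The sum lies between 0 and 2 k ≤ t, so it is 0 or t, and the value t forces a = b = k. This is
-- the source of the two exceptional heights, 0 and t / 2, at which a cell may be sent to a mirror
-- image.
∣-sum : ∀ t {a b k} → a ℕ.≤ k → b ℕ.≤ k → k ℕ.+ k ℕ.≤ t → t ℕ∣.∣ a ℕ.+ b →
        a ≡ b × (a ≡ 0 ⊎ a ℕ.+ a ≡ t)
∣-sum t {zero} {zero} _ _ _ _ = refl , inj₁ refl
∣-sum t {a} {b} {k} a≤k b≤k 2k≤t t∣ with a ℕ.+ b ℕ.≟ 0
... | yes e = trans (ℕ.m+n≡0⇒m≡0 a e) (sym (ℕ.m+n≡0⇒n≡0 a e)) , inj₁ (ℕ.m+n≡0⇒m≡0 a e)
... | no ¬e = trans a≡k (sym b≡k) , inj₂ (trans (cong₂ ℕ._+_ a≡k a≡k) (ℕ.≤-antisym 2k≤t (ℕ.≤-trans t≤a+b (ℕ.+-mono-≤ a≤k b≤k))))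
  where
  t≤a+b : t ℕ.≤ a ℕ.+ b
  t≤a+b = ℕ∣.∣⇒≤ {{ℕ.≢-nonZero ¬e}} t∣
  2k≤a+b : k ℕ.+ k ℕ.≤ a ℕ.+ b
  2k≤a+b = ℕ.≤-trans 2k≤t t≤a+b
  a≡k : a ≡ k
  a≡k = ℕ.≤-antisym a≤k (ℕ.+-cancelʳ-≤ k k a (ℕ.≤-trans 2k≤a+b (ℕ.+-monoʳ-≤ a b≤k)))
  b≡k : b ≡ k
  b≡k = ℕ.≤-antisym b≤k (ℕ.+-cancelˡ-≤ k k b (ℕ.≤-trans 2k≤a+b (ℕ.+-monoˡ-≤ b a≤k)))

xor-cancel : ∀ b c → (b xor c) xor c ≡ b
xor-cancel false false = refl
xor-cancel false true  = refl
xor-cancel true  false = refl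
xor-cancel true  true  = refl

not-xor : ∀ b c → not b xor c ≡ not (b xor c)
not-xor false c     = refl
not-xor true  false = refl
not-xor true  true  = refl

-- A permutation of the cells commuting with ι is a permutation of the pairs
-- {x , ι x} together with a choice of signs.
module CellSymmetry (𝕊 : Setting) where
  open Cells 𝕊

  act : (Fin n → Fin n) → (Fin n → Bool) → Cell → Cell
  act ρ σ (inj₁ (i , b)) = inj₁ (ρ i , b xor σ i)
  act ρ σ (inj₂ m)       = inj₂ m

  act-ι : ∀ ρ σ x → act ρ σ (ι x) ≡ ι (act ρ σ x)
  act-ι ρ σ (inj₁ (i , b)) = cong (λ b → inj₁ (ρ i , b)) (not-xor b (σ i))
  act-ι ρ σ (inj₂ m)       = refl

  act-inverse : ∀ ρ ρ′ σ → (∀ i → ρ (ρ′ i) ≡ i) → ∀ x → act ρ σ (act ρ′ (σ ∘ ρ′) x) ≡ x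
  act-inverse ρ ρ′ σ inv (inj₁ (i , b)) = cong₂ (λ i b → inj₁ (i , b)) (inv i) (xor-cancel b (σ (ρ′ i)))
  act-inverse ρ ρ′ σ inv (inj₂ m)       = refl

  act-inverse′ : ∀ ρ ρ′ σ → (∀ i → ρ′ (ρ i) ≡ i) → ∀ x → act ρ′ (σ ∘ ρ′) (act ρ σ x) ≡ x
  act-inverse′ ρ ρ′ σ inv (inj₁ (i , b)) = cong₂ (λ i b → inj₁ (i , b)) (inv i)
    (trans (cong (λ j → (b xor σ i) xor σ j) (inv i)) (xor-cancel b (σ i)))
  act-inverse′ ρ ρ′ σ inv (inj₂ m)       = refl

  record Symmetry : Set where
    field
      π π⁻¹ : Cell → Cell
      π⁻¹∘π : ∀ x → π⁻¹ (π x) ≡ x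
      π∘π⁻¹ : ∀ x → π (π⁻¹ x) ≡ x
      π-ι   : ∀ x → π (ι x) ≡ ι (π x)

    π⁻¹-ι : ∀ x → π⁻¹ (ι x) ≡ ι (π⁻¹ x)
    π⁻¹-ι x = trans (cong (π⁻¹ ∘ ι) (sym (π∘π⁻¹ x))) (trans (cong π⁻¹ (sym (π-ι (π⁻¹ x)))) (π⁻¹∘π (ι (π⁻¹ x))))

  inverse-symmetry : Symmetry → Symmetry
  inverse-symmetry g = record { π = π⁻¹ ; π⁻¹ = π ; π⁻¹∘π = π∘π⁻¹ ; π∘π⁻¹ = π⁻¹∘π ; π-ι = π⁻¹-ι }
    where open Symmetry g

  module _ (g : Symmetry) where
    open Symmetry g

    private
      pair : ∀ (x : Cell) → (∀ (m : Fin ε) → x ≢ inj₂ m) → Σ[ jb ∈ Fin n × Bool ] x ≡ inj₁ jb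
      pair (inj₁ jb) _ = jb , refl
      pair (inj₂ m)  ≢ = contradiction refl (≢ m)

      not≢ : ∀ b → b ≢ not b
      not≢ false ()
      not≢ true ()

      -- The middle cell is fixed by ι, so it would be the image of both `upper i` and `lower i`,
      -- against injectivity.
      π-pair≢ : ∀ i m → π (upper i) ≢ inj₂ m
      π-pair≢ i m eq with trans (sym (π⁻¹∘π (upper i))) (trans (cong π⁻¹ (trans eq
        (sym (trans (π-ι (upper i)) (cong ι eq))))) (π⁻¹∘π (lower i)))
      ... | ()

      sign : Cell → Bool
      sign (inj₁ (_ , b)) = b
      sign (inj₂ _)       = false

      pairOf : ∀ i → Σ[ jb ∈ Fin n × Bool ] π (upper i) ≡ inj₁ jb
      pairOf i = pair (π (upper i)) (π-pair≢ i)

    pairImage : Fin n → Fin n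
    pairImage i = proj₁ (proj₁ (pairOf i))

    signOf : Fin n → Bool
    signOf i = proj₂ (proj₁ (pairOf i))

    π≗act : ∀ x → π x ≡ act pairImage signOf x
    π≗act (upper i) = proj₂ (pairOf i)
    π≗act (lower i)  = trans (π-ι (upper i)) (cong ι (proj₂ (pairOf i)))
    π≗act (inj₂ m) with π (inj₂ m) in eq
    ... | inj₂ m′       = cong inj₂ (Fin.toℕ-injective (trans (zero! m′) (sym (zero! m))))
      where
      zero! : ∀ (m : Fin ε) → toℕ m ≡ 0
      zero! m = ℕ.n<1⇒n≡0 (ℕ.<-≤-trans (Fin.toℕ<n m) ε≤1)
    ... | inj₁ (j , b) with trans (sym eq) (trans (π-ι (inj₂ m)) (cong ι eq))
    ... | fixed = contradiction (cong sign fixed) (not≢ b)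

  pairImage-inverse : ∀ g i → pairImage (inverse-symmetry g) (pairImage g i) ≡ i
  pairImage-inverse g i = pairIndex-injective (trans (sym (π≗act (inverse-symmetry g) _))
    (trans (cong π⁻¹ (sym (π≗act g (upper i)))) (π⁻¹∘π _)))
    where
    open Symmetry g
    pairIndex-injective : ∀ {i j : Fin n} {b c : Bool} → _≡_ {A = Cell} (inj₁ (i , b)) (inj₁ (j , c)) → i ≡ j
    pairIndex-injective refl = refl

-- Pairs of height h may be exchanged with their mirror images by a
-- permutation that preserves residues modulo t exactly if 2 h ≡ 0 mod t.
free? : ∀ t h → Dec (h ≡ 0 ⊎ h ℕ.+ h ≡ t)
free? t h = (h ℕ.≟ 0) ⊎-dec (h ℕ.+ h ℕ.≟ t)

free : ℕ → ℕ → Bool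
free t h = does (free? t h)

module StabGroup (𝕊 : Setting) (p : Path (Setting.n 𝕊) (Setting.q 𝕊)) where
  open Cells 𝕊
  open PathCore 𝕊 p
  open CellSymmetry 𝕊

  Coloured : (Cell → Cell) → Set
  Coloured π = ∀ x → T Signed.∣ e (π x) - e x

  private
    e-difference : ∀ x y → e y - e x ≡ (P x - P y) * T - S * (d y - d x)
    e-difference x y = solve c T S (P x) (P y) (d x) (d y)
      where
      solve : ∀ c t s x y dx dy → c - t * y - s * dy - (c - t * x - s * dx) ≡ (x - y) * t - s * (dy - dx)
      solve = solve-∀

    -- Modulo t the term t P vanishes, so e y - e x ≡ -s (d y - d x), and s is a unit modulo t.
    -- Preserving residues is thus a condition on `d` alone.
    ∣e⇒∣d : ∀ x y → T Signed.∣ e y - e x → t ℕ∣.∣ ℤ.∣ d y - d x ∣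
    ∣e⇒∣d x y (Signed.divides k eq) = Coprimality.coprime-divisor (Coprimality.sym coprime)
      (subst (t ℕ∣.∣_) (ℤ.abs-* S (d y - d x)) (Signed.∣⇒∣ᵤ (Signed.divides (P x - P y - k)
        (modulo 1ℤ (trans (sym eq) (e-difference x y)) (solve T S (P x) (P y) (d y - d x) k)))))
      where
      solve : ∀ t s x y dd k → s * dd ≡ (x - y - k) * t + 1ℤ * (k * t - ((x - y) * t - s * dd))
      solve = solve-∀

    ∣d⇒∣e : ∀ x y k → d y - d x ≡ k * T → T Signed.∣ e y - e x
    ∣d⇒∣e x y k eq = Signed.divides (P x - P y - S * k) (trans (e-difference x y)
      (trans (cong (λ D → (P x - P y) * T - S * D) eq) (solve T S (P x) (P y) k)))
      where
      solve : ∀ t s x y k → (x - y) * t - s * (k * t) ≡ (x - y - s * k) * t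
      solve = solve-∀

    2q≤t : q ℕ.+ q ℕ.≤ t
    2q≤t = ℕ.+-monoʳ-≤ q (ℕ.m≤n+m q δ)

  coloured⇒height : ∀ i j b → T Signed.∣ e (inj₁ (j , b)) - e (upper i) →
                    height p j ≡ height p i × (free t (height p i) ≡ false → b ≡ false)
  coloured⇒height i j false t∣ =
    ∣-small t (height≤ p j) (height≤ p i) 2q≤t (∣e⇒∣d (upper i) (upper j) t∣) , λ _ → refl
  coloured⇒height i j true t∣ with ∣-sum t (height≤ p j) (height≤ p i) 2q≤t
    (subst (t ℕ∣.∣_) ∣-sum∣ (∣e⇒∣d (upper i) (lower j) t∣))
    where
    ∣-sum∣ : ℤ.∣ - + height p j - + height p i ∣ ≡ height p j ℕ.+ height p i
    ∣-sum∣ = trans (cong ℤ.∣_∣ (sym (ℤ.neg-distrib-+ (+ height p j) (+ height p i))))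
               (ℤ.∣-i∣≡∣i∣ (+ height p j + + height p i))
  ... | h≡ , fr = h≡ , λ not-free → contradiction
          (trans (sym (dec-true (free? t (height p i)) (subst (λ h → h ≡ 0 ⊎ h ℕ.+ h ≡ t) h≡ fr))) not-free) λ ()

  act-coloured : ∀ ρ σ → (∀ i → height p (ρ i) ≡ height p i) →
                 (∀ i → free t (height p i) ≡ false → σ i ≡ false) → Coloured (act ρ σ)
  act-coloured ρ σ ρ-h σ-h (inj₂ m) = Signed.divides 0ℤ (ℤ.+-inverseʳ (e (inj₂ m)))
  act-coloured ρ σ ρ-h σ-h (lower i) with act-coloured ρ σ ρ-h σ-h (upper i)
  ... | Signed.divides k eq = Signed.divides (- k) (trans (cong₂ _-_
          (trans (cong e (act-ι ρ σ (upper i))) (e-ι (act ρ σ (upper i))))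
          (e-ι (upper i)))
          (modulo -1ℤ eq (solve S (e (act ρ σ (upper i))) (e (upper i)) k T)))
    where
    solve : ∀ s x y k t → s - 1ℤ - x - (s - 1ℤ - y) ≡ - k * t + -1ℤ * (x - y - k * t)
    solve = solve-∀
  act-coloured ρ σ ρ-h σ-h (upper i) with σ i in eq
  ... | false = ∣d⇒∣e (upper i) (inj₁ (ρ i , false)) 0ℤ
                  (trans (cong (λ h → + h - + height p i) (ρ-h i)) (ℤ.+-inverseʳ (+ height p i)))
  ... | true with free? t (height p i) in fr
  ... | no _ = contradiction (trans (sym eq) (σ-h i (cong does fr))) λ ()
  ... | yes (inj₁ h≡0) = ∣d⇒∣e (upper i) (inj₁ (ρ i , true)) 0ℤ
                  (cong₂ (λ h k → - + h - + k) (trans (ρ-h i) h≡0) h≡0)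
  -- Here `d` changes from h to -h, a difference of -2 h = -t; hence the quotient -1.
  ... | yes (inj₂ 2h≡t) = ∣d⇒∣e (upper i) (inj₁ (ρ i , true)) -1ℤ
                  (trans (cong (λ h → - + h - + height p i) (ρ-h i))
                    (trans (sym (ℤ.neg-distrib-+ (+ height p i) (+ height p i)))
                      (trans (cong (-_ ∘ +_) 2h≡t) (sym (ℤ.-1*i≡-i T)))))

  -- The only extension that commutes with translation by s: each integer is written as `e x` plus s
  -- times its level, and the level is kept.
  lift : (Cell → Cell) → ℤ → ℤ
  lift π z = e (π (cell z)) + S * level z

  cell-lift : ∀ π z → cell (lift π z) ≡ π (cell z)
  cell-lift π z = cell-e+ (π (cell z)) (level z)

  level-lift : ∀ π z → level (lift π z) ≡ level z
  level-lift π z = level-unique (π (cell z)) (level z) refl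

  lift-∘ : ∀ π π′ → (∀ x → π (π′ x) ≡ x) → ∀ z → lift π (lift π′ z) ≡ z
  lift-∘ π π′ inv z = trans (cong₂ (λ x k → e (π x) + S * k) (cell-lift π′ z) (level-lift π′ z))
    (trans (cong (λ x → e x + S * level z) (inv (cell z))) (sym (level-spec z)))

  lift-shift : ∀ π z → lift π (z + S) ≡ lift π z + S
  lift-shift π z = trans (cong₂ (λ x k → e (π x) + S * k) (cell-+S z) (level-unique (cell z) (level z + 1ℤ)
      (trans (cong (_+ S) (level-spec z)) (solve (e (cell z)) S (level z)))))
    (sym (solve (e (π (cell z))) S (level z)))
    where
    solve : ∀ e s k → e + s * k + s ≡ e + s * (k + 1ℤ)
    solve = solve-∀

  lift-reflect : ∀ π → (∀ x → π (ι x) ≡ ι (π x)) → ∀ z → lift π (-1ℤ - z) ≡ -1ℤ - lift π z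
  lift-reflect π π-ι z = trans (cong₂ (λ x k → e x + S * k)
      (trans (cong π (cell-reflect z)) (π-ι (cell z))) (level-reflect z))
    (trans (cong (_+ S * (-1ℤ - level z)) (e-ι (π (cell z)))) (solve (e (π (cell z))) S (level z)))
    where
    solve : ∀ e s k → s - 1ℤ - e + s * (-1ℤ - k) ≡ -1ℤ - (e + s * k)
    solve = solve-∀

  toH : (g : Symmetry) → Coloured (Symmetry.π g) → H s t
  toH g coloured = record
    { permutation = mk↔ₛ′ (lift π) (lift π⁻¹) (lift-∘ π π⁻¹ π∘π⁻¹) (lift-∘ π⁻¹ π π⁻¹∘π)
    ; shift       = lift-shift π
    ; balanced    = antisymmetric-balanced s (λ i → lift π (+ toℕ i)) λ i →
        trans (cong (lift π) (trans (+opposite i) (s-1-x≡-1-x+s S (+ toℕ i))))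
          (trans (lift-shift π (-1ℤ - + toℕ i)) (trans (cong (_+ S) (lift-reflect π π-ι (+ toℕ i)))
            (sym (s-1-x≡-1-x+s S (lift π (+ toℕ i))))))
    ; mod-t       = λ z → Signed.∣⇒∣ᵤ (subst (T Signed.∣_) (sym (difference z)) (coloured (cell z)))
    ; odd         = lift-reflect π π-ι
    }
    where
    open Symmetry g
    difference : ∀ z → lift π z - z ≡ e (π (cell z)) - e (cell z)
    difference z = trans (cong (λ y → lift π z - y) (level-spec z)) (solve (e (π (cell z))) (e (cell z)) (S * level z))
      where
      solve : ∀ x y k → x + k - (y + k) ≡ x - y
      solve = solve-∀

module StabCard (𝕊 : Setting) (p : Path (Setting.n 𝕊) (Setting.q 𝕊)) (μ : Partition)
  (μ∈𝒟 : μ ∈ 𝒟 (Setting.s 𝕊)) (realizes : PathCore.Realizes 𝕊 p μ) where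
  open Cells 𝕊
  open PathCore 𝕊 p
  open CellSymmetry 𝕊
  open StabGroup 𝕊 p

  private
    boundary : ∀ k → k - 1ℤ ℤ.< 0ℤ → ¬ (k ℤ.< 0ℤ) → k ≡ 0ℤ
    boundary (+ zero)  _ _ = refl
    boundary (+ suc k) (+<+ ()) _
    boundary -[1+ k ]  _ k≮0 = contradiction -<+ k≮0

    -- The beta-set is where the level is negative, and subtracting s lowers the level by one.
    -- Membership in the s-set therefore means level 0.
    sSet⇒ : ∀ {x} → x ∈ sSet s μ → e (cell x) ≡ x
    sSet⇒ {x} (x-S∈B , x∉B) = sym (trans (level-spec x) (trans (cong (λ k → e (cell x) + S * k)
      (boundary (level x) (subst (ℤ._< 0ℤ) (level-−S x) (proj₁ (realizes (x - S)) x-S∈B))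
         (λ l → x∉B (proj₂ (realizes x) l)))) (x+s*0≡x (e (cell x)) S)))

    e∈sSet : ∀ x → e x ∈ sSet s μ
    e∈sSet x =
      proj₂ (realizes (e x - S)) (subst (ℤ._< 0ℤ) (sym (trans (level-−S (e x)) (cong (_- 1ℤ) (level-e x)))) -<+) ,
      λ ∈B → ℤ.<-irrefl (level-e x) (proj₁ (realizes (e x)) ∈B)

    lift-e : ∀ π x → lift π (e x) ≡ e (π x)
    lift-e π x = trans (cong₂ (λ y k → e (π y) + S * k) (cell-e x) (level-e x)) (x+s*0≡x (e (π x)) S)

    lift-sSet : ∀ π {x} → x ∈ sSet s μ → lift π x ∈ sSet s μ
    lift-sSet π {x} x∈S = subst (_∈ sSet s μ)
      (trans (sym (lift-e π (cell x))) (cong (lift π) (sSet⇒ x∈S))) (e∈sSet (π (cell x)))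

    stabilizes : (γ : Symmetry) (coloured : Coloured (Symmetry.π γ)) → toH γ coloured · μ ↦ μ
    stabilizes γ coloured = μ∈𝒟 ,
      (λ {x} x∈S → lift π⁻¹ x , lift-sSet π⁻¹ x∈S , lift-∘ π π⁻¹ π∘π⁻¹ x) ,
      (λ { (x , x∈S , refl) → lift-sSet π x∈S })
      where open Symmetry γ

    module FromStab (f : H s t) (fμ↦μ : f · μ ↦ μ) where
      open Inverse (H.permutation f) using (strictlyInverseʳ) renaming (to to F; from to F⁻¹)

      π π⁻¹ : Cell → Cell
      π x   = cell (F (e x))
      π⁻¹ x = cell (F⁻¹ (e x))

      e-π : ∀ x → e (π x) ≡ F (e x)
      e-π x = sSet⇒ (proj₂ (proj₂ fμ↦μ) (e x , e∈sSet x , refl))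

      -- The other inclusion of the stabilizer condition enters here: `e x` is the image of an
      -- element of the s-set, so `F⁻¹` also maps the s-set to itself.
      e-π⁻¹ : ∀ x → e (π⁻¹ x) ≡ F⁻¹ (e x)
      e-π⁻¹ x = let (y , y∈S , Fy≡) = proj₁ (proj₂ fμ↦μ) (e∈sSet x) in
        sSet⇒ (subst (_∈ sSet s μ) (trans (sym (strictlyInverseʳ y)) (cong F⁻¹ Fy≡)) y∈S)

      F-reflect : ∀ z → F (S - 1ℤ - z) ≡ S - 1ℤ - F z
      F-reflect z = trans (cong F (s-1-x≡-1-x+s S z)) (trans (H.shift f (-1ℤ - z))
        (trans (cong (_+ S) (H.odd f z)) (sym (s-1-x≡-1-x+s S (F z)))))

      symmetry : Symmetry
      symmetry = record
        { π     = π
        ; π⁻¹   = π⁻¹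
        ; π⁻¹∘π = λ x → trans (cong (cell ∘ F⁻¹) (e-π x)) (trans (cong cell (strictlyInverseʳ (e x))) (cell-e x))
        ; π∘π⁻¹ = λ x → trans (cong (cell ∘ F) (e-π⁻¹ x)) (trans (cong cell (Inverse.strictlyInverseˡ (H.permutation f) (e x))) (cell-e x))
        ; π-ι   = λ x → trans (cong cell (trans (cong F (e-ι x)) (trans (F-reflect (e x))
                    (trans (cong (λ y → S - 1ℤ - y) (sym (e-π x))) (sym (e-ι (π x))))))) (cell-e (ι (π x)))
        }

      coloured : Coloured π
      coloured x = subst (λ y → T Signed.∣ y - e x) (sym (e-π x)) (Signed.∣ᵤ⇒∣ (H.mod-t f (e x)))

      F-+ : ∀ z m → F (z + S * + m) ≡ F z + S * + m
      F-+ z zero    = trans (cong F (x+s*0≡x z S)) (sym (x+s*0≡x (F z) S))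
      F-+ z (suc m) = trans (cong F (solve z S (+ m))) (trans (H.shift f (z + S * + m))
          (trans (cong (_+ S) (F-+ z m)) (sym (solve (F z) S (+ m)))))
        where
        solve : ∀ z s m → z + s * (1ℤ + m) ≡ z + s * m + s
        solve = solve-∀

      F-periodic : ∀ z k → F (z + S * k) ≡ F z + S * k
      F-periodic z (+ m)    = F-+ z m
      F-periodic z -[1+ m ] = trans (solve₁ (F (z + S * - (+ suc m))) S (+ suc m))
          (cong (_+ S * - (+ suc m)) (trans (sym (F-+ (z + S * - (+ suc m)) (suc m))) (cong F (solve₂ z S (+ suc m)))))
        where
        solve₁ : ∀ x s m → x ≡ x + s * m + s * - m
        solve₁ = solve-∀
        solve₂ : ∀ z s m → z + s * - m + s * m ≡ z
        solve₂ = solve-∀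

      -- The s-set meets every class modulo s, so a map commuting with translation by s is
      -- determined by its values there. This makes the correspondence with signed permutations
      -- injective.
      lift-π : ∀ z → lift π z ≡ F z
      lift-π z = trans (cong (_+ S * level z) (e-π (cell z)))
        (trans (sym (F-periodic (e (cell z)) (level z))) (cong F (sym (level-spec z))))

    SignedPerms : Setoid 0ℓ 0ℓ
    SignedPerms = ×-setoid (Perms (height p)) (Signs (free t) (height p))

    open Symmetry

    actSymmetry : Permutation′ n → (Fin n → Bool) → Symmetry
    actSymmetry ρ σ = record
      { π = act (ρ ⟨$⟩ʳ_) σ ; π⁻¹ = act (ρ ⟨$⟩ˡ_) (σ ∘ (ρ ⟨$⟩ˡ_))
      ; π⁻¹∘π = act-inverse′ (ρ ⟨$⟩ʳ_) (ρ ⟨$⟩ˡ_) σ (λ _ → Perm.inverseˡ ρ)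
      ; π∘π⁻¹ = act-inverse (ρ ⟨$⟩ʳ_) (ρ ⟨$⟩ˡ_) σ (λ _ → Perm.inverseʳ ρ)
      ; π-ι   = act-ι (ρ ⟨$⟩ʳ_) σ }

    act-cong : ∀ {ρ ρ′ σ σ′} → ρ ≗ ρ′ → σ ≗ σ′ → act ρ σ ≗ act ρ′ σ′
    act-cong ρ≗ σ≗ (inj₁ (i , b)) = cong₂ (λ i c → inj₁ (i , b xor c)) (ρ≗ i) (σ≗ i)
    act-cong ρ≗ σ≗ (inj₂ m)       = refl

    pair-injective : ∀ {i j : Fin n} {b c : Bool} → _≡_ {A = Cell} (inj₁ (i , b)) (inj₁ (j , c)) → i ≡ j × b ≡ c
    pair-injective refl = refl , refl

    lift-cong : ∀ {π π′} → π ≗ π′ → lift π ≗ lift π′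
    lift-cong eq z = cong (λ x → e x + S * level z) (eq (cell z))

    to : Setoid.Carrier SignedPerms → Setoid.Carrier (Stab s t μ)
    to ((ρ , ρ-h) , (σ , σ-h)) = toH (actSymmetry ρ σ) coloured , stabilizes (actSymmetry ρ σ) coloured
      where coloured = act-coloured (ρ ⟨$⟩ʳ_) σ ρ-h σ-h

    from : Setoid.Carrier (Stab s t μ) → Setoid.Carrier SignedPerms
    from (f , fμ↦μ) =
      (Perm.permutation (pairImage γ) (pairImage γ⁻¹) (pairImage-inverse γ⁻¹) (pairImage-inverse γ) ,
        λ i → proj₁ (heights i)) ,
      (signOf γ , λ i → proj₂ (heights i))
      where
      open FromStab f fμ↦μ
      γ = symmetry
      γ⁻¹ = inverse-symmetry γ
      heights = λ i → coloured⇒height i (pairImage γ i) (signOf γ i)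
        (subst (λ y → T Signed.∣ e y - e (upper i)) (π≗act γ (upper i)) (coloured (upper i)))

    agree : ∀ (f f′ : Setoid.Carrier (Stab s t μ)) → (∀ z → H.to (proj₁ f) z ≡ H.to (proj₁ f′) z) →
            Setoid._≈_ SignedPerms (from f) (from f′)
    agree (f , a) (f′ , a′) eq = (λ i → proj₁ (same i)) , (λ i → proj₂ (same i))
      where
      γ = FromStab.symmetry f a
      γ′ = FromStab.symmetry f′ a′
      same : ∀ i → pairImage γ i ≡ pairImage γ′ i × signOf γ i ≡ signOf γ′ i
      same i = pair-injective (trans (sym (π≗act γ (upper i)))
        (trans (cong cell (eq (e (upper i)))) (π≗act γ′ (upper i))))

    to-from : ∀ f z → H.to (proj₁ (to (from f))) z ≡ H.to (proj₁ f) z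
    to-from (f , a) z = trans (lift-cong (λ x → sym (π≗act (FromStab.symmetry f a) x)) z) (FromStab.lift-π f a z)

    from-to : ∀ γ → Setoid._≈_ SignedPerms (from (to γ)) γ
    from-to γ@((ρ , ρ-h) , (σ , σ-h)) = (λ i → proj₁ (same i)) , (λ i → proj₂ (same i))
      where
      f = to γ
      γ′ = FromStab.symmetry (proj₁ f) (proj₂ f)
      same : ∀ i → pairImage γ′ i ≡ ρ ⟨$⟩ʳ i × signOf γ′ i ≡ σ i
      same i = pair-injective (trans (sym (π≗act γ′ (upper i)))
        (trans (cong cell (lift-e (act (ρ ⟨$⟩ʳ_) σ) (upper i))) (cell-e (inj₁ (ρ ⟨$⟩ʳ i , σ i)))))

  hasCard-Stab : HasCard (Stab s t μ) (groupOrder (signCount ∘ free t) p)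
  hasCard-Stab = subst (HasCard (Stab s t μ)) (groupOrder-× (free t) p)
    (hasCard-via (hasCard-× (hasCard-Perms p) (hasCard-Signs (free t) p)) (record
      { to        = to
      ; from      = from
      ; to-cong   = λ { (ρ≗ , σ≗) z → lift-cong (act-cong ρ≗ σ≗) z }
      ; from-cong = λ {f} {f′} eq → agree f f′ eq
      ; inverse   = (λ { {f} {γ} eq z → trans (lift-cong (act-cong (proj₁ eq) (proj₂ eq)) z) (to-from f z) })
                  , (λ { {γ} {f} eq → Setoid.trans SignedPerms {i = from f} {j = from (to γ)} {k = γ}
                          (agree f (to γ) eq) (from-to γ) })
      }))

-- The size of a core

∑ℤ-splitAt : ∀ m {n} (f : Fin (m ℕ.+ n) → ℤ) →
             ∑ℤ f ≡ ∑ℤ (λ i → f (i ↑ˡ n)) + ∑ℤ (λ j → f (m ↑ʳ j))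
∑ℤ-splitAt zero    f = sym (ℤ.+-identityˡ _)
∑ℤ-splitAt (suc m) f = trans (cong (λ x → f zero + x) (∑ℤ-splitAt m (f ∘ suc))) (sym (ℤ.+-assoc (f zero) _ _))

∑ℤ-combine : ∀ m {n} (f : Fin (m ℕ.* n) → ℤ) →
             ∑ℤ f ≡ ∑ℤ (λ i → ∑ℤ (λ j → f (Fin.combine {m} {n} i j)))
∑ℤ-combine zero        f = refl
∑ℤ-combine (suc m) {n} f = trans (∑ℤ-splitAt n f)
  (cong (λ x → ∑ℤ (λ j → f (j ↑ˡ (m ℕ.* n))) + x) (∑ℤ-combine m (λ i → f (n ↑ʳ i))))

∑ℤ-zero : ∀ n (f : Fin n → ℤ) → (∀ i → f i ≡ 0ℤ) → ∑ℤ f ≡ 0ℤ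
∑ℤ-zero zero    f f≡0 = refl
∑ℤ-zero (suc n) f f≡0 = cong₂ _+_ (f≡0 zero) (∑ℤ-zero n (f ∘ suc) (f≡0 ∘ suc))

∑ℤ-last : ∀ n (f : ℕ → ℤ) → ∑ℤ (λ (i : Fin (suc n)) → f (toℕ i)) ≡ ∑ℤ (λ (i : Fin n) → f (toℕ i)) + f n
∑ℤ-last n f = trans (∑ℤ-init-last (λ (i : Fin (suc n)) → f (toℕ i)))
  (cong₂ _+_ (∑ℤ-cong (λ (i : Fin n) → cong f (Fin.toℕ-inject₁ i))) (cong f (Fin.toℕ-fromℕ n)))

∑ℤ-truncate : ∀ (f h : ℕ → ℤ) {k} R → k ℕ.≤ R → (∀ {v} → v ℕ.< k → f v ≡ h v) → (∀ {v} → k ℕ.≤ v → f v ≡ 0ℤ) →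
              ∑ℤ (λ (v : Fin R) → f (toℕ v)) ≡ ∑ℤ (λ (v : Fin k) → h (toℕ v))
∑ℤ-truncate f h {k} R k≤R f≡h f≡0 with ℕ.≤⇒≤′ k≤R
... | ℕ.≤′-reflexive refl = ∑ℤ-cong (λ v → f≡h (Fin.toℕ<n v))
... | ℕ.≤′-step {R′} k≤R′ = trans (∑ℤ-last R′ f) (trans
        (cong₂ _+_ (∑ℤ-truncate f h R′ (ℕ.≤′⇒≤ k≤R′) f≡h f≡0) (f≡0 (ℕ.≤′⇒≤ k≤R′))) (ℤ.+-identityʳ _))

-- The total size of the principal hooks with arms i + s v for 0 ≤ v < k.
classSize : ℤ → ℤ → ℤ → ℤ
classSize s i k = s * (k * k) + (i + i + 1ℤ - s) * k

∑-hookSizes : ∀ s i k → ∑ℤ (λ (v : Fin k) → hookSize (s ℕ.* toℕ v ℕ.+ i)) ≡ classSize (+ s) (+ i) (+ k)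
∑-hookSizes s i zero    = solve (+ s) (+ i)
  where
  solve : ∀ s i → 0ℤ ≡ s * (0ℤ * 0ℤ) + (i + i + 1ℤ - s) * 0ℤ
  solve = solve-∀
∑-hookSizes s i (suc k) = trans (∑ℤ-last k (λ v → hookSize (s ℕ.* v ℕ.+ i))) (trans
  (cong₂ _+_ (∑-hookSizes s i k) (cong (λ x → 1ℤ + (x + + i + (x + + i))) (ℤ.pos-* s k)))
  (solve (+ s) (+ i) (+ k)))
  where
  solve : ∀ s i k → s * (k * k) + (i + i + 1ℤ - s) * k + (1ℤ + (s * k + i + (s * k + i))) ≡
          s * ((1ℤ + k) * (1ℤ + k)) + (i + i + 1ℤ - s) * (1ℤ + k)
  solve = solve-∀

-- Only the case σ = m = s is wanted, where the right side collapses to s³ - s; σ is kept separate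
-- so that the induction on m leaves the summand alone.
∑-squares : ∀ σ m → + 3 * ∑ℤ (λ (i : Fin m) → (+ toℕ i + + toℕ i + 1ℤ - σ) * (+ toℕ i + + toℕ i + 1ℤ - σ)) ≡
            + 4 * (+ m * + m * + m) - + m - + 6 * σ * (+ m * + m) + + 3 * σ * σ * + m
∑-squares σ zero = solve σ
  where
  solve : ∀ σ → 0ℤ ≡ + 4 * (0ℤ * 0ℤ * 0ℤ) - 0ℤ - + 6 * σ * (0ℤ * 0ℤ) + + 3 * σ * σ * 0ℤ
  solve = solve-∀
∑-squares σ (suc m) = trans (cong (λ x → + 3 * x) (∑ℤ-last m sq)) (trans
  (ℤ.*-distribˡ-+ (+ 3) (∑ℤ (λ (i : Fin m) → sq (toℕ i))) (sq m))
  (trans (cong (λ x → x + + 3 * sq m) (∑-squares σ m)) (solve σ (+ m))))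
  where
  sq : ℕ → ℤ
  sq i = (+ i + + i + 1ℤ - σ) * (+ i + + i + 1ℤ - σ)
  solve : ∀ σ m → + 4 * (m * m * m) - m - + 6 * σ * (m * m) + + 3 * σ * σ * m + + 3 * ((m + m + 1ℤ - σ) * (m + m + 1ℤ - σ)) ≡
          + 4 * ((1ℤ + m) * (1ℤ + m) * (1ℤ + m)) - (1ℤ + m) - + 6 * σ * ((1ℤ + m) * (1ℤ + m)) + + 3 * σ * σ * (1ℤ + m)
  solve = solve-∀

if-true : ∀ {b} {x y : ℤ} → b ≡ true → (if b then x else y) ≡ x
if-true refl = refl

if-false : ∀ {b} {x y : ℤ} → b ≡ false → (if b then x else y) ≡ y
if-false refl = refl

∑ℤ-linear : ∀ {n} a (f g h : Fin n → ℤ) → (∀ i → a * f i + g i ≡ h i) → a * ∑ℤ f + ∑ℤ g ≡ ∑ℤ h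
∑ℤ-linear {zero}  a f g h eq = trans (ℤ.+-identityʳ _) (ℤ.*-zeroʳ a)
∑ℤ-linear {suc n} a f g h eq = trans (solve a (f zero) (∑ℤ (f ∘ suc)) (g zero) (∑ℤ (g ∘ suc)))
  (cong₂ _+_ (eq zero) (∑ℤ-linear a (f ∘ suc) (g ∘ suc) (h ∘ suc) (eq ∘ suc)))
  where
  solve : ∀ a f f′ g g′ → a * (f + f′) + (g + g′) ≡ a * f + g + (a * f′ + g′)
  solve = solve-∀

v-k<0 : ∀ {v k} → v ℕ.< k → + v - + k ℤ.< 0ℤ
v-k<0 {v} {k} v<k = subst (+ v - + k ℤ.<_) (ℤ.+-inverseʳ (+ k)) (ℤ.+-monoˡ-< (- + k) (+<+ v<k))

module Size (𝕊 : Setting) (p : Path (Setting.n 𝕊) (Setting.q 𝕊)) where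
  open Cells 𝕊
  open PathCore 𝕊 p

  -- The arms in the residue class of `e x` are i + s v for 0 ≤ v < θ, and there are none if θ ≤ 0.
  i θ : Cell → ℤ
  i x = + (e x ℤ.%ℕ s)
  θ x = e x ℤ./ℕ s

  e-division : ∀ x → e x ≡ i x + θ x * S
  e-division x = ℤ.a≡a%ℕn+[a/ℕn]*n (e x) s

  private
    class : Cell → Fin s
    class x = fromℕ< (ℤ.n%ℕd<d (e x) s)

    +class : ∀ x → + toℕ (class x) ≡ i x
    +class x = cong +_ (Fin.toℕ-fromℕ< (ℤ.n%ℕd<d (e x) s))

    division-unique : ∀ x r k → r ℕ.< s → e x ≡ + r + k * S → i x ≡ + r × θ x ≡ k
    division-unique x r k r<s eq = cong +_ ix≡ , ℤ.*-cancelʳ-≡ (θ x) k S (trans (solve (i x) (θ x * S))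
        (trans (cong₂ _-_ (trans (sym (e-division x)) eq) (cong +_ ix≡)) (sym (solve (+ r) (k * S)))))
      where
      ix≡ = %ℕ-unique s (e x) k r<s eq
      solve : ∀ x y → y ≡ x + y - x
      solve = solve-∀

    iθ-ι : ∀ x → i (ι x) ≡ S - 1ℤ - i x × θ (ι x) ≡ - θ x
    iθ-ι x = let (a , b) = division-unique (ι x) (toℕ (opposite (class x))) (- θ x) (Fin.toℕ<n (opposite (class x)))
                  (trans (e-ι x) (trans (cong (λ y → S - 1ℤ - y) (e-division x)) (trans (solve S (i x) (θ x))
                    (cong (_+ - θ x * S) (sym opp))))) in trans a opp , b
      where
      opp : + toℕ (opposite (class x)) ≡ S - 1ℤ - i x
      opp = trans (+opposite (class x)) (cong (λ y → S - 1ℤ - y) (+class x))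
      solve : ∀ s i θ → s - 1ℤ - (i + θ * s) ≡ s - 1ℤ - i + - θ * s
      solve = solve-∀

    i-middle : ∀ m → i (inj₂ m) + i (inj₂ m) + 1ℤ - S ≡ 0ℤ
    i-middle m = modulo 1ℤ (proj₁ (iθ-ι (inj₂ m))) (solve (i (inj₂ m)) S)
      where
      solve : ∀ i s → i + i + 1ℤ - s ≡ 0ℤ + 1ℤ * (i - (s - 1ℤ - i))
      solve = solve-∀

    θ-middle : ∀ m → θ (inj₂ m) ≡ 0ℤ
    θ-middle m = i≡-i⇒i≡0 _ (proj₂ (iθ-ι (inj₂ m)))

    θ≤R : ∀ x → θ x ℤ.≤ + R
    θ≤R x = ℤ.*-cancelʳ-≤-pos (θ x) (+ R) S {{ℤ.positive (+<+ (ℕ.>-nonZero⁻¹ s))}} (begin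
      θ x * S  ≤⟨ ℤ.i≤j+i (θ x * S) (i x) ⟩
      i x + θ x * S  ≡⟨ e-division x ⟨
      e x  ≤⟨ e≤ x ⟩
      S * + R  ≡⟨ ℤ.*-comm S (+ R) ⟩
      + R * S ∎)
      where open ℤ.≤-Reasoning

    -- The s-set has one element in each residue class, so sums over residues may be rewritten as
    -- sums over cells.
    classes : Permutation′ s
    classes = Perm.permutation (class ∘ cellAt) (λ r → residue (+ toℕ r))
      (λ r → Fin.toℕ-injective (trans (Fin.toℕ-fromℕ< _) (%ℕ-unique s (e (cell (+ toℕ r))) (- level (+ toℕ r)) (Fin.toℕ<n r)
        (trans (solve₁ (e (cell (+ toℕ r))) S (level (+ toℕ r))) (cong (_+ - level (+ toℕ r) * S) (sym (level-spec (+ toℕ r))))))))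
      (λ r → trans (sym (position-cellAt _)) (trans (cong position (trans (cong cell (trans (+class (cellAt r))
        (solve₂ (i (cellAt r)) (θ (cellAt r)) S (e (cellAt r)) (e-division (cellAt r))))) (cell-e+ (cellAt r) (- θ (cellAt r)))))
        (position-cellAt r)))
      where
      solve₁ : ∀ e s k → e ≡ e + s * k + - k * s
      solve₁ = solve-∀
      solve₂ : ∀ i θ s e → e ≡ i + θ * s → i ≡ e + s * - θ
      solve₂ i θ s e eq = trans (solve₃ i θ s) (cong (_+ s * - θ) (sym eq))
        where
        solve₃ : ∀ i θ s → i ≡ i + θ * s + s * - θ
        solve₃ = solve-∀

  ∑-cells : ∀ (K : Cell → ℤ) → ∑ℤ (λ r → K (cellAt r)) ≡
            ∑ℤ (λ a → K (upper a) + K (lower a)) + ∑ℤ (λ m → K (inj₂ m))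
  ∑-cells K = begin
    ∑ℤ (λ r → K (cellAt r))
      ≡⟨ ∑ℤ-splitAt n {ε ℕ.+ n} (λ r → K (cellAt r)) ⟩
    ∑ℤ (λ (a : Fin n) → K (cellAt (a ↑ˡ (ε ℕ.+ n)))) + ∑ℤ K′
      ≡⟨ cong₂ _+_ (∑ℤ-cong {n} (λ a → cong K (cellAt-position (upper a)))) (∑ℤ-splitAt ε {n} K′) ⟩
    ∑ℤ K₊ + (∑ℤ (λ (m : Fin ε) → K′ (m ↑ˡ n)) + ∑ℤ (λ (a : Fin n) → K′ (ε ↑ʳ a)))
      ≡⟨ cong (λ x → ∑ℤ K₊ + x) (cong₂ _+_ (∑ℤ-cong {ε} (λ m → cong K (cellAt-position (inj₂ m))))
           (trans (∑ℤ-permute (λ (a : Fin n) → K′ (ε ↑ʳ a)) Perm.reverse)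
             (∑ℤ-cong {n} (λ a → cong K (cellAt-position (lower a)))))) ⟩
    ∑ℤ K₊ + (∑ℤ (λ m → K (inj₂ m)) + ∑ℤ K₋)
      ≡⟨ solve (∑ℤ K₊) (∑ℤ (λ m → K (inj₂ m))) (∑ℤ K₋) ⟩
    ∑ℤ K₊ + ∑ℤ K₋ + ∑ℤ (λ m → K (inj₂ m))
      ≡⟨ cong (_+ ∑ℤ (λ m → K (inj₂ m))) (∑ℤ-distrib-+ K₊ K₋) ⟨
    ∑ℤ (λ a → K (upper a) + K (lower a)) + ∑ℤ (λ m → K (inj₂ m)) ∎
    where
    open ≡-Reasoning
    K′ : Fin (ε ℕ.+ n) → ℤ
    K′ r = K (cellAt (n ↑ʳ r))
    K₊ K₋ : Fin n → ℤ
    K₊ a = K (upper a)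
    K₋ a = K (lower a)
    solve : ∀ x y z → x + (y + z) ≡ x + z + y
    solve = solve-∀

  ∑-residues : ∀ (h : Fin s → ℤ) → (∀ m → h (class (inj₂ m)) ≡ 0ℤ) →
               ∑ℤ h ≡ ∑ℤ (λ a → h (class (upper a)) + h (class (lower a)))
  ∑-residues h h≡0 = trans (∑ℤ-permute h classes) (trans (∑-cells (h ∘ class))
    (trans (cong (λ x → ∑ℤ (λ a → h (class (upper a)) + h (class (lower a))) + x)
      (∑ℤ-zero ε _ h≡0)) (ℤ.+-identityʳ _)))

  private
    term : ℕ → ℤ
    term a = if χ a then hookSize a else 0ℤ

    classTotal : Fin s → ℤ
    classTotal r = ∑ℤ (λ (v : Fin R) → term (s ℕ.* toℕ v ℕ.+ toℕ r))

    point : Cell → ℕ → ℕ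
    point x v = s ℕ.* v ℕ.+ toℕ (class x)

    level-point : ∀ x v → level (+ point x v) ≡ + v - θ x
    level-point x v = level-unique x (+ v - θ x) (trans (cong₂ _+_ (ℤ.pos-* s v) (+class x))
      (trans (solve S (+ v) (i x) (θ x)) (cong (_+ S * (+ v - θ x)) (sym (e-division x)))))
      where
      solve : ∀ s v i θ → s * v + i ≡ i + θ * s + s * (v - θ)
      solve = solve-∀

    term-out : ∀ x v → θ x ℤ.≤ + v → term (point x v) ≡ 0ℤ
    term-out x v θ≤v = if-false (dec-false (level (+ point x v) ℤ.<? 0ℤ) λ l →
      ℤ.<⇒≱ (subst (ℤ._< 0ℤ) (level-point x v) l) (ℤ.i≤j⇒0≤j-i θ≤v))

    classTotal-nonPos : ∀ x → θ x ℤ.≤ 0ℤ → classTotal (class x) ≡ 0ℤ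
    classTotal-nonPos x θ≤0 = ∑ℤ-zero R _ (λ v → term-out x (toℕ v) (ℤ.≤-trans θ≤0 (+≤+ z≤n)))

    classTotal-nonNeg : ∀ x k → θ x ≡ + k → classTotal (class x) ≡ classSize S (i x) (+ k)
    classTotal-nonNeg x k θ≡k = trans
      (∑ℤ-truncate (term ∘ point x) (hookSize ∘ point x) R (ℤ.drop‿+≤+ (subst (ℤ._≤ + R) θ≡k (θ≤R x)))
        (λ {v} v<k → if-true (χ-below (subst (ℤ._< 0ℤ)
          (sym (trans (level-point x v) (cong (λ y → + v - y) θ≡k))) (v-k<0 v<k))))
        (λ {v} k≤v → term-out x v (subst (ℤ._≤ + v) (sym θ≡k) (+≤+ k≤v))))
      (trans (∑-hookSizes s (toℕ (class x)) k) (cong (λ y → classSize S y (+ k)) (+class x)))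

    -- `θ` changes sign under ι, so at most one of two mirror classes contains arms. `classSize` is
    -- invariant under (i , k) ↦ (s - 1 - i , -k), hence one polynomial serves for both signs.
    classTotal-pair : ∀ x k → θ x ≡ k → classTotal (class x) + classTotal (class (ι x)) ≡ classSize S (i x) k
    classTotal-pair x (+ k) θ≡k = trans (cong₂ _+_ (classTotal-nonNeg x k θ≡k)
      (classTotal-nonPos (ι x) (subst (ℤ._≤ 0ℤ) (sym (trans (proj₂ (iθ-ι x)) (cong -_ θ≡k))) (ℤ.neg-≤-pos {k} {0}))))
      (ℤ.+-identityʳ _)
    classTotal-pair x -[1+ k ] θ≡k = trans (cong₂ _+_
      (classTotal-nonPos x (subst (ℤ._≤ 0ℤ) (sym θ≡k) -≤+))
      (trans (classTotal-nonNeg (ι x) (suc k) (trans (proj₂ (iθ-ι x)) (cong -_ θ≡k)))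
        (trans (cong (λ y → classSize S y (+ suc k)) (proj₁ (iθ-ι x))) (solve S (i x) (+ suc k)))))
      (ℤ.+-identityˡ _)
      where
      solve : ∀ s i k → s * (k * k) + (s - 1ℤ - i + (s - 1ℤ - i) + 1ℤ - s) * k ≡
              s * (- k * - k) + (i + i + 1ℤ - s) * - k
      solve = solve-∀

  size-classes : + size pathCore ≡ ∑ℤ (λ a → classSize S (i (upper a)) (θ (upper a)))
  size-classes = begin
    + size pathCore
      ≡⟨ size-fromArms χ (R ℕ.* s) ⟩
    ∑ℤ (λ (a : Fin (R ℕ.* s)) → term (toℕ a))
      ≡⟨ ∑ℤ-combine R {s} (λ a → term (toℕ a)) ⟩
    ∑ℤ (λ (v : Fin R) → ∑ℤ (λ (r : Fin s) → term (toℕ (Fin.combine v r))))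
      ≡⟨ ∑ℤ-cong {R} (λ v → ∑ℤ-cong {s} (λ r → cong term (Fin.toℕ-combine v r))) ⟩
    ∑ℤ (λ (v : Fin R) → ∑ℤ (λ (r : Fin s) → term (s ℕ.* toℕ v ℕ.+ toℕ r)))
      ≡⟨ ∑ℤ-comm {R} {s} (λ v r → term (s ℕ.* toℕ v ℕ.+ toℕ r)) ⟩
    ∑ℤ classTotal
      ≡⟨ ∑-residues classTotal (λ m → classTotal-nonPos (inj₂ m) (ℤ.≤-reflexive (θ-middle m))) ⟩
    ∑ℤ (λ a → classTotal (class (upper a)) + classTotal (class (lower a)))
      ≡⟨ ∑ℤ-cong {n} (λ a → classTotal-pair (upper a) _ refl) ⟩
    ∑ℤ (λ a → classSize S (i (upper a)) (θ (upper a))) ∎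
    where open ≡-Reasoning

  Y : Fin n → ℤ
  Y a = e (upper a) + e (upper a) + 1ℤ - S

  private
    W : Fin n → ℤ
    W a = i (upper a) + i (upper a) + 1ℤ - S

    ∑W² : + 3 * (∑ℤ (λ a → W a * W a) + ∑ℤ (λ a → W a * W a)) ≡ S * S * S - S
    ∑W² = begin
      + 3 * (∑ℤ (λ a → W a * W a) + ∑ℤ (λ a → W a * W a))
        ≡⟨ cong (λ x → + 3 * x) (∑ℤ-distrib-+ (λ a → W a * W a) (λ a → W a * W a)) ⟨
      + 3 * ∑ℤ (λ a → W a * W a + W a * W a)
        ≡⟨ cong (λ x → + 3 * x) (∑ℤ-cong {n} (λ a → cong₂ _+_ (square (upper a)) (square′ a))) ⟨
      + 3 * ∑ℤ (λ a → h (class (upper a)) + h (class (lower a)))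
        ≡⟨ cong (λ x → + 3 * x) (∑-residues h (λ m → trans (square (inj₂ m)) (cong (λ w → w * w) (i-middle m)))) ⟨
      + 3 * ∑ℤ h
        ≡⟨ ∑-squares S s ⟩
      + 4 * (S * S * S) - S - + 6 * S * (S * S) + + 3 * S * S * S
        ≡⟨ solve S ⟩
      S * S * S - S ∎
      where
      open ≡-Reasoning
      h : Fin s → ℤ
      h r = (+ toℕ r + + toℕ r + 1ℤ - S) * (+ toℕ r + + toℕ r + 1ℤ - S)
      square : ∀ x → h (class x) ≡ (i x + i x + 1ℤ - S) * (i x + i x + 1ℤ - S)
      square x = cong (λ y → (y + y + 1ℤ - S) * (y + y + 1ℤ - S)) (+class x)
      flip : ∀ s i → (s - 1ℤ - i + (s - 1ℤ - i) + 1ℤ - s) * (s - 1ℤ - i + (s - 1ℤ - i) + 1ℤ - s) ≡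
             (i + i + 1ℤ - s) * (i + i + 1ℤ - s)
      flip = solve-∀
      square′ : ∀ a → h (class (lower a)) ≡ W a * W a
      square′ a = trans (square (lower a)) (trans
        (cong (λ y → (y + y + 1ℤ - S) * (y + y + 1ℤ - S)) (proj₁ (iθ-ι (upper a))))
        (flip S (i (upper a))))
      solve : ∀ s → + 4 * (s * s * s) - s - + 6 * s * (s * s) + + 3 * s * s * s ≡ s * s * s - s
      solve = solve-∀

  -- Completing the square: with W = 2 i + 1 - s and Y = W + 2 s θ one has 4 s (s θ² + W θ) + W² =
  -- Y². The squares W² depend only on residues. Mirror residues give equal squares, so their sum
  -- over the pairs is half of the sum over all residues, namely (s³ - s) / 6.
  size-formula : + 24 * S * + size pathCore + (S * S * S - S) ≡ + 6 * ∑ℤ (λ a → Y a * Y a)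
  size-formula = begin
    + 24 * S * + size pathCore + (S * S * S - S)
      ≡⟨ cong₂ (λ x y → + 24 * S * x + y) size-classes (sym ∑W²) ⟩
    + 24 * S * Q + + 3 * (W² + W²)
      ≡⟨ solve S Q W² ⟩
    + 6 * (+ 4 * S * Q + W²)
      ≡⟨ cong (λ x → + 6 * x) (∑ℤ-linear {n} (+ 4 * S) _ _ _ λ a →
           trans (solve′ S (i (upper a)) (θ (upper a)))
             (cong (λ y → (y + y + 1ℤ - S) * (y + y + 1ℤ - S)) (sym (e-division (upper a))))) ⟩
    + 6 * ∑ℤ (λ a → Y a * Y a) ∎
    where
    open ≡-Reasoning
    Q = ∑ℤ (λ a → classSize S (i (upper a)) (θ (upper a)))
    W² = ∑ℤ (λ a → W a * W a)
    solve : ∀ s q w → + 24 * s * q + + 3 * (w + w) ≡ + 6 * (+ 4 * s * q + w)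
    solve = solve-∀
    solve′ : ∀ s i θ → + 4 * s * (s * (θ * θ) + (i + i + 1ℤ - s) * θ) + (i + i + 1ℤ - s) * (i + i + 1ℤ - s) ≡
             (i + θ * s + (i + θ * s) + 1ℤ - s) * (i + θ * s + (i + θ * s) + 1ℤ - s)
    solve′ = solve-∀

-- The sum of the squares Y² along a path

module _ (S T η : ℤ) where

  -- With b = n - 1 - a and η = 1 + ε, the number s - 1 - 2 a equals 2 b + η. Counting positions
  -- from the back leaves b unchanged when the first entry is removed, in accordance with the
  -- recursion on paths.
  oddSquares : ℕ → ℤ
  oddSquares zero    = 0ℤ
  oddSquares (suc n) = (+ n + + n + η) * (+ n + + n + η) + oddSquares n

  -- The part of Σ (T (2 b + η) − 2 S h)² that depends on the path.
  crossTerms : ∀ {n q} → Path n q → ℤ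
  crossTerms base             = 0ℤ
  crossTerms (stop p)         = crossTerms p
  crossTerms (take {n} {q} p) =
    + 4 * S * S * + suc q * + suc q - + 4 * S * T * (+ n + + n + η) * + suc q + crossTerms p

  private
    y : ℕ → ℕ → ℕ → ℤ
    y n h i = T * (+ n + + n + η - + 2 - + i - + i) - + 2 * S * + h

    y-suc : ∀ n h i → y (suc n) h (suc i) ≡ y n h i
    y-suc n h i = solve T (+ n) η (+ i) (+ 2 * S * + h)
      where
      solve : ∀ t n η i h → t * (1ℤ + n + (1ℤ + n) + η - + 2 - (1ℤ + i) - (1ℤ + i)) - h ≡ t * (n + n + η - + 2 - i - i) - h
      solve = solve-∀

    y-zero : ∀ n h → y (suc n) h 0 ≡ T * (+ n + + n + η) - + 2 * S * + h
    y-zero n h = solve T (+ n) η (+ 2 * S * + h)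
      where
      solve : ∀ t n η h → t * (1ℤ + n + (1ℤ + n) + η - + 2 - 0ℤ - 0ℤ) - h ≡ t * (n + n + η) - h
      solve = solve-∀

    head : ∀ n h → y (suc n) h 0 * y (suc n) h 0 ≡
      T * T * ((+ n + + n + η) * (+ n + + n + η)) + (+ 4 * S * S * + h * + h - + 4 * S * T * (+ n + + n + η) * + h)
    head n h = trans (cong (λ x → x * x) (y-zero n h)) (solve S T (+ n + + n + η) (+ h))
      where
      solve : ∀ s t o h → (t * o - + 2 * s * h) * (t * o - + 2 * s * h) ≡
        t * t * (o * o) + (+ 4 * s * s * h * h - + 4 * s * t * o * h)
      solve = solve-∀

    squares : ∀ n (h : Fin n → ℕ) → ℤ
    squares n h = ∑ℤ (λ i → y n (h i) (toℕ i) * y n (h i) (toℕ i))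

    squares-suc : ∀ n h → squares (suc n) h ≡ y (suc n) (h zero) 0 * y (suc n) (h zero) 0 + squares n (h ∘ suc)
    squares-suc n h = cong (λ x → y (suc n) (h zero) 0 * y (suc n) (h zero) 0 + x)
      (∑ℤ-cong {n} (λ i → cong (λ x → x * x) (y-suc n (h (suc i)) (toℕ i))))

    squares-base : ∀ n → squares n (λ _ → 0) ≡ T * T * oddSquares n + 0ℤ
    squares-base zero    = sym (trans (ℤ.+-identityʳ _) (ℤ.*-zeroʳ (T * T)))
    squares-base (suc n) = trans (squares-suc n (λ _ → 0)) (trans (cong₂ _+_ (head n 0) (squares-base n))
      (solve S T (+ n + + n + η) (oddSquares n)))
      where
      solve : ∀ s t o b → t * t * (o * o) + (+ 4 * s * s * 0ℤ * 0ℤ - + 4 * s * t * o * 0ℤ) + (t * t * b + 0ℤ) ≡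
              t * t * (o * o + b) + 0ℤ
      solve = solve-∀

  squares-path : ∀ {n q} (p : Path n q) → squares n (height p) ≡ T * T * oddSquares n + crossTerms p
  squares-path {n} base         = squares-base n
  squares-path (stop p)         = squares-path p
  squares-path (take {n} {q} p) = trans (squares-suc n (height (take p)))
    (trans (cong₂ _+_ (head n (suc q)) (squares-path p))
      (solve (T * T) ((+ n + + n + η) * (+ n + + n + η)) (oddSquares n)
        (+ 4 * S * S * + suc q * + suc q - + 4 * S * T * (+ n + + n + η) * + suc q) (crossTerms p)))
    where
    solve : ∀ tt oo b z zs → tt * oo + z + (tt * b + zs) ≡ tt * (oo + b) + (z + zs)
    solve = solve-∀

  3*oddSquares : ∀ n → + 3 * oddSquares n ≡
    + 2 * + n * (+ n - 1ℤ) * (+ 2 * + n - 1ℤ) + + 6 * η * + n * (+ n - 1ℤ) + + 3 * η * η * + n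
  3*oddSquares zero    = solve η
    where
    solve : ∀ η → 0ℤ ≡ + 2 * 0ℤ * (0ℤ - 1ℤ) * (+ 2 * 0ℤ - 1ℤ) + + 6 * η * 0ℤ * (0ℤ - 1ℤ) + + 3 * η * η * 0ℤ
    solve = solve-∀
  3*oddSquares (suc n) = trans (ℤ.*-distribˡ-+ (+ 3) ((+ n + + n + η) * (+ n + + n + η)) (oddSquares n))
    (trans (cong (λ x → + 3 * ((+ n + + n + η) * (+ n + + n + η)) + x) (3*oddSquares n)) (solve η (+ n)))
    where
    solve : ∀ η n → + 3 * ((n + n + η) * (n + n + η)) +
        (+ 2 * n * (n - 1ℤ) * (+ 2 * n - 1ℤ) + + 6 * η * n * (n - 1ℤ) + + 3 * η * η * n) ≡
      + 2 * (1ℤ + n) * (1ℤ + n - 1ℤ) * (+ 2 * (1ℤ + n) - 1ℤ) + + 6 * η * (1ℤ + n) * (1ℤ + n - 1ℤ) + + 3 * η * η * (1ℤ + n)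
    solve = solve-∀

module PathSize (𝕊 : Setting) (p : Path (Setting.n 𝕊) (Setting.q 𝕊)) where
  open Cells 𝕊
  open PathCore 𝕊 p
  open Size 𝕊 p

  η : ℤ
  η = 1ℤ + + ε

  size-path : + 24 * S * + size pathCore + (S * S * S - S) ≡
              + 6 * (T * T * oddSquares S T η n + crossTerms S T η p)
  size-path = trans size-formula (cong (λ x → + 6 * x) (trans
    (∑ℤ-cong {n} (λ a → cong (λ x → x * x) (Y-eq a))) (squares-path S T η p)))
    where
    Y-eq : ∀ a → Y a ≡ T * (+ n + + n + η - + 2 - + toℕ a - + toℕ a) - + 2 * S * + height p a
    Y-eq a = trans (cong (λ P → c - T * P - S * + height p a + (c - T * P - S * + height p a) + 1ℤ - S) (P-pos a))
      (modulo 1ℤ c+c (solve c (+ n) (+ ε) T (+ toℕ a) (+ height p a)))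
      where
      solve : ∀ c n ε t a h → c - t * a - (n + (ε + n)) * h + (c - t * a - (n + (ε + n)) * h) + 1ℤ - (n + (ε + n)) ≡
        t * (n + n + (1ℤ + ε) - + 2 - a - a) - + 2 * (n + (ε + n)) * h
        + 1ℤ * (c + c - (n + (ε + n) - 1ℤ) * (t + 1ℤ))
      solve = solve-∀

-- Rational numbers

fromℚᵘ-homo-+ : ∀ p q → ℚ.fromℚᵘ (p ℚᵘ.+ q) ≡ ℚ.fromℚᵘ p ℚ.+ ℚ.fromℚᵘ q
fromℚᵘ-homo-+ p q = ℚ.toℚᵘ-injective (ℚᵘ.≃-trans (ℚ.toℚᵘ-fromℚᵘ (p ℚᵘ.+ q))
  (ℚᵘ.≃-sym (ℚᵘ.≃-trans (ℚ.toℚᵘ-homo-+ (ℚ.fromℚᵘ p) (ℚ.fromℚᵘ q))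
    (ℚᵘ.+-cong (ℚ.toℚᵘ-fromℚᵘ p) (ℚ.toℚᵘ-fromℚᵘ q)))))

fromℚᵘ-homo-* : ∀ p q → ℚ.fromℚᵘ (p ℚᵘ.* q) ≡ ℚ.fromℚᵘ p ℚ.* ℚ.fromℚᵘ q
fromℚᵘ-homo-* p q = ℚ.toℚᵘ-injective (ℚᵘ.≃-trans (ℚ.toℚᵘ-fromℚᵘ (p ℚᵘ.* q))
  (ℚᵘ.≃-sym (ℚᵘ.≃-trans (ℚ.toℚᵘ-homo-* (ℚ.fromℚᵘ p) (ℚ.fromℚᵘ q))
    (ℚᵘ.*-cong (ℚ.toℚᵘ-fromℚᵘ p) (ℚ.toℚᵘ-fromℚᵘ q)))))

⟦_⟧ : ℤ → ℚ
⟦ z ⟧ = z / 1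

⟦⟧-+ : ∀ x y → ⟦ x + y ⟧ ≡ ⟦ x ⟧ ℚ.+ ⟦ y ⟧
⟦⟧-+ x y = trans (cong ⟦_⟧ (sym (cong₂ _+_ (ℤ.*-identityʳ x) (ℤ.*-identityʳ y))))
  (fromℚᵘ-homo-+ (ℚᵘ.mkℚᵘ x 0) (ℚᵘ.mkℚᵘ y 0))

⟦⟧-* : ∀ x y → ⟦ x * y ⟧ ≡ ⟦ x ⟧ ℚ.* ⟦ y ⟧
⟦⟧-* x y = fromℚᵘ-homo-* (ℚᵘ.mkℚᵘ x 0) (ℚᵘ.mkℚᵘ y 0)

⟦⟧-neg : ∀ x → ⟦ - x ⟧ ≡ ℚ.- ⟦ x ⟧
⟦⟧-neg (+ zero)  = refl
⟦⟧-neg (+ suc x) = refl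
⟦⟧-neg -[1+ x ]  = sym (neg-neg ⟦ + suc x ⟧)
  where
  neg-neg : ∀ p → ℚ.- (ℚ.- p) ≡ p
  neg-neg (ℚ.mkℚ (+ zero)  _ _) = refl
  neg-neg (ℚ.mkℚ (+ suc _) _ _) = refl
  neg-neg (ℚ.mkℚ -[1+ _ ]  _ _) = refl

⟦⟧-- : ∀ x y → ⟦ x - y ⟧ ≡ ⟦ x ⟧ ℚ.- ⟦ y ⟧
⟦⟧-- x y = trans (⟦⟧-+ x (- y)) (cong (⟦ x ⟧ ℚ.+_) (⟦⟧-neg y))

inv : (k : ℕ) .{{_ : NonZero k}} → ℚ
inv k = + 1 / k

inv-* : ∀ k l .{{_ : NonZero k}} .{{_ : NonZero l}} .{{_ : NonZero (k ℕ.* l)}} → inv (k ℕ.* l) ≡ inv k ℚ.* inv l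
inv-* (suc k) (suc l) = fromℚᵘ-homo-* (ℚᵘ.mkℚᵘ (+ 1) k) (ℚᵘ.mkℚᵘ (+ 1) l)

/-inv : ∀ z k .{{_ : NonZero k}} → z / k ≡ ⟦ z ⟧ ℚ.* inv k
/-inv z (suc k) = trans (ℚ.fromℚᵘ-cong {ℚᵘ.mkℚᵘ z k} {ℚᵘ.mkℚᵘ z 0 ℚᵘ.* ℚᵘ.mkℚᵘ (+ 1) k} (ℚᵘ.*≡* eq))
  (fromℚᵘ-homo-* (ℚᵘ.mkℚᵘ z 0) (ℚᵘ.mkℚᵘ (+ 1) k))
  where
  eq : z * + suc (k ℕ.+ 0) ≡ z * + 1 * + suc k
  eq = cong₂ _*_ (sym (ℤ.*-identityʳ z)) (cong (+_ ∘ suc) (ℕ.+-identityʳ k))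

*-inv : ∀ k .{{_ : NonZero k}} → ⟦ + k ⟧ ℚ.* inv k ≡ 1ℚ
*-inv k@(suc _) = trans (sym (/-inv (+ k) k)) (ℚ.fromℚᵘ-cong {ℚᵘ.mkℚᵘ (+ k) _} {ℚᵘ.mkℚᵘ (+ 1) 0}
  (ℚᵘ.*≡* (trans (ℤ.*-identityʳ (+ k)) (sym (ℤ.*-identityˡ (+ k))))))

-- Exponential series

Series : Set
Series = ℕ → ℚ

shift : Series → Series
shift f zero    = 0ℚ
shift f (suc n) = f n

conv : Series → Series → Series
conv f g zero    = f 0 ℚ.* g 0
conv f g (suc n) = f 0 ℚ.* g (suc n) ℚ.+ conv (f ∘ suc) g n

conv-cong : ∀ {f f′ g g′} → f ≗ f′ → g ≗ g′ → conv f g ≗ conv f′ g′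
conv-cong f≗ g≗ zero    = cong₂ ℚ._*_ (f≗ 0) (g≗ 0)
conv-cong f≗ g≗ (suc n) = cong₂ ℚ._+_ (cong₂ ℚ._*_ (f≗ 0) (g≗ (suc n))) (conv-cong (f≗ ∘ suc) g≗ n)

conv-shiftˡ : ∀ f g → conv (shift f) g ≗ shift (conv f g)
conv-shiftˡ f g zero    = ℚ.*-zeroˡ (g 0)
conv-shiftˡ f g (suc n) = trans (cong (ℚ._+ conv f g n) (ℚ.*-zeroˡ (g (suc n)))) (ℚ.+-identityˡ _)

conv-shiftʳ : ∀ f g → conv f (shift g) ≗ shift (conv f g)
conv-shiftʳ f g zero          = ℚ.*-zeroʳ (f 0)
conv-shiftʳ f g (suc zero)    = trans (cong (f 0 ℚ.* g 0 ℚ.+_) (ℚ.*-zeroʳ (f 1))) (ℚ.+-identityʳ _)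
conv-shiftʳ f g (suc (suc n)) = cong (f 0 ℚ.* g (suc n) ℚ.+_) (conv-shiftʳ (f ∘ suc) g (suc n))

conv-+ˡ : ∀ f f′ g n → conv (λ k → f k ℚ.+ f′ k) g n ≡ conv f g n ℚ.+ conv f′ g n
conv-+ˡ f f′ g zero    = ℚ.*-distribʳ-+ (g 0) (f 0) (f′ 0)
conv-+ˡ f f′ g (suc n) = trans (cong ((f 0 ℚ.+ f′ 0) ℚ.* g (suc n) ℚ.+_) (conv-+ˡ (f ∘ suc) (f′ ∘ suc) g n))
  (solveℚ 5 (λ a b c x y → (a :+ b) :* c :+ (x :+ y) := a :* c :+ x :+ (b :* c :+ y)) refl
    (f 0) (f′ 0) (g (suc n)) (conv (f ∘ suc) g n) (conv (f′ ∘ suc) g n))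

conv-+ʳ : ∀ f g g′ n → conv f (λ k → g k ℚ.+ g′ k) n ≡ conv f g n ℚ.+ conv f g′ n
conv-+ʳ f g g′ zero    = ℚ.*-distribˡ-+ (f 0) (g 0) (g′ 0)
conv-+ʳ f g g′ (suc n) = trans (cong (f 0 ℚ.* (g (suc n) ℚ.+ g′ (suc n)) ℚ.+_) (conv-+ʳ (f ∘ suc) g g′ n))
  (solveℚ 5 (λ a b c x y → a :* (b :+ c) :+ (x :+ y) := a :* b :+ x :+ (a :* c :+ y)) refl
    (f 0) (g (suc n)) (g′ (suc n)) (conv (f ∘ suc) g n) (conv (f ∘ suc) g′ n))

conv-*ˡ : ∀ a f g n → conv (λ k → a ℚ.* f k) g n ≡ a ℚ.* conv f g n
conv-*ˡ a f g zero    = ℚ.*-assoc a (f 0) (g 0)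
conv-*ˡ a f g (suc n) = trans (cong (a ℚ.* f 0 ℚ.* g (suc n) ℚ.+_) (conv-*ˡ a (f ∘ suc) g n))
  (solveℚ 4 (λ a x y z → a :* x :* y :+ a :* z := a :* (x :* y :+ z)) refl a (f 0) (g (suc n)) (conv (f ∘ suc) g n))

conv-*ʳ : ∀ a f g n → conv f (λ k → a ℚ.* g k) n ≡ a ℚ.* conv f g n
conv-*ʳ a f g zero    = solveℚ 3 (λ a x y → x :* (a :* y) := a :* (x :* y)) refl a (f 0) (g 0)
conv-*ʳ a f g (suc n) = trans (cong (f 0 ℚ.* (a ℚ.* g (suc n)) ℚ.+_) (conv-*ʳ a (f ∘ suc) g n))
  (solveℚ 4 (λ a x y z → x :* (a :* y) :+ a :* z := a :* (x :* y :+ z)) refl a (f 0) (g (suc n)) (conv (f ∘ suc) g n))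

# : ℕ → ℚ
# n = ⟦ + n ⟧

#-suc : ∀ n → # (suc n) ≡ 1ℚ ℚ.+ # n
#-suc n = ⟦⟧-+ 1ℤ (+ n)

-- Multiplying the n-th coefficient by n is the operator x d/dx; this is its product rule.
conv-leibniz : ∀ f g n → conv (λ k → # k ℚ.* f k) g n ℚ.+ conv f (λ r → # r ℚ.* g r) n ≡ # n ℚ.* conv f g n
conv-leibniz f g zero    = solveℚ 2 (λ x y → con 0ℚ :* x :* y :+ x :* (con 0ℚ :* y) := con 0ℚ :* (x :* y)) refl (f 0) (g 0)
conv-leibniz f g (suc n) = begin
  # 0 ℚ.* f 0 ℚ.* g (suc n) ℚ.+ conv (λ k → # (suc k) ℚ.* f (suc k)) g n ℚ.+ (f 0 ℚ.* (# (suc n) ℚ.* g (suc n)) ℚ.+ conv (f ∘ suc) (λ r → # r ℚ.* g r) n)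
    ≡⟨ cong (λ x → # 0 ℚ.* f 0 ℚ.* g (suc n) ℚ.+ x ℚ.+ (f 0 ℚ.* (# (suc n) ℚ.* g (suc n)) ℚ.+ conv (f ∘ suc) (λ r → # r ℚ.* g r) n))
         (trans (conv-cong {g = g} (λ k → trans (cong (ℚ._* f (suc k)) (#-suc k)) (ℚ.*-distribʳ-+ (f (suc k)) 1ℚ (# k))) (λ _ → refl) n)
           (trans (conv-+ˡ (λ k → 1ℚ ℚ.* f (suc k)) (λ k → # k ℚ.* f (suc k)) g n)
             (cong (ℚ._+ D) (conv-*ˡ 1ℚ (f ∘ suc) g n)))) ⟩
  # 0 ℚ.* f 0 ℚ.* g (suc n) ℚ.+ (1ℚ ℚ.* K ℚ.+ D) ℚ.+ (f 0 ℚ.* (# (suc n) ℚ.* g (suc n)) ℚ.+ D′)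
    ≡⟨ solveℚ 6 (λ x y s K D D′ → con 0ℚ :* x :* y :+ (con 1ℚ :* K :+ D) :+ (x :* (s :* y) :+ D′) := s :* (x :* y) :+ K :+ (D :+ D′)) refl
         (f 0) (g (suc n)) (# (suc n)) K D D′ ⟩
  # (suc n) ℚ.* (f 0 ℚ.* g (suc n)) ℚ.+ K ℚ.+ (D ℚ.+ D′)
    ≡⟨ cong (# (suc n) ℚ.* (f 0 ℚ.* g (suc n)) ℚ.+ K ℚ.+_) (conv-leibniz (f ∘ suc) g n) ⟩
  # (suc n) ℚ.* (f 0 ℚ.* g (suc n)) ℚ.+ K ℚ.+ # n ℚ.* K
    ≡⟨ cong (λ s → s ℚ.* (f 0 ℚ.* g (suc n)) ℚ.+ K ℚ.+ # n ℚ.* K) (#-suc n) ⟩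
  (1ℚ ℚ.+ # n) ℚ.* (f 0 ℚ.* g (suc n)) ℚ.+ K ℚ.+ # n ℚ.* K
    ≡⟨ solveℚ 3 (λ n x K → (con 1ℚ :+ n) :* x :+ K :+ n :* K := (con 1ℚ :+ n) :* (x :+ K)) refl (# n) (f 0 ℚ.* g (suc n)) K ⟩
  (1ℚ ℚ.+ # n) ℚ.* (f 0 ℚ.* g (suc n) ℚ.+ K)
    ≡⟨ cong (ℚ._* (f 0 ℚ.* g (suc n) ℚ.+ K)) (#-suc n) ⟨
  # (suc n) ℚ.* (f 0 ℚ.* g (suc n) ℚ.+ K) ∎
  where
  open ≡-Reasoning
  K = conv (f ∘ suc) g n
  D = conv (λ k → # k ℚ.* f (suc k)) g n
  D′ = conv (f ∘ suc) (λ r → # r ℚ.* g r) n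

-- aⁿ / n!
expSeries : ℚ → Series
expSeries a zero    = 1ℚ
expSeries a (suc n) = a ℚ.* inv (suc n) ℚ.* expSeries a n

#*expSeries : ∀ a n → # n ℚ.* expSeries a n ≡ a ℚ.* shift (expSeries a) n
#*expSeries a zero    = trans (ℚ.*-zeroˡ 1ℚ) (sym (ℚ.*-zeroʳ a))
#*expSeries a (suc n) = trans
  (solveℚ 4 (λ s a i e → s :* (a :* i :* e) := s :* i :* (a :* e)) refl (# (suc n)) a (inv (suc n)) (expSeries a n))
  (trans (cong (ℚ._* (a ℚ.* expSeries a n)) (*-inv (suc n))) (ℚ.*-identityˡ _))

-- The factor n (n - 1) represents x² d²/dx², which multiplies the exponential series by a² x².
##*expSeries : ∀ a n → # n ℚ.* (# n ℚ.- 1ℚ) ℚ.* expSeries a n ≡ a ℚ.* a ℚ.* shift (shift (expSeries a)) n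
##*expSeries a zero    = solveℚ 1 (λ a → con 0ℚ :* (con 0ℚ :- con 1ℚ) :* con 1ℚ := a :* a :* con 0ℚ) refl a
##*expSeries a (suc n) = begin
  # (suc n) ℚ.* (# (suc n) ℚ.- 1ℚ) ℚ.* expSeries a (suc n)
    ≡⟨ cong (λ x → # (suc n) ℚ.* (x ℚ.- 1ℚ) ℚ.* expSeries a (suc n)) (#-suc n) ⟩
  # (suc n) ℚ.* (1ℚ ℚ.+ # n ℚ.- 1ℚ) ℚ.* expSeries a (suc n)
    ≡⟨ solveℚ 3 (λ s n e → s :* (con 1ℚ :+ n :- con 1ℚ) :* e := n :* (s :* e)) refl (# (suc n)) (# n) (expSeries a (suc n)) ⟩
  # n ℚ.* (# (suc n) ℚ.* expSeries a (suc n))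
    ≡⟨ cong (# n ℚ.*_) (#*expSeries a (suc n)) ⟩
  # n ℚ.* (a ℚ.* expSeries a n)
    ≡⟨ solveℚ 3 (λ n a e → n :* (a :* e) := a :* (n :* e)) refl (# n) a (expSeries a n) ⟩
  a ℚ.* (# n ℚ.* expSeries a n)
    ≡⟨ cong (a ℚ.*_) (#*expSeries a n) ⟩
  a ℚ.* (a ℚ.* shift (expSeries a) n)
    ≡⟨ ℚ.*-assoc a a _ ⟨
  a ℚ.* a ℚ.* shift (expSeries a) n ∎
  where open ≡-Reasoning

-- By the product rule the Cauchy product f satisfies x f′ = (a + b) x f, which yields each
-- coefficient from the preceding one.
conv-expSeries : ∀ a b → conv (expSeries a) (expSeries b) ≗ expSeries (a ℚ.+ b)
conv-expSeries a b zero    = refl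
conv-expSeries a b (suc n) = begin
  K (suc n)
    ≡⟨ ℚ.*-identityˡ (K (suc n)) ⟨
  1ℚ ℚ.* K (suc n)
    ≡⟨ cong (ℚ._* K (suc n)) (*-inv (suc n)) ⟨
  # (suc n) ℚ.* inv (suc n) ℚ.* K (suc n)
    ≡⟨ solveℚ 3 (λ s i c → s :* i :* c := i :* (s :* c)) refl (# (suc n)) (inv (suc n)) (K (suc n)) ⟩
  inv (suc n) ℚ.* (# (suc n) ℚ.* K (suc n))
    ≡⟨ cong (inv (suc n) ℚ.*_) (conv-leibniz (expSeries a) (expSeries b) (suc n)) ⟨
  inv (suc n) ℚ.* (conv (λ k → # k ℚ.* expSeries a k) (expSeries b) (suc n) ℚ.+ conv (expSeries a) (λ r → # r ℚ.* expSeries b r) (suc n))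
    ≡⟨ cong (inv (suc n) ℚ.*_) (cong₂ ℚ._+_
         (trans (conv-cong {g = expSeries b} (#*expSeries a) (λ _ → refl) (suc n)) (trans (conv-*ˡ a (shift (expSeries a)) (expSeries b) (suc n))
           (cong (a ℚ.*_) (conv-shiftˡ (expSeries a) (expSeries b) (suc n)))))
         (trans (conv-cong {f = expSeries a} (λ _ → refl) (#*expSeries b) (suc n)) (trans (conv-*ʳ b (expSeries a) (shift (expSeries b)) (suc n))
           (cong (b ℚ.*_) (conv-shiftʳ (expSeries a) (expSeries b) (suc n)))))) ⟩
  inv (suc n) ℚ.* (a ℚ.* K n ℚ.+ b ℚ.* K n)
    ≡⟨ solveℚ 4 (λ i a b c → i :* (a :* c :+ b :* c) := (a :+ b) :* i :* c) refl (inv (suc n)) a b (K n) ⟩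
  (a ℚ.+ b) ℚ.* inv (suc n) ℚ.* K n
    ≡⟨ cong ((a ℚ.+ b) ℚ.* inv (suc n) ℚ.*_) (conv-expSeries a b n) ⟩
  (a ℚ.+ b) ℚ.* inv (suc n) ℚ.* expSeries (a ℚ.+ b) n ∎
  where
  open ≡-Reasoning
  K = conv (expSeries a) (expSeries b)

-- Weighted sums over paths

∑P : ∀ n q → (Path n q → ℚ) → ℚ
∑P n       zero    f = f base
∑P zero    (suc q) f = ∑P zero q (f ∘ stop)
∑P (suc n) (suc q) f = ∑P (suc n) q (f ∘ stop) ℚ.+ ∑P n (suc q) (f ∘ take)

∑ℚ-splitAt : ∀ m {n} (f : Fin m ⊎ Fin n → ℚ) →
             ∑ℚ (λ i → f (Fin.splitAt m i)) ≡ ∑ℚ (λ i → f (inj₁ i)) ℚ.+ ∑ℚ (λ j → f (inj₂ j))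
∑ℚ-splitAt zero    f = sym (ℚ.+-identityˡ _)
∑ℚ-splitAt (suc m) {n} f = trans (cong (f (inj₁ zero) ℚ.+_)
    (trans (∑ℚ-cong (λ i → tail (Fin.splitAt m i))) (∑ℚ-splitAt m {n} f′)))
  (sym (ℚ.+-assoc (f (inj₁ zero)) _ _))
  where
  f′ : Fin m ⊎ Fin n → ℚ
  f′ (inj₁ i) = f (inj₁ (suc i))
  f′ (inj₂ j) = f (inj₂ j)
  tail : ∀ x → f (Sum.map₁ suc x) ≡ f′ x
  tail (inj₁ i) = refl
  tail (inj₂ j) = refl

∑ℚ-paths : ∀ n q (f : Path n q → ℚ) → ∑ℚ (λ i → f (pathAt n q i)) ≡ ∑P n q f
∑ℚ-paths n       zero    f = ℚ.+-identityʳ (f base)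
∑ℚ-paths zero    (suc q) f = ∑ℚ-paths zero q (f ∘ stop)
∑ℚ-paths (suc n) (suc q) f = trans
  (∑ℚ-splitAt (pathCount (suc n) q) (λ x → f ([ stop ∘ pathAt (suc n) q , take ∘ pathAt n (suc q) ]′ x)))
  (cong₂ ℚ._+_ (∑ℚ-paths (suc n) q (f ∘ stop)) (∑ℚ-paths n (suc q) (f ∘ take)))

∑P-cong : ∀ n q {f g : Path n q → ℚ} → f ≗ g → ∑P n q f ≡ ∑P n q g
∑P-cong n       zero    eq = eq base
∑P-cong zero    (suc q) eq = ∑P-cong zero q (eq ∘ stop)
∑P-cong (suc n) (suc q) eq = cong₂ ℚ._+_ (∑P-cong (suc n) q (eq ∘ stop)) (∑P-cong n (suc q) (eq ∘ take))

∑P-+ : ∀ n q (f g : Path n q → ℚ) → ∑P n q (λ p → f p ℚ.+ g p) ≡ ∑P n q f ℚ.+ ∑P n q g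
∑P-+ n       zero    f g = refl
∑P-+ zero    (suc q) f g = ∑P-+ zero q (f ∘ stop) (g ∘ stop)
∑P-+ (suc n) (suc q) f g = trans
  (cong₂ ℚ._+_ (∑P-+ (suc n) q (f ∘ stop) (g ∘ stop)) (∑P-+ n (suc q) (f ∘ take) (g ∘ take)))
  (rearrange (∑P (suc n) q (f ∘ stop)) (∑P (suc n) q (g ∘ stop)) (∑P n (suc q) (f ∘ take)) (∑P n (suc q) (g ∘ take)))
  where
  rearrange : ∀ a b c d → a ℚ.+ b ℚ.+ (c ℚ.+ d) ≡ a ℚ.+ c ℚ.+ (b ℚ.+ d)
  rearrange = solveℚ 4 (λ a b c d → a :+ b :+ (c :+ d) := a :+ c :+ (b :+ d)) refl

∑P-* : ∀ n q a (f : Path n q → ℚ) → ∑P n q (λ p → a ℚ.* f p) ≡ a ℚ.* ∑P n q f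
∑P-* n       zero    a f = refl
∑P-* zero    (suc q) a f = ∑P-* zero q a (f ∘ stop)
∑P-* (suc n) (suc q) a f = trans
  (cong₂ ℚ._+_ (∑P-* (suc n) q a (f ∘ stop)) (∑P-* n (suc q) a (f ∘ take)))
  (sym (ℚ.*-distribˡ-+ a _ _))

rest : ∀ {n q} → Path n (suc q) → Σ[ r ∈ ℕ ] Path r q
rest (stop {n} p) = n , p
rest (take p)     = rest p

-- A path amounts to the multiplicity k of its greatest admissible value and a path with smaller
-- values on the other n - k entries. The length of that remainder varies, so `h` takes it together
-- with the path.
∑P-conv : ∀ n q (F : Series) (h : Σ[ r ∈ ℕ ] Path r q → ℚ) →
          ∑P n (suc q) (λ p → F (top p) ℚ.* h (rest p)) ≡ conv F (λ r → ∑P r q (λ p → h (r , p))) n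
∑P-conv zero    q F h = ∑P-* zero q (F 0) (λ p → h (0 , p))
∑P-conv (suc n) q F h = cong₂ ℚ._+_ (∑P-* (suc n) q (F 0) (λ p → h (suc n , p))) (∑P-conv n q (F ∘ suc) h)

size-rest : ∀ {n q} (p : Path n (suc q)) → n ≡ top p ℕ.+ proj₁ (rest p)
size-rest (stop p) = refl
size-rest (take p) = cong suc (size-rest p)

module _ (S T η : ℤ) where

  linCoeff quadCoeff : ℕ → ℤ
  linCoeff q    = + 4 * S * S * + q * + q - + 4 * S * T * η * + q
  quadCoeff q = - (+ 4 * S * T * + q)

  -- The k entries of value q + 1 sit at b = r, ..., r + k - 1, where r entries remain, and the sum
  -- of 2 b + η over these is η k + 2 k r + k (k - 1). Writing k² through k (k - 1) prepares for
  -- second derivatives.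
  crossTerms-rest : ∀ {n q} (p : Path n (suc q)) → let k = + top p ; r = + proj₁ (rest p) in
    crossTerms S T η p ≡ crossTerms S T η (proj₂ (rest p)) + linCoeff (suc q) * k
                         + quadCoeff (suc q) * (+ 2 * k * r + k * (k - 1ℤ))
  crossTerms-rest {q = q} (stop {n} p) = solve S T η (+ suc q) (crossTerms S T η p) (+ n)
    where
    solve : ∀ s t η q z r → z ≡ z + (+ 4 * s * s * q * q - + 4 * s * t * η * q) * 0ℤ
              + - (+ 4 * s * t * q) * (+ 2 * 0ℤ * r + 0ℤ * (0ℤ - 1ℤ))
    solve = solve-∀
  crossTerms-rest {q = q} (take {n} p) = trans
    (cong₂ (λ n z → + 4 * S * S * + suc q * + suc q - + 4 * S * T * (+ n + + n + η) * + suc q + z) (size-rest p) (crossTerms-rest p))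
    (solve S T η (+ suc q) (crossTerms S T η (proj₂ (rest p))) (+ top p) (+ proj₁ (rest p)))
    where
    solve : ∀ s t η q z k r → + 4 * s * s * q * q - + 4 * s * t * (k + r + (k + r) + η) * q
        + (z + (+ 4 * s * s * q * q - + 4 * s * t * η * q) * k + - (+ 4 * s * t * q) * (+ 2 * k * r + k * (k - 1ℤ))) ≡
      z + (+ 4 * s * s * q * q - + 4 * s * t * η * q) * (1ℤ + k)
        + - (+ 4 * s * t * q) * (+ 2 * (1ℤ + k) * r + (1ℤ + k) * (1ℤ + k - 1ℤ))
    solve = solve-∀

module WeightedSums (S T η : ℤ) (α : ℕ → ℚ) where

  weight : ∀ {n q} → Path n q → ℚ
  weight (base {n})       = expSeries (α 0) n
  weight (stop p)         = weight p
  weight (take {q = q} p) = α (suc q) ℚ.* inv (suc (top p)) ℚ.* weight p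

  weight-rest : ∀ {n q} (p : Path n (suc q)) → weight p ≡ expSeries (α (suc q)) (top p) ℚ.* weight (proj₂ (rest p))
  weight-rest (stop p) = sym (ℚ.*-identityˡ (weight p))
  weight-rest {q = q} (take p) = trans (cong (α (suc q) ℚ.* inv (suc (top p)) ℚ.*_) (weight-rest p))
    (sym (ℚ.*-assoc (α (suc q) ℚ.* inv (suc (top p))) _ _))

  a : ℕ → ℚ
  a zero    = α 0
  a (suc q) = α (suc q) ℚ.+ a q

  -- Each value h contributes a factor exp(α_h x), so the exponents accumulate in `a`.
  ∑-weight : ∀ n q → ∑P n q weight ≡ expSeries (a q) n
  ∑-weight n zero    = refl
  ∑-weight n (suc q) = begin
    ∑P n (suc q) weight
      ≡⟨ ∑P-cong n (suc q) weight-rest ⟩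
    ∑P n (suc q) (λ p → expSeries (α (suc q)) (top p) ℚ.* weight (proj₂ (rest p)))
      ≡⟨ ∑P-conv n q (expSeries (α (suc q))) (λ rp → weight (proj₂ rp)) ⟩
    conv (expSeries (α (suc q))) (λ r → ∑P r q weight) n
      ≡⟨ conv-cong {expSeries (α (suc q))} (λ _ → refl) (λ r → ∑-weight r q) n ⟩
    conv (expSeries (α (suc q))) (expSeries (a q)) n
      ≡⟨ conv-expSeries (α (suc q)) (a q) n ⟩
    expSeries (a (suc q)) n ∎
    where open ≡-Reasoning

  -- The weighted sum of crossTerms has generating function (M x + N x²) exp(a x).
  M N : ℕ → ℚ
  M zero    = 0ℚ
  M (suc q) = M q ℚ.+ ⟦ linCoeff S T η (suc q) ⟧ ℚ.* α (suc q)
  N zero    = 0ℚ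
  N (suc q) = N q ℚ.+ ⟦ quadCoeff S T η (suc q) ⟧ ℚ.* (⟦ + 2 ⟧ ℚ.* α (suc q) ℚ.* a q ℚ.+ α (suc q) ℚ.* α (suc q))

  -- Under the weights k acts as α x, the product k r as (α x)(a x) and k (k - 1) as α² x², always
  -- times the exponential of the new total exponent. These account for `f₂`, `f₃` and `f₄`, while
  -- `f₁` carries the induction hypothesis.
  ∑-cross : ∀ n q → ∑P n q (λ p → weight p ℚ.* ⟦ crossTerms S T η p ⟧) ≡
            M q ℚ.* shift (expSeries (a q)) n ℚ.+ N q ℚ.* shift (shift (expSeries (a q))) n
  ∑-cross n zero    = trans (ℚ.*-zeroʳ (expSeries (α 0) n)) (sym
    (cong₂ ℚ._+_ (ℚ.*-zeroˡ (shift (expSeries (a 0)) n)) (ℚ.*-zeroˡ (shift (shift (expSeries (a 0))) n))))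
  ∑-cross n (suc q) = begin
    ∑P n (suc q) (λ p → weight p ℚ.* ⟦ crossTerms S T η p ⟧)
      ≡⟨ ∑P-cong n (suc q) split ⟩
    ∑P n (suc q) (λ p → f₁ p ℚ.+ (A ℚ.* f₂ p ℚ.+ (2B ℚ.* f₃ p ℚ.+ B ℚ.* f₄ p)))
      ≡⟨ trans (∑P-+ n (suc q) f₁ _) (cong (∑P n (suc q) f₁ ℚ.+_)
           (trans (∑P-+ n (suc q) (λ p → A ℚ.* f₂ p) _) (cong₂ ℚ._+_ (∑P-* n (suc q) A f₂)
             (trans (∑P-+ n (suc q) (λ p → 2B ℚ.* f₃ p) (λ p → B ℚ.* f₄ p))
               (cong₂ ℚ._+_ (∑P-* n (suc q) 2B f₃) (∑P-* n (suc q) B f₄)))))) ⟩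
    ∑P n (suc q) f₁ ℚ.+ (A ℚ.* ∑P n (suc q) f₂ ℚ.+ (2B ℚ.* ∑P n (suc q) f₃ ℚ.+ B ℚ.* ∑P n (suc q) f₄))
      ≡⟨ cong₂ ℚ._+_ ∑f₁ (cong₂ ℚ._+_ (cong (A ℚ.*_) ∑f₂) (cong₂ ℚ._+_ (cong (2B ℚ.*_) ∑f₃) (cong (B ℚ.*_) ∑f₄))) ⟩
    (M q ℚ.* X ℚ.+ N q ℚ.* X²) ℚ.+ (A ℚ.* (α′ ℚ.* X) ℚ.+ (2B ℚ.* (α′ ℚ.* (a q ℚ.* X²)) ℚ.+ B ℚ.* (α′ ℚ.* α′ ℚ.* X²)))
      ≡⟨ collect (M q) (N q) X X² A α′ B (a q) ⟩
    M (suc q) ℚ.* X ℚ.+ N (suc q) ℚ.* X² ∎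
    where
    open ≡-Reasoning
    α′ = α (suc q)
    E = expSeries α′
    A = ⟦ linCoeff S T η (suc q) ⟧
    B = ⟦ quadCoeff S T η (suc q) ⟧
    2B = ⟦ + 2 ⟧ ℚ.* B
    X = shift (expSeries (a (suc q))) n
    X² = shift (shift (expSeries (a (suc q)))) n
    f₁ f₂ f₃ f₄ : Path n (suc q) → ℚ
    f₁ p = E (top p) ℚ.* (weight (proj₂ (rest p)) ℚ.* ⟦ crossTerms S T η (proj₂ (rest p)) ⟧)
    f₂ p = # (top p) ℚ.* E (top p) ℚ.* weight (proj₂ (rest p))
    f₃ p = # (top p) ℚ.* E (top p) ℚ.* (# (proj₁ (rest p)) ℚ.* weight (proj₂ (rest p)))
    f₄ p = # (top p) ℚ.* (# (top p) ℚ.- 1ℚ) ℚ.* E (top p) ℚ.* weight (proj₂ (rest p))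

    collect : ∀ m n x x² a α b a′ →
      (m ℚ.* x ℚ.+ n ℚ.* x²) ℚ.+ (a ℚ.* (α ℚ.* x) ℚ.+ (⟦ + 2 ⟧ ℚ.* b ℚ.* (α ℚ.* (a′ ℚ.* x²)) ℚ.+ b ℚ.* (α ℚ.* α ℚ.* x²))) ≡
      (m ℚ.+ a ℚ.* α) ℚ.* x ℚ.+ (n ℚ.+ b ℚ.* (⟦ + 2 ⟧ ℚ.* α ℚ.* a′ ℚ.+ α ℚ.* α)) ℚ.* x²
    collect = solveℚ 8 (λ m n x x² a α b a′ →
      (m :* x :+ n :* x²) :+ (a :* (α :* x) :+ (con ⟦ + 2 ⟧ :* b :* (α :* (a′ :* x²)) :+ b :* (α :* α :* x²))) :=
      (m :+ a :* α) :* x :+ (n :+ b :* (con ⟦ + 2 ⟧ :* α :* a′ :+ α :* α)) :* x²) refl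

    expand : ∀ e w z k r a b → e ℚ.* w ℚ.* (z ℚ.+ a ℚ.* k ℚ.+ b ℚ.* (⟦ + 2 ⟧ ℚ.* k ℚ.* r ℚ.+ k ℚ.* (k ℚ.- 1ℚ))) ≡
      e ℚ.* (w ℚ.* z) ℚ.+ (a ℚ.* (k ℚ.* e ℚ.* w) ℚ.+ (⟦ + 2 ⟧ ℚ.* b ℚ.* (k ℚ.* e ℚ.* (r ℚ.* w)) ℚ.+ b ℚ.* (k ℚ.* (k ℚ.- 1ℚ) ℚ.* e ℚ.* w)))
    expand = solveℚ 7 (λ e w z k r a b → e :* w :* (z :+ a :* k :+ b :* (con ⟦ + 2 ⟧ :* k :* r :+ k :* (k :- con 1ℚ))) :=
      e :* (w :* z) :+ (a :* (k :* e :* w) :+ (con ⟦ + 2 ⟧ :* b :* (k :* e :* (r :* w)) :+ b :* (k :* (k :- con 1ℚ) :* e :* w)))) refl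

    split : ∀ p → weight p ℚ.* ⟦ crossTerms S T η p ⟧ ≡ f₁ p ℚ.+ (A ℚ.* f₂ p ℚ.+ (2B ℚ.* f₃ p ℚ.+ B ℚ.* f₄ p))
    split p = trans (cong₂ ℚ._*_ (weight-rest p) (trans (cong ⟦_⟧ (crossTerms-rest S T η p)) embed))
      (expand (E (top p)) (weight (proj₂ (rest p))) ⟦ z ⟧ (# (top p)) (# (proj₁ (rest p))) A B)
      where
      z = crossTerms S T η (proj₂ (rest p))
      k = + top p
      r = + proj₁ (rest p)
      l = linCoeff S T η (suc q)
      u = quadCoeff S T η (suc q)
      embed : ⟦ z + l * k + u * (+ 2 * k * r + k * (k - 1ℤ)) ⟧ ≡
              ⟦ z ⟧ ℚ.+ A ℚ.* ⟦ k ⟧ ℚ.+ B ℚ.* (⟦ + 2 ⟧ ℚ.* ⟦ k ⟧ ℚ.* ⟦ r ⟧ ℚ.+ ⟦ k ⟧ ℚ.* (⟦ k ⟧ ℚ.- 1ℚ))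
      embed = trans (⟦⟧-+ (z + l * k) _) (cong₂ ℚ._+_ (trans (⟦⟧-+ z (l * k)) (cong (⟦ z ⟧ ℚ.+_) (⟦⟧-* l k)))
        (trans (⟦⟧-* u (+ 2 * k * r + k * (k - 1ℤ))) (cong (B ℚ.*_) (trans (⟦⟧-+ (+ 2 * k * r) (k * (k - 1ℤ))) (cong₂ ℚ._+_
          (trans (⟦⟧-* (+ 2 * k) r) (cong (ℚ._* ⟦ r ⟧) (⟦⟧-* (+ 2) k)))
          (trans (⟦⟧-* k (k - 1ℤ)) (cong (⟦ k ⟧ ℚ.*_) (⟦⟧-- k 1ℤ))))))))

    W : Series
    W r = ∑P r q weight

    conv-shift : ∀ r → conv (shift E) (expSeries (a q)) r ≡ shift (expSeries (a (suc q))) r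
    conv-shift zero    = conv-shiftˡ E (expSeries (a q)) zero
    conv-shift (suc r) = trans (conv-shiftˡ E (expSeries (a q)) (suc r)) (conv-expSeries α′ (a q) r)

    shift-cong : ∀ {f g : Series} → f ≗ g → shift f ≗ shift g
    shift-cong eq zero    = refl
    shift-cong eq (suc n) = eq n

    ∑f₁ : ∑P n (suc q) f₁ ≡ M q ℚ.* X ℚ.+ N q ℚ.* X²
    ∑f₁ = trans (∑P-conv n q E (λ rp → weight (proj₂ rp) ℚ.* ⟦ crossTerms S T η (proj₂ rp) ⟧))
      (trans (conv-cong {E} (λ _ → refl) (λ r → ∑-cross r q) n)
        (trans (conv-+ʳ E (λ r → M q ℚ.* shift (expSeries (a q)) r) (λ r → N q ℚ.* shift (shift (expSeries (a q))) r) n)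
          (cong₂ ℚ._+_
            (trans (conv-*ʳ (M q) E (shift (expSeries (a q))) n) (cong (M q ℚ.*_)
              (trans (conv-shiftʳ E (expSeries (a q)) n) (shift-cong (conv-expSeries α′ (a q)) n))))
            (trans (conv-*ʳ (N q) E (shift (shift (expSeries (a q)))) n) (cong (N q ℚ.*_)
              (trans (conv-shiftʳ E (shift (expSeries (a q))) n) (shift-cong (λ r →
                trans (conv-shiftʳ E (expSeries (a q)) r) (shift-cong (conv-expSeries α′ (a q)) r)) n)))))))

    ∑f₂ : ∑P n (suc q) f₂ ≡ α′ ℚ.* X
    ∑f₂ = trans (∑P-conv n q (λ k → # k ℚ.* E k) (λ rp → weight (proj₂ rp)))
      (trans (conv-cong (#*expSeries α′) (λ r → ∑-weight r q) n)
        (trans (conv-*ˡ α′ (shift E) (expSeries (a q)) n) (cong (α′ ℚ.*_) (conv-shift n))))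

    ∑f₃ : ∑P n (suc q) f₃ ≡ α′ ℚ.* (a q ℚ.* X²)
    ∑f₃ = trans (∑P-conv n q (λ k → # k ℚ.* E k) (λ rp → # (proj₁ rp) ℚ.* weight (proj₂ rp)))
      (trans (conv-cong (#*expSeries α′) (λ r → trans (∑P-* r q (# r) weight)
          (trans (cong (# r ℚ.*_) (∑-weight r q)) (#*expSeries (a q) r))) n)
        (trans (conv-*ˡ α′ (shift E) (λ r → a q ℚ.* shift (expSeries (a q)) r) n) (cong (α′ ℚ.*_)
          (trans (conv-*ʳ (a q) (shift E) (shift (expSeries (a q))) n) (cong (a q ℚ.*_)
            (trans (conv-shiftʳ (shift E) (expSeries (a q)) n) (shift-cong conv-shift n)))))))

    ∑f₄ : ∑P n (suc q) f₄ ≡ α′ ℚ.* α′ ℚ.* X²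
    ∑f₄ = trans (∑P-conv n q (λ k → # k ℚ.* (# k ℚ.- 1ℚ) ℚ.* E k) (λ rp → weight (proj₂ rp)))
      (trans (conv-cong (##*expSeries α′) (λ r → ∑-weight r q) n)
        (trans (conv-*ˡ (α′ ℚ.* α′) (shift (shift E)) (expSeries (a q)) n) (cong (α′ ℚ.* α′ ℚ.*_)
          (trans (conv-shiftˡ (shift E) (expSeries (a q)) n) (shift-cong conv-shift n)))))

-- Evaluation of the average

-- Six times the sum of the squares 1², ..., m².
pyramid : ℚ → ℚ
pyramid m = m ℚ.* (m ℚ.+ 1ℚ) ℚ.* (# 2 ℚ.* m ℚ.+ 1ℚ)

-- The values of `M` and `N` when α_0 = ½ and α_1 = ... = α_m = 1. The partial exponent before h is
-- then h - ½, so the bracket in `N` equals 2 (h - ½) + 1 = 2 h, and N is -8 S T times the sum of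
-- the h².
closedM closedN : ℚ → ℚ → ℚ → ℚ → ℚ
closedM S T η m = + 2 / 3 ℚ.* S ℚ.* S ℚ.* pyramid m ℚ.- # 2 ℚ.* S ℚ.* T ℚ.* η ℚ.* (m ℚ.* (m ℚ.+ 1ℚ))
closedN S T η m = ℚ.- (+ 4 / 3 ℚ.* S ℚ.* T ℚ.* pyramid m)

linCoeffℚ quadCoeffℚ : ℚ → ℚ → ℚ → ℚ → ℚ
linCoeffℚ S T η q    = # 4 ℚ.* S ℚ.* S ℚ.* q ℚ.* q ℚ.- # 4 ℚ.* S ℚ.* T ℚ.* η ℚ.* q
quadCoeffℚ S T η q = ℚ.- (# 4 ℚ.* S ℚ.* T ℚ.* q)

-- Three times the sum of the squares (2 b + η)² for b < n.
oddSquaresℚ : ℚ → ℚ → ℚ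
oddSquaresℚ η n = # 2 ℚ.* n ℚ.* (n ℚ.- 1ℚ) ℚ.* (# 2 ℚ.* n ℚ.- 1ℚ)
                  ℚ.+ # 6 ℚ.* η ℚ.* n ℚ.* (n ℚ.- 1ℚ) ℚ.+ # 3 ℚ.* η ℚ.* η ℚ.* n

-- 24 T² S times the average size. The factor T² = 4 a² clears the denominators in X = n E / a and
-- X² = n (n - 1) E / a², so the total weight E divides out and a polynomial remains.
momentPolynomial : (S T η n a M N : ℚ) → ℚ
momentPolynomial S T η n a M N =
  T ℚ.* T ℚ.* (T ℚ.* T ℚ.* (# 2 ℚ.* oddSquaresℚ η n)) ℚ.+ # 24 ℚ.* (M ℚ.* a ℚ.* n ℚ.+ N ℚ.* (n ℚ.* (n ℚ.- 1ℚ)))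
  ℚ.- T ℚ.* T ℚ.* (S ℚ.* S ℚ.* S ℚ.- S)

private
  -- These are copies of the preceding formulas as solver syntax.
  pyramid′ : ∀ {k} → Polynomial k → Polynomial k
  pyramid′ m = m :* (m :+ con 1ℚ) :* (con (# 2) :* m :+ con 1ℚ)
  closedM′ closedN′ linear′ quadratic′ : ∀ {k} → (S T η m : Polynomial k) → Polynomial k
  closedM′ S T η m = con (+ 2 / 3) :* S :* S :* pyramid′ m :- con (# 2) :* S :* T :* η :* (m :* (m :+ con 1ℚ))
  closedN′ S T η m = :- (con (+ 4 / 3) :* S :* T :* pyramid′ m)
  linear′ S T η q = con (# 4) :* S :* S :* q :* q :- con (# 4) :* S :* T :* η :* q
  quadratic′ S T η q = :- (con (# 4) :* S :* T :* q)
  oddSquares′ : ∀ {k} → (η n : Polynomial k) → Polynomial k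
  oddSquares′ η n = con (# 2) :* n :* (n :- con 1ℚ) :* (con (# 2) :* n :- con 1ℚ)
                    :+ con (# 6) :* η :* n :* (n :- con 1ℚ) :+ con (# 3) :* η :* η :* n
  moment′ : ∀ {k} → (S T η n a M N : Polynomial k) → Polynomial k
  moment′ S T η n a M N =
    T :* T :* (T :* T :* (con (# 2) :* oddSquares′ η n)) :+ con (# 24) :* (M :* a :* n :+ N :* (n :* (n :- con 1ℚ)))
    :- T :* T :* (S :* S :* S :- S)

closedM-suc : ∀ S T η m → closedM S T η m ℚ.+ linCoeffℚ S T η (1ℚ ℚ.+ m) ℚ.* 1ℚ ≡ closedM S T η (1ℚ ℚ.+ m)
closedM-suc = solveℚ 4 (λ S T η m → closedM′ S T η m :+ linear′ S T η (con 1ℚ :+ m) :* con 1ℚ :=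
  closedM′ S T η (con 1ℚ :+ m)) refl

closedN-suc : ∀ S T η m →
  closedN S T η m ℚ.+ quadCoeffℚ S T η (1ℚ ℚ.+ m) ℚ.* (# 2 ℚ.* 1ℚ ℚ.* (m ℚ.+ ½) ℚ.+ 1ℚ ℚ.* 1ℚ) ≡
  closedN S T η (1ℚ ℚ.+ m)
closedN-suc = solveℚ 4 (λ S T η m → closedN′ S T η m :+ quadratic′ S T η (con 1ℚ :+ m) :*
    (con (# 2) :* con 1ℚ :* (m :+ con ½) :+ con 1ℚ :* con 1ℚ) :=
  closedN′ S T η (con 1ℚ :+ m)) refl

-- The identity depends on ε² = ε (it already fails at n = 0 for general ε), so the two values of ε
-- are separate polynomial identities.
moment-odd : ∀ n m ε → ε ≡ 0ℚ ⊎ ε ≡ 1ℚ →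
  let S = n ℚ.+ (ε ℚ.+ n) ; T = m ℚ.+ (1ℚ ℚ.+ m) ; η = 1ℚ ℚ.+ ε in
  momentPolynomial S T η n (m ℚ.+ ½) (closedM S T η m) (closedN S T η m) ≡
  T ℚ.* T ℚ.* S ℚ.* ((S ℚ.- 1ℚ) ℚ.* (T ℚ.* T ℚ.- 1ℚ))
moment-odd n m ε = λ { (inj₁ refl) → solveℚ 2 (identity 0ℚ) refl n m ; (inj₂ refl) → solveℚ 2 (identity 1ℚ) refl n m }
  where
  identity : ℚ → (n m : Polynomial 2) → Polynomial 2 × Polynomial 2
  identity ε n m =
    let S = n :+ (con ε :+ n) ; T = m :+ (con 1ℚ :+ m) ; η = con 1ℚ :+ con ε in
    moment′ S T η n (m :+ con ½) (closedM′ S T η m) (closedN′ S T η m) :=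
    T :* T :* S :* ((S :- con 1ℚ) :* (T :* T :- con 1ℚ))

-- Here q = m + 1 and the last value h = q has weight ½ instead of 1, so `M` and `N` take one more
-- step of their recursion from the closed forms at m. As t is even, s is odd, whence ε = 1 and η =
-- 2.
moment-even : ∀ n m →
  let S = n ℚ.+ (1ℚ ℚ.+ n) ; q = 1ℚ ℚ.+ m ; T = q ℚ.+ (0ℚ ℚ.+ q) ; η = 1ℚ ℚ.+ 1ℚ in
  momentPolynomial S T η n (½ ℚ.+ (m ℚ.+ ½)) (closedM S T η m ℚ.+ linCoeffℚ S T η q ℚ.* ½)
    (closedN S T η m ℚ.+ quadCoeffℚ S T η q ℚ.* (# 2 ℚ.* ½ ℚ.* (m ℚ.+ ½) ℚ.+ ½ ℚ.* ½)) ≡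
  T ℚ.* T ℚ.* S ℚ.* ((S ℚ.- 1ℚ) ℚ.* (T ℚ.* T ℚ.+ # 2))
moment-even = solveℚ 2 (λ n m →
  let S = n :+ (con 1ℚ :+ n) ; q = con 1ℚ :+ m ; T = q :+ (con 0ℚ :+ q) ; η = con 1ℚ :+ con 1ℚ in
  moment′ S T η n (con ½ :+ (m :+ con ½)) (closedM′ S T η m :+ linear′ S T η q :* con ½)
    (closedN′ S T η m :+ quadratic′ S T η q :* (con (# 2) :* con ½ :* (m :+ con ½) :+ con ½ :* con ½)) :=
  T :* T :* S :* ((S :- con 1ℚ) :* (T :* T :+ con (# 2)))) refl

-- E, X and X² stand for the coefficients of xⁿ in e^(a x), x e^(a x) and x² e^(a x).
combine-moments : ∀ S a η n M N B E X X² V D → let T = a ℚ.+ a in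
  # 3 ℚ.* B ≡ oddSquaresℚ η n → n ℚ.* E ≡ a ℚ.* X → n ℚ.* (n ℚ.- 1ℚ) ℚ.* E ≡ a ℚ.* a ℚ.* X² →
  # 24 ℚ.* S ℚ.* V ℚ.+ (S ℚ.* S ℚ.* S ℚ.- S) ℚ.* E ≡ # 6 ℚ.* (T ℚ.* T ℚ.* B ℚ.* E ℚ.+ (M ℚ.* X ℚ.+ N ℚ.* X²)) →
  momentPolynomial S T η n a M N ≡ T ℚ.* T ℚ.* S ℚ.* D →
  # 24 ℚ.* (T ℚ.* T ℚ.* S) ℚ.* V ≡ T ℚ.* T ℚ.* S ℚ.* D ℚ.* E
combine-moments S a η n M N B E X X² V D 3B nE n²E total poly = begin
  # 24 ℚ.* (T ℚ.* T ℚ.* S) ℚ.* V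
    ≡⟨ solveℚ 5 (λ S T V E D → con (# 24) :* (T :* T :* S) :* V :=
         T :* T :* (con (# 24) :* S :* V :+ (S :* S :* S :- S) :* E) :- T :* T :* (S :* S :* S :- S) :* E) refl S T V E D ⟩
  T ℚ.* T ℚ.* (# 24 ℚ.* S ℚ.* V ℚ.+ (S ℚ.* S ℚ.* S ℚ.- S) ℚ.* E) ℚ.- W ℚ.* E
    ≡⟨ cong (λ x → T ℚ.* T ℚ.* x ℚ.- W ℚ.* E) total ⟩
  T ℚ.* T ℚ.* (# 6 ℚ.* (T ℚ.* T ℚ.* B ℚ.* E ℚ.+ (M ℚ.* X ℚ.+ N ℚ.* X²))) ℚ.- W ℚ.* E
    ≡⟨ solveℚ 8 (λ S a B E M X N X² → let T = a :+ a in
         T :* T :* (con (# 6) :* (T :* T :* B :* E :+ (M :* X :+ N :* X²))) :- T :* T :* (S :* S :* S :- S) :* E :=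
         T :* T :* (T :* T :* (con (# 2) :* (con (# 3) :* B))) :* E :+ con (# 24) :* (M :* a :* (a :* X) :+ N :* (a :* a :* X²))
         :- T :* T :* (S :* S :* S :- S) :* E) refl S a B E M X N X² ⟩
  T ℚ.* T ℚ.* (T ℚ.* T ℚ.* (# 2 ℚ.* (# 3 ℚ.* B))) ℚ.* E ℚ.+ # 24 ℚ.* (M ℚ.* a ℚ.* (a ℚ.* X) ℚ.+ N ℚ.* (a ℚ.* a ℚ.* X²))
    ℚ.- W ℚ.* E
    ≡⟨ cong₂ (λ b y → T ℚ.* T ℚ.* (T ℚ.* T ℚ.* (# 2 ℚ.* b)) ℚ.* E ℚ.+ # 24 ℚ.* y ℚ.- W ℚ.* E)
         3B (cong₂ (λ x y → M ℚ.* a ℚ.* x ℚ.+ N ℚ.* y) (sym nE) (sym n²E)) ⟩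
  T ℚ.* T ℚ.* (T ℚ.* T ℚ.* (# 2 ℚ.* b)) ℚ.* E ℚ.+ # 24 ℚ.* (M ℚ.* a ℚ.* (n ℚ.* E) ℚ.+ N ℚ.* (n ℚ.* (n ℚ.- 1ℚ) ℚ.* E))
    ℚ.- W ℚ.* E
    ≡⟨ solveℚ 8 (λ S T a b E M N n →
         T :* T :* (T :* T :* (con (# 2) :* b)) :* E :+ con (# 24) :* (M :* a :* (n :* E) :+ N :* (n :* (n :- con 1ℚ) :* E))
           :- T :* T :* (S :* S :* S :- S) :* E :=
         (T :* T :* (T :* T :* (con (# 2) :* b)) :+ con (# 24) :* (M :* a :* n :+ N :* (n :* (n :- con 1ℚ)))
           :- T :* T :* (S :* S :* S :- S)) :* E) refl S T a b E M N n ⟩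
  momentPolynomial S T η n a M N ℚ.* E
    ≡⟨ cong (ℚ._* E) poly ⟩
  T ℚ.* T ℚ.* S ℚ.* D ℚ.* E ∎
  where
  open ≡-Reasoning
  T = a ℚ.+ a
  W = T ℚ.* T ℚ.* (S ℚ.* S ℚ.* S ℚ.- S)
  b = oddSquaresℚ η n

-- Reciprocals of the stabilizer orders as weights of paths

signCount-nonZero : ∀ b → NonZero (signCount b)
signCount-nonZero true  = _
signCount-nonZero false = _

groupOrder-nonZero : ∀ (free : ℕ → Bool) {n q} (p : Path n q) → NonZero (groupOrder (signCount ∘ free) p)
groupOrder-nonZero free (base {n}) = ℕ.m*n≢0 (n !) _ {{n ℕ.!≢0}} {{ℕ.m^n≢0 _ n {{signCount-nonZero (free 0)}}}}
groupOrder-nonZero free (stop p)   = groupOrder-nonZero free p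
groupOrder-nonZero free (take {q = q} p) = ℕ.m*n≢0 _ _ {{ℕ.m*n≢0 _ _ {{signCount-nonZero (free (suc q))}}}}
  {{groupOrder-nonZero free p}}

signWeight : Bool → ℚ
signWeight b = inv (signCount b) {{signCount-nonZero b}}

inv-cong : ∀ {k l} .{{_ : NonZero k}} .{{_ : NonZero l}} → k ≡ l → inv k ≡ inv l
inv-cong refl = refl

inv-base : ∀ n k .{{_ : NonZero k}} .{{_ : NonZero (n ! ℕ.* k ℕ.^ n)}} → inv (n ! ℕ.* k ℕ.^ n) ≡ expSeries (inv k) n
inv-base zero    k = refl
inv-base (suc n) k = trans (inv-cong (rearrange (suc n) (n !) k (k ℕ.^ n)))
  (trans (inv-* (k ℕ.* suc n) (n ! ℕ.* k ℕ.^ n))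
    (cong₂ ℚ._*_ (inv-* k (suc n)) (inv-base n k)))
  where
  instance
    k*suc≢0 : NonZero (k ℕ.* suc n)
    k*suc≢0 = ℕ.m*n≢0 k (suc n)
    base≢0 : NonZero (n ! ℕ.* k ℕ.^ n)
    base≢0 = ℕ.m*n≢0 (n !) (k ℕ.^ n) {{n ℕ.!≢0}} {{ℕ.m^n≢0 k n}}
    product≢0 : NonZero (k ℕ.* suc n ℕ.* (n ! ℕ.* k ℕ.^ n))
    product≢0 = ℕ.m*n≢0 (k ℕ.* suc n) (n ! ℕ.* k ℕ.^ n)
  rearrange : ∀ s f k p → s ℕ.* f ℕ.* (k ℕ.* p) ≡ k ℕ.* s ℕ.* (f ℕ.* p)
  rearrange = ℕ-Ring.solve-∀

module _ (S T η : ℤ) (free : ℕ → Bool) where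
  open WeightedSums S T η (signWeight ∘ free)

  inv-groupOrder : ∀ {n q} (p : Path n q) .{{_ : NonZero (groupOrder (signCount ∘ free) p)}} →
                   inv (groupOrder (signCount ∘ free) p) ≡ weight p
  inv-groupOrder (base {n})       = inv-base n (signCount (free 0)) {{signCount-nonZero (free 0)}}
  inv-groupOrder (stop p)         = inv-groupOrder p
  inv-groupOrder (take {q = q} p) = trans (inv-* (signCount (free (suc q)) ℕ.* suc (top p)) (groupOrder (signCount ∘ free) p))
    (cong₂ ℚ._*_ (inv-* (signCount (free (suc q))) (suc (top p))) (inv-groupOrder p))
    where
    instance
      sign≢0 = signCount-nonZero (free (suc q))
      factor≢0 = ℕ.m*n≢0 (signCount (free (suc q))) (suc (top p))
      order≢0 = groupOrder-nonZero free p

module ClosedForms (S T η : ℤ) (α : ℕ → ℚ) (α-0 : α 0 ≡ ½) where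
  open WeightedSums S T η α

  linear quadratic M* N* : ℚ → ℚ
  linear    = linCoeffℚ ⟦ S ⟧ ⟦ T ⟧ ⟦ η ⟧
  quadratic = quadCoeffℚ ⟦ S ⟧ ⟦ T ⟧ ⟦ η ⟧
  M*        = closedM ⟦ S ⟧ ⟦ T ⟧ ⟦ η ⟧
  N*        = closedN ⟦ S ⟧ ⟦ T ⟧ ⟦ η ⟧

  ⟦linear⟧ : ∀ q → ⟦ linCoeff S T η q ⟧ ≡ linear (# q)
  ⟦linear⟧ q = trans (⟦⟧-- (+ 4 * S * S * + q * + q) (+ 4 * S * T * η * + q)) (cong₂ ℚ._-_
    (trans (⟦⟧-* (+ 4 * S * S * + q) (+ q)) (cong (ℚ._* # q) (trans (⟦⟧-* (+ 4 * S * S) (+ q)) (cong (ℚ._* # q)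
      (trans (⟦⟧-* (+ 4 * S) S) (cong (ℚ._* ⟦ S ⟧) (⟦⟧-* (+ 4) S)))))))
    (trans (⟦⟧-* (+ 4 * S * T * η) (+ q)) (cong (ℚ._* # q) (trans (⟦⟧-* (+ 4 * S * T) η) (cong (ℚ._* ⟦ η ⟧)
      (trans (⟦⟧-* (+ 4 * S) T) (cong (ℚ._* ⟦ T ⟧) (⟦⟧-* (+ 4) S))))))))

  ⟦quadratic⟧ : ∀ q → ⟦ quadCoeff S T η q ⟧ ≡ quadratic (# q)
  ⟦quadratic⟧ q = trans (⟦⟧-neg (+ 4 * S * T * + q)) (cong ℚ.-_ (trans (⟦⟧-* (+ 4 * S * T) (+ q)) (cong (ℚ._* # q)
      (trans (⟦⟧-* (+ 4 * S) T) (cong (ℚ._* ⟦ T ⟧) (⟦⟧-* (+ 4) S))))))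

  Ones : ℕ → Set
  Ones m = ∀ {h} → h ℕ.< m → α (suc h) ≡ 1ℚ

  ones-pred : ∀ {m} → Ones (suc m) → Ones m
  ones-pred ones h<m = ones (ℕ.m≤n⇒m≤1+n h<m)

  a-closed : ∀ m → Ones m → a m ≡ # m ℚ.+ ½
  a-closed zero    ones = trans α-0 (sym (ℚ.+-identityˡ ½))
  a-closed (suc m) ones = trans (cong₂ ℚ._+_ (ones ℕ.≤-refl) (a-closed m (ones-pred ones)))
    (trans (sym (ℚ.+-assoc 1ℚ (# m) ½)) (cong (ℚ._+ ½) (sym (#-suc m))))

  M-step : ∀ m → M (suc m) ≡ M m ℚ.+ linear (1ℚ ℚ.+ # m) ℚ.* α (suc m)
  M-step m = cong (λ x → M m ℚ.+ x ℚ.* α (suc m))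
    (trans (⟦linear⟧ (suc m)) (cong linear (#-suc m)))

  N-step : ∀ m → N (suc m) ≡ N m ℚ.+ quadratic (1ℚ ℚ.+ # m) ℚ.*
                               (# 2 ℚ.* α (suc m) ℚ.* a m ℚ.+ α (suc m) ℚ.* α (suc m))
  N-step m = cong (λ x → N m ℚ.+ x ℚ.* (# 2 ℚ.* α (suc m) ℚ.* a m ℚ.+ α (suc m) ℚ.* α (suc m)))
    (trans (⟦quadratic⟧ (suc m)) (cong quadratic (#-suc m)))

  M-closed : ∀ m → Ones m → M m ≡ M* (# m)
  M-closed zero    ones = zero-closed ⟦ S ⟧ ⟦ T ⟧ ⟦ η ⟧
    where
    zero-closed : ∀ S T η → 0ℚ ≡ closedM S T η 0ℚ
    zero-closed = solveℚ 3 (λ S T η → con 0ℚ := con (+ 2 / 3) :* S :* S :* (con 0ℚ :* (con 0ℚ :+ con 1ℚ) :*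
      (con (# 2) :* con 0ℚ :+ con 1ℚ)) :- con (# 2) :* S :* T :* η :* (con 0ℚ :* (con 0ℚ :+ con 1ℚ))) refl
  M-closed (suc m) ones = begin
    M (suc m)
      ≡⟨ M-step m ⟩
    M m ℚ.+ linear (1ℚ ℚ.+ # m) ℚ.* α (suc m)
      ≡⟨ cong₂ (λ x y → x ℚ.+ linear (1ℚ ℚ.+ # m) ℚ.* y) (M-closed m (ones-pred ones)) (ones ℕ.≤-refl) ⟩
    M* (# m) ℚ.+ linear (1ℚ ℚ.+ # m) ℚ.* 1ℚ
      ≡⟨ closedM-suc ⟦ S ⟧ ⟦ T ⟧ ⟦ η ⟧ (# m) ⟩
    M* (1ℚ ℚ.+ # m)
      ≡⟨ cong M* (#-suc m) ⟨
    M* (# (suc m)) ∎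
    where open ≡-Reasoning

  N-closed : ∀ m → Ones m → N m ≡ N* (# m)
  N-closed zero    ones = zero-closed ⟦ S ⟧ ⟦ T ⟧
    where
    zero-closed : ∀ S T → 0ℚ ≡ closedN S T ⟦ η ⟧ 0ℚ
    zero-closed = solveℚ 2 (λ S T → con 0ℚ := :- (con (+ 4 / 3) :* S :* T :* (con 0ℚ :* (con 0ℚ :+ con 1ℚ) :*
      (con (# 2) :* con 0ℚ :+ con 1ℚ)))) refl
  N-closed (suc m) ones = begin
    N (suc m)
      ≡⟨ N-step m ⟩
    N m ℚ.+ Q ℚ.* (# 2 ℚ.* α (suc m) ℚ.* a m ℚ.+ α (suc m) ℚ.* α (suc m))
      ≡⟨ cong₂ (λ x y → x ℚ.+ Q ℚ.* y) (N-closed m (ones-pred ones))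
           (cong₂ (λ α a → # 2 ℚ.* α ℚ.* a ℚ.+ α ℚ.* α) (ones ℕ.≤-refl) (a-closed m (ones-pred ones))) ⟩
    N* (# m) ℚ.+ Q ℚ.* (# 2 ℚ.* 1ℚ ℚ.* (# m ℚ.+ ½) ℚ.+ 1ℚ ℚ.* 1ℚ)
      ≡⟨ closedN-suc ⟦ S ⟧ ⟦ T ⟧ ⟦ η ⟧ (# m) ⟩
    N* (1ℚ ℚ.+ # m)
      ≡⟨ cong N* (#-suc m) ⟨
    N* (# (suc m)) ∎
    where
    open ≡-Reasoning
    Q = quadratic (1ℚ ℚ.+ # m)

free-false : ∀ t h → h ≢ 0 → h ℕ.+ h ≢ t → free t h ≡ false
free-false t h h≢0 2h≢t = dec-false (free? t h) [ h≢0 , 2h≢t ]′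

÷-unique : ∀ {x y z} .{{nz : ℚ.NonZero y}} → x ≡ z ℚ.* y → (x ℚ.÷ y) ≡ z
÷-unique {x} {y} {z} eq = trans (cong (ℚ._* (ℚ.1/ y)) eq)
  (trans (ℚ.*-assoc z y (ℚ.1/ y)) (trans (cong (z ℚ.*_) (ℚ.*-inverseʳ y)) (ℚ.*-identityʳ z)))

|Stab|⁻¹≡inv : ∀ {s t} (cores : Finite (𝒟∩𝒟 s t)) (stabs : FiniteStabs s t) i k .{{_ : NonZero k}} →
               card (stabs (core cores stabs i) (proj₂ (element cores i))) ≡ k → |Stab|⁻¹ cores stabs i ≡ inv k
|Stab|⁻¹≡inv cores stabs i k refl = refl

module Average (𝕊 : Setting) where
  open Cells 𝕊
  open CoreEnumeration 𝕊
  private module C = PathCore 𝕊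

  abstract
    stabCard : ∀ μ (μ∈ : μ ∈ 𝒟 s × μ ∈ 𝒟 t) →
               HasCard (Stab s t μ) (groupOrder (signCount ∘ free t) (proj₁ (pathOf μ μ∈)))
    stabCard μ μ∈ = StabCard.hasCard-Stab 𝕊 (proj₁ (pathOf μ μ∈)) μ (proj₁ μ∈) (proj₂ (pathOf μ μ∈))

    stabs : FiniteStabs s t
    stabs μ μ∈ = proj₁ (stabCard μ μ∈)

    -- The order was computed for the path extracted from μ; uniqueness of the realizing path
    -- carries it over to the path from which an enumerated core was built.
    card-stabs : ∀ p μ (μ∈ : μ ∈ 𝒟 s × μ ∈ 𝒟 t) → C.Realizes p μ → card (stabs μ μ∈) ≡ groupOrder (signCount ∘ free t) p
    card-stabs p μ μ∈ realizes = trans (proj₂ (stabCard μ μ∈))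
      (cong (groupOrder (signCount ∘ free t)) (realizes-injective {μ = μ} (proj₂ (pathOf μ μ∈)) realizes))

  card-element : ∀ i → card (stabs (core cores stabs i) (proj₂ (element cores i))) ≡
                       groupOrder (signCount ∘ free t) (pathAt n q i)
  card-element i = card-stabs (pathAt n q i) (core cores stabs i) (proj₂ (element cores i))
    (C.pathCore-realizes (pathAt n q i))

  η : ℤ
  η = 1ℤ + + ε

  α : ℕ → ℚ
  α = signWeight ∘ free t

  open WeightedSums S T η α
  open ClosedForms S T η α refl

  private
    sizeℚ : Path n q → ℚ
    sizeℚ p = # (size (C.pathCore p))

    |Stab|⁻¹-weight : ∀ i → |Stab|⁻¹ cores stabs i ≡ weight (pathAt n q i)
    |Stab|⁻¹-weight i = trans (|Stab|⁻¹≡inv cores stabs i (groupOrder (signCount ∘ free t) p) (card-element i))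
      (inv-groupOrder S T η (free t) p)
      where
      p = pathAt n q i
      instance order≢0 = groupOrder-nonZero (free t) p

    B TTB S³-S : ℚ
    B    = ⟦ oddSquares S T η n ⟧
    TTB  = ⟦ T ⟧ ℚ.* ⟦ T ⟧ ℚ.* B
    S³-S = ⟦ S ⟧ ℚ.* ⟦ S ⟧ ℚ.* ⟦ S ⟧ ℚ.- ⟦ S ⟧

    size-rational : ∀ p → # 24 ℚ.* ⟦ S ⟧ ℚ.* sizeℚ p ℚ.+ S³-S ≡
                    # 6 ℚ.* (TTB ℚ.+ ⟦ crossTerms S T η p ⟧)
    size-rational p = trans (sym left) (trans (cong ⟦_⟧ (PathSize.size-path 𝕊 p)) right)
      where
      left : ⟦ + 24 * S * + size (C.pathCore p) + (S * S * S - S) ⟧ ≡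
             # 24 ℚ.* ⟦ S ⟧ ℚ.* sizeℚ p ℚ.+ S³-S
      left = trans (⟦⟧-+ (+ 24 * S * + size (C.pathCore p)) (S * S * S - S)) (cong₂ ℚ._+_
        (trans (⟦⟧-* (+ 24 * S) (+ size (C.pathCore p))) (cong (ℚ._* sizeℚ p) (⟦⟧-* (+ 24) S)))
        (trans (⟦⟧-- (S * S * S) S) (cong (ℚ._- ⟦ S ⟧) (trans (⟦⟧-* (S * S) S) (cong (ℚ._* ⟦ S ⟧) (⟦⟧-* S S))))))
      right : ⟦ + 6 * (T * T * oddSquares S T η n + crossTerms S T η p) ⟧ ≡
              # 6 ℚ.* (TTB ℚ.+ ⟦ crossTerms S T η p ⟧)
      right = trans (⟦⟧-* (+ 6) (T * T * oddSquares S T η n + crossTerms S T η p)) (cong (# 6 ℚ.*_)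
        (trans (⟦⟧-+ (T * T * oddSquares S T η n) (crossTerms S T η p)) (cong (ℚ._+ ⟦ crossTerms S T η p ⟧)
          (trans (⟦⟧-* (T * T) (oddSquares S T η n)) (cong (ℚ._* B) (⟦⟧-* T T))))))

    3B : # 3 ℚ.* B ≡ oddSquaresℚ ⟦ η ⟧ (# n)
    3B = trans (sym (⟦⟧-* (+ 3) (oddSquares S T η n))) (trans (cong ⟦_⟧ (3*oddSquares S T η n)) embed)
      where
      m = + n
      n-1 : ⟦ m - 1ℤ ⟧ ≡ # n ℚ.- 1ℚ
      n-1 = ⟦⟧-- m 1ℤ
      embed : ⟦ + 2 * m * (m - 1ℤ) * (+ 2 * m - 1ℤ) + + 6 * η * m * (m - 1ℤ) + + 3 * η * η * m ⟧ ≡ oddSquaresℚ ⟦ η ⟧ (# n)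
      embed = trans (⟦⟧-+ (+ 2 * m * (m - 1ℤ) * (+ 2 * m - 1ℤ) + + 6 * η * m * (m - 1ℤ)) (+ 3 * η * η * m)) (cong₂ ℚ._+_
        (trans (⟦⟧-+ (+ 2 * m * (m - 1ℤ) * (+ 2 * m - 1ℤ)) (+ 6 * η * m * (m - 1ℤ))) (cong₂ ℚ._+_
          (trans (⟦⟧-* (+ 2 * m * (m - 1ℤ)) (+ 2 * m - 1ℤ)) (cong₂ ℚ._*_
            (trans (⟦⟧-* (+ 2 * m) (m - 1ℤ)) (cong₂ ℚ._*_ (⟦⟧-* (+ 2) m) n-1))
            (trans (⟦⟧-- (+ 2 * m) 1ℤ) (cong (ℚ._- 1ℚ) (⟦⟧-* (+ 2) m)))))
          (trans (⟦⟧-* (+ 6 * η * m) (m - 1ℤ)) (cong₂ ℚ._*_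
            (trans (⟦⟧-* (+ 6 * η) m) (cong (ℚ._* # n) (⟦⟧-* (+ 6) η))) n-1))))
        (trans (⟦⟧-* (+ 3 * η * η) m) (cong (ℚ._* # n) (trans (⟦⟧-* (+ 3 * η) η) (cong (ℚ._* ⟦ η ⟧) (⟦⟧-* (+ 3) η))))))

    E X X² : ℚ
    E  = expSeries (a q) n
    X  = shift (expSeries (a q)) n
    X² = shift (shift (expSeries (a q))) n

    total : ℚ
    total = ∑P n q (λ p → weight p ℚ.* sizeℚ p)

    total-moments : # 24 ℚ.* ⟦ S ⟧ ℚ.* total ℚ.+ S³-S ℚ.* E ≡
                    # 6 ℚ.* (TTB ℚ.* E ℚ.+ (M q ℚ.* X ℚ.+ N q ℚ.* X²))
    total-moments = begin
      24S ℚ.* total ℚ.+ S³-S ℚ.* E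
        ≡⟨ cong (λ e → 24S ℚ.* total ℚ.+ S³-S ℚ.* e) (∑-weight n q) ⟨
      24S ℚ.* total ℚ.+ S³-S ℚ.* ∑P n q weight
        ≡⟨ cong₂ ℚ._+_ (∑P-* n q 24S (λ p → weight p ℚ.* sizeℚ p)) (∑P-* n q S³-S weight) ⟨
      ∑P n q (λ p → 24S ℚ.* (weight p ℚ.* sizeℚ p)) ℚ.+ ∑P n q (λ p → S³-S ℚ.* weight p)
        ≡⟨ ∑P-+ n q (λ p → 24S ℚ.* (weight p ℚ.* sizeℚ p)) (λ p → S³-S ℚ.* weight p) ⟨
      ∑P n q (λ p → 24S ℚ.* (weight p ℚ.* sizeℚ p) ℚ.+ S³-S ℚ.* weight p)
        ≡⟨ ∑P-cong n q (λ p → trans (collect 24S (weight p) (sizeℚ p) S³-S) (trans (cong (weight p ℚ.*_) (size-rational p))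
             (distribute (weight p) (TTB) ⟦ crossTerms S T η p ⟧))) ⟩
      ∑P n q (λ p → # 6 ℚ.* (TTB ℚ.* weight p ℚ.+ weight p ℚ.* ⟦ crossTerms S T η p ⟧))
        ≡⟨ trans (∑P-* n q (# 6) _) (cong (# 6 ℚ.*_) (trans (∑P-+ n q (λ p → TTB ℚ.* weight p) _)
             (cong₂ ℚ._+_ (trans (∑P-* n q (TTB) weight) (cong (TTB ℚ.*_) (∑-weight n q)))
               (∑-cross n q)))) ⟩
      # 6 ℚ.* (TTB ℚ.* E ℚ.+ (M q ℚ.* X ℚ.+ N q ℚ.* X²)) ∎
      where
      open ≡-Reasoning
      24S = # 24 ℚ.* ⟦ S ⟧
      collect : ∀ s w z r → s ℚ.* (w ℚ.* z) ℚ.+ r ℚ.* w ≡ w ℚ.* (s ℚ.* z ℚ.+ r)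
      collect = solveℚ 4 (λ s w z r → s :* (w :* z) :+ r :* w := w :* (s :* z :+ r)) refl
      distribute : ∀ w b z → w ℚ.* (# 6 ℚ.* (b ℚ.+ z)) ≡ # 6 ℚ.* (b ℚ.* w ℚ.+ w ℚ.* z)
      distribute = solveℚ 3 (λ w b z → w :* (con (# 6) :* (b :+ z)) := con (# 6) :* (b :* w :+ w :* z)) refl

  average : ∀ D → a q ℚ.+ a q ≡ ⟦ T ⟧ →
            momentPolynomial ⟦ S ⟧ ⟦ T ⟧ ⟦ η ⟧ (# n) (a q) (M q) (N q) ≡ ⟦ T ⟧ ℚ.* ⟦ T ⟧ ℚ.* ⟦ S ⟧ ℚ.* ⟦ D ⟧ →
            weightedAverageSize cores stabs ≡ D / 24
  average D 2a≡T poly = ÷-unique {{totalWeight-nonZero cores stabs}} (begin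
    ∑ℚ (λ i → |Stab|⁻¹ cores stabs i ℚ.* sizeℚ (pathAt n q i))
      ≡⟨ ∑ℚ-cong (λ i → cong (ℚ._* sizeℚ (pathAt n q i)) (|Stab|⁻¹-weight i)) ⟩
    ∑ℚ (λ i → weight (pathAt n q i) ℚ.* sizeℚ (pathAt n q i))
      ≡⟨ ∑ℚ-paths n q (λ p → weight p ℚ.* sizeℚ p) ⟩
    total
      ≡⟨ total≡ ⟩
    D / 24 ℚ.* E
      ≡⟨ cong (D / 24 ℚ.*_) (trans (∑ℚ-cong |Stab|⁻¹-weight) (trans (∑ℚ-paths n q weight) (∑-weight n q))) ⟨
    D / 24 ℚ.* ∑ℚ (|Stab|⁻¹ cores stabs) ∎)
    where
    open ≡-Reasoning
    -- The moment identity holds after multiplication by t² s. This number is nonzero and is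
    -- cancelled in `total≡`.
    K = t ℕ.* t ℕ.* s
    instance
      tt≢0 = ℕ.m*n≢0 t t
      K≢0 = ℕ.m*n≢0 (t ℕ.* t) s
    ⟦K⟧ : # K ≡ ⟦ T ⟧ ℚ.* ⟦ T ⟧ ℚ.* ⟦ S ⟧
    ⟦K⟧ = trans (cong ⟦_⟧ (trans (ℤ.pos-* (t ℕ.* t) s) (cong (_* S) (ℤ.pos-* t t))))
            (trans (⟦⟧-* (T * T) S) (cong (ℚ._* ⟦ S ⟧) (⟦⟧-* T T)))

    scaled : # 24 ℚ.* # K ℚ.* total ≡ # K ℚ.* ⟦ D ⟧ ℚ.* E
    scaled = subst (λ k → # 24 ℚ.* k ℚ.* total ≡ k ℚ.* ⟦ D ⟧ ℚ.* E) (sym ⟦K⟧)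
      (subst (λ T′ → # 24 ℚ.* (T′ ℚ.* T′ ℚ.* ⟦ S ⟧) ℚ.* total ≡ T′ ℚ.* T′ ℚ.* ⟦ S ⟧ ℚ.* ⟦ D ⟧ ℚ.* E) 2a≡T
        (combine-moments ⟦ S ⟧ (a q) ⟦ η ⟧ (# n) (M q) (N q) B E X X² total ⟦ D ⟧ 3B
          (#*expSeries (a q) n) (##*expSeries (a q) n)
          (subst (λ T′ → # 24 ℚ.* ⟦ S ⟧ ℚ.* total ℚ.+ S³-S ℚ.* E ≡
                         # 6 ℚ.* (T′ ℚ.* T′ ℚ.* B ℚ.* E ℚ.+ (M q ℚ.* X ℚ.+ N q ℚ.* X²))) (sym 2a≡T) total-moments)
          (subst (λ T′ → momentPolynomial ⟦ S ⟧ T′ ⟦ η ⟧ (# n) (a q) (M q) (N q) ≡ T′ ℚ.* T′ ℚ.* ⟦ S ⟧ ℚ.* ⟦ D ⟧) (sym 2a≡T) poly)))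

    total≡ : total ≡ D / 24 ℚ.* E
    total≡ = begin
      total
        ≡⟨ solveℚ 1 (λ x → x := con (inv 24) :* con (# 24) :* (con 1ℚ :* x)) refl total ⟩
      inv 24 ℚ.* # 24 ℚ.* (1ℚ ℚ.* total)
        ≡⟨ cong (λ k → inv 24 ℚ.* # 24 ℚ.* (k ℚ.* total)) (*-inv K) ⟨
      inv 24 ℚ.* # 24 ℚ.* (# K ℚ.* inv K ℚ.* total)
        ≡⟨ solveℚ 5 (λ i u k v x → i :* u :* (k :* v :* x) := i :* v :* (u :* k :* x)) refl (inv 24) (# 24) (# K) (inv K) total ⟩
      inv 24 ℚ.* inv K ℚ.* (# 24 ℚ.* # K ℚ.* total)
        ≡⟨ cong (inv 24 ℚ.* inv K ℚ.*_) scaled ⟩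
      inv 24 ℚ.* inv K ℚ.* (# K ℚ.* ⟦ D ⟧ ℚ.* E)
        ≡⟨ solveℚ 5 (λ i v k d e → i :* v :* (k :* d :* e) := k :* v :* (d :* i :* e)) refl (inv 24) (inv K) (# K) ⟦ D ⟧ E ⟩
      # K ℚ.* inv K ℚ.* (⟦ D ⟧ ℚ.* inv 24 ℚ.* E)
        ≡⟨ cong₂ (λ k d → k ℚ.* (d ℚ.* E)) (*-inv K) (sym (/-inv D 24)) ⟩
      1ℚ ℚ.* (D / 24 ℚ.* E)
        ≡⟨ ℚ.*-identityˡ _ ⟩
      D / 24 ℚ.* E ∎

-- The two parities of t

m+m≡m*2 : ∀ m → m ℕ.+ m ≡ m ℕ.* 2
m+m≡m*2 = ℕ-Ring.solve-∀

module Cases (𝕊 : Setting) where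
  open Cells 𝕊
  open CoreEnumeration 𝕊 using (cores)
  open Average 𝕊
  open WeightedSums S T η α
  open ClosedForms S T η α refl

  private
    ⟦S⟧ : ⟦ S ⟧ ≡ # n ℚ.+ (# ε ℚ.+ # n)
    ⟦S⟧ = trans (⟦⟧-+ (+ n) (+ ε + + n)) (cong (# n ℚ.+_) (⟦⟧-+ (+ ε) (+ n)))

    ⟦T⟧ : ⟦ T ⟧ ≡ # q ℚ.+ (# δ ℚ.+ # q)
    ⟦T⟧ = trans (⟦⟧-+ (+ q) (+ δ + + q)) (cong (# q ℚ.+_) (⟦⟧-+ (+ δ) (+ q)))

    ⟦η⟧ : ⟦ η ⟧ ≡ 1ℚ ℚ.+ # ε
    ⟦η⟧ = ⟦⟧-+ 1ℤ (+ ε)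

    ≤1 : ∀ {k} → k ℕ.≤ 1 → k ≡ 0 ⊎ k ≡ 1
    ≤1 z≤n       = inj₁ refl
    ≤1 (s≤s z≤n) = inj₂ refl

    t%2 : t % 2 ≡ δ
    t%2 = trans (cong (_% 2) (rearrange q δ)) (trans (ℕ.[m+kn]%n≡m%n δ q 2) (ℕ.m<n⇒m%n≡m (s≤s δ≤1)))
      where
      rearrange : ∀ q δ → q ℕ.+ (δ ℕ.+ q) ≡ δ ℕ.+ q ℕ.* 2
      rearrange = ℕ-Ring.solve-∀

    2h≢t : ∀ {h} → suc h ℕ.+ suc h ℕ.< t → free t (suc h) ≡ false
    2h≢t {h} l = free-false t (suc h) (λ ()) (ℕ.<⇒≢ l)

  average-odd : δ ≡ 1 → weightedAverageSize cores stabs ≡ ((S - + 1) * (T * T - + 1)) / 24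
  average-odd δ≡1 = average ((S - + 1) * (T * T - + 1)) 2a≡T (begin
    momentPolynomial ⟦ S ⟧ ⟦ T ⟧ ⟦ η ⟧ (# n) (a q) (M q) (N q)
      ≡⟨ cong₂ (λ a MN → momentPolynomial ⟦ S ⟧ ⟦ T ⟧ ⟦ η ⟧ (# n) a (proj₁ MN) (proj₂ MN)) (a-closed q ones)
           (cong₂ _,_ (M-closed q ones) (N-closed q ones)) ⟩
    lhs ⟦ S ⟧ ⟦ T ⟧ ⟦ η ⟧
      ≡⟨ cong₂ (λ S Tη → lhs S (proj₁ Tη) (proj₂ Tη)) ⟦S⟧ (cong₂ _,_ T≡ ⟦η⟧) ⟩
    lhs (# n ℚ.+ (# ε ℚ.+ # n)) (# q ℚ.+ (1ℚ ℚ.+ # q)) (1ℚ ℚ.+ # ε)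
      ≡⟨ moment-odd (# n) (# q) (# ε) (Sum.map (cong #) (cong #) (≤1 ε≤1)) ⟩
    rhs (# n ℚ.+ (# ε ℚ.+ # n)) (# q ℚ.+ (1ℚ ℚ.+ # q))
      ≡⟨ cong₂ rhs ⟦S⟧ T≡ ⟨
    rhs ⟦ S ⟧ ⟦ T ⟧
      ≡⟨ cong (⟦ T ⟧ ℚ.* ⟦ T ⟧ ℚ.* ⟦ S ⟧ ℚ.*_) (trans (⟦⟧-* (S - + 1) (T * T - + 1)) (cong₂ ℚ._*_ (⟦⟧-- S (+ 1))
           (trans (⟦⟧-- (T * T) (+ 1)) (cong (ℚ._- 1ℚ) (⟦⟧-* T T))))) ⟨
    ⟦ T ⟧ ℚ.* ⟦ T ⟧ ℚ.* ⟦ S ⟧ ℚ.* ⟦ (S - + 1) * (T * T - + 1) ⟧ ∎)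
    where
    open ≡-Reasoning
    lhs : ℚ → ℚ → ℚ → ℚ
    lhs S T η = momentPolynomial S T η (# n) (# q ℚ.+ ½) (closedM S T η (# q)) (closedN S T η (# q))
    rhs : ℚ → ℚ → ℚ
    rhs S T = T ℚ.* T ℚ.* S ℚ.* ((S ℚ.- 1ℚ) ℚ.* (T ℚ.* T ℚ.- 1ℚ))
    -- For odd t every value 0 < h ≤ q satisfies 2 h < t, so only h = 0 admits signs.
    ones : Ones q
    ones {h} h<q = cong signWeight (2h≢t (ℕ.≤-<-trans (ℕ.+-mono-≤ h<q h<q)
      (ℕ.+-monoʳ-< q (subst (λ d → q ℕ.< d ℕ.+ q) (sym δ≡1) ℕ.≤-refl))))
    T≡ : ⟦ T ⟧ ≡ # q ℚ.+ (1ℚ ℚ.+ # q)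
    T≡ = trans ⟦T⟧ (cong (λ d → # q ℚ.+ (# d ℚ.+ # q)) δ≡1)
    2a≡T : a q ℚ.+ a q ≡ ⟦ T ⟧
    2a≡T = trans (cong (λ a → a ℚ.+ a) (a-closed q ones)) (trans
      (solveℚ 1 (λ q → q :+ con ½ :+ (q :+ con ½) := q :+ (con 1ℚ :+ q)) refl (# q)) (sym T≡))

  average-even : ∀ m → q ≡ suc m → δ ≡ 0 → ε ≡ 1 →
                 weightedAverageSize cores stabs ≡ ((S - + 1) * (T * T + + 2)) / 24
  average-even m q≡ δ≡0 ε≡1 = average ((S - + 1) * (T * T + + 2)) 2a≡T (begin
    momentPolynomial ⟦ S ⟧ ⟦ T ⟧ ⟦ η ⟧ (# n) (a q) (M q) (N q)
      ≡⟨ cong₂ (λ a MN → momentPolynomial ⟦ S ⟧ ⟦ T ⟧ ⟦ η ⟧ (# n) a (proj₁ MN) (proj₂ MN)) a≡ (cong₂ _,_ M≡ N≡) ⟩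
    lhs ⟦ S ⟧ ⟦ T ⟧ ⟦ η ⟧
      ≡⟨ cong₂ (λ S Tη → lhs S (proj₁ Tη) (proj₂ Tη)) S≡ (cong₂ _,_ T≡ η≡) ⟩
    lhs (# n ℚ.+ (1ℚ ℚ.+ # n)) (q′ ℚ.+ (0ℚ ℚ.+ q′)) (1ℚ ℚ.+ 1ℚ)
      ≡⟨ moment-even (# n) (# m) ⟩
    rhs (# n ℚ.+ (1ℚ ℚ.+ # n)) (q′ ℚ.+ (0ℚ ℚ.+ q′))
      ≡⟨ cong₂ rhs S≡ T≡ ⟨
    rhs ⟦ S ⟧ ⟦ T ⟧
      ≡⟨ cong (⟦ T ⟧ ℚ.* ⟦ T ⟧ ℚ.* ⟦ S ⟧ ℚ.*_) (trans (⟦⟧-* (S - + 1) (T * T + + 2)) (cong₂ ℚ._*_ (⟦⟧-- S (+ 1))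
           (trans (⟦⟧-+ (T * T) (+ 2)) (cong (ℚ._+ # 2) (⟦⟧-* T T))))) ⟨
    ⟦ T ⟧ ℚ.* ⟦ T ⟧ ℚ.* ⟦ S ⟧ ℚ.* ⟦ (S - + 1) * (T * T + + 2) ⟧ ∎)
    where
    open ≡-Reasoning
    q′ = 1ℚ ℚ.+ # m
    lhs : ℚ → ℚ → ℚ → ℚ
    lhs S T η = momentPolynomial S T η (# n) (½ ℚ.+ (# m ℚ.+ ½)) (closedM S T η (# m) ℚ.+ linCoeffℚ S T η q′ ℚ.* ½)
      (closedN S T η (# m) ℚ.+ quadCoeffℚ S T η q′ ℚ.* (# 2 ℚ.* ½ ℚ.* (# m ℚ.+ ½) ℚ.+ ½ ℚ.* ½))
    rhs : ℚ → ℚ → ℚ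
    rhs S T = T ℚ.* T ℚ.* S ℚ.* ((S ℚ.- 1ℚ) ℚ.* (T ℚ.* T ℚ.+ # 2))
    t≡ : suc m ℕ.+ suc m ≡ t
    t≡ = trans (cong₂ ℕ._+_ (sym q≡) (sym q≡)) (cong (λ d → q ℕ.+ (d ℕ.+ q)) (sym δ≡0))
    ones : Ones m
    ones {h} h<m = cong signWeight (2h≢t (subst (suc h ℕ.+ suc h ℕ.<_) t≡
      (s≤s (ℕ.+-mono-≤ h<m (ℕ.m≤n⇒m≤1+n h<m)))))
    -- For even t the greatest value h = q satisfies 2 h = t and admits signs as h = 0 does.
    α-last : α (suc m) ≡ ½
    α-last = cong signWeight (dec-true (free? t (suc m)) (inj₂ t≡))
    a≡ : a q ≡ ½ ℚ.+ (# m ℚ.+ ½)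
    a≡ = trans (cong a q≡) (cong₂ ℚ._+_ α-last (a-closed m ones))
    M≡ : M q ≡ M* (# m) ℚ.+ linear q′ ℚ.* ½
    M≡ = trans (cong M q≡) (trans (M-step m)
      (cong₂ (λ x y → x ℚ.+ linear q′ ℚ.* y) (M-closed m ones) α-last))
    N≡ : N q ≡ N* (# m) ℚ.+ quadratic q′ ℚ.*
                 (# 2 ℚ.* ½ ℚ.* (# m ℚ.+ ½) ℚ.+ ½ ℚ.* ½)
    N≡ = trans (cong N q≡) (trans (N-step m)
      (cong₂ (λ x y → x ℚ.+ quadratic q′ ℚ.* y) (N-closed m ones)
        (cong₂ (λ α a → # 2 ℚ.* α ℚ.* a ℚ.+ α ℚ.* α) α-last (a-closed m ones))))
    S≡ : ⟦ S ⟧ ≡ # n ℚ.+ (1ℚ ℚ.+ # n)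
    S≡ = trans ⟦S⟧ (cong (λ e → # n ℚ.+ (# e ℚ.+ # n)) ε≡1)
    #q≡ : # q ≡ q′
    #q≡ = trans (cong # q≡) (#-suc m)
    T≡ : ⟦ T ⟧ ≡ q′ ℚ.+ (0ℚ ℚ.+ q′)
    T≡ = trans ⟦T⟧ (cong₂ (λ d q → q ℚ.+ (# d ℚ.+ q)) δ≡0 #q≡)
    η≡ : ⟦ η ⟧ ≡ 1ℚ ℚ.+ 1ℚ
    η≡ = trans ⟦η⟧ (cong (λ e → 1ℚ ℚ.+ # e) ε≡1)
    2a≡T : a q ℚ.+ a q ≡ ⟦ T ⟧
    2a≡T = trans (cong (λ a → a ℚ.+ a) a≡) (trans
      (solveℚ 1 (λ m → con ½ :+ (m :+ con ½) :+ (con ½ :+ (m :+ con ½)) :=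
        con 1ℚ :+ m :+ (con 0ℚ :+ (con 1ℚ :+ m))) refl (# m)) (sym T≡))

  theorem : Σ[ cores ∈ Finite (𝒟∩𝒟 s t) ]
            Σ[ stabs ∈ FiniteStabs s t ]
            (t % 2 ≡ 1 → weightedAverageSize cores stabs ≡ ((+ s - + 1) * (+ t * + t - + 1)) / 24)
            × (t % 2 ≡ 0 → weightedAverageSize cores stabs ≡ ((+ s - + 1) * (+ t * + t + + 2)) / 24)
  theorem = cores , stabs , (λ odd → average-odd (trans (sym t%2) odd)) , λ even → evenCase (trans (sym t%2) even)
    where
    2∣double : ∀ {k} → k ≡ 0 → ∀ m → 2 ℕ∣.∣ m ℕ.+ (k ℕ.+ m)
    2∣double refl m = ℕ∣.divides m (m+m≡m*2 m)

    predecessor : δ ≡ 0 → Σ[ m ∈ ℕ ] q ≡ suc m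
    predecessor δ≡0 with q in q≡
    ... | suc m = m , refl
    ... | zero  = contradiction (trans (cong₂ (λ q d → q ℕ.+ (d ℕ.+ q)) q≡ δ≡0) refl) (ℕ.≢-nonZero⁻¹ t)

    -- If s were even too, 2 would be a common divisor of s and t.
    ε≡1 : δ ≡ 0 → ε ≡ 1
    ε≡1 δ≡0 = [ (λ ε≡0 → contradiction (coprime (2∣double ε≡0 n , 2∣double δ≡0 q)) λ ()) , id ]′ (≤1 ε≤1)

    evenCase : δ ≡ 0 → weightedAverageSize cores stabs ≡ ((+ s - + 1) * (+ t * + t + + 2)) / 24
    evenCase δ≡0 = average-even (proj₁ (predecessor δ≡0)) (proj₂ (predecessor δ≡0)) δ≡0 (ε≡1 δ≡0)

halve : ∀ s → Σ[ n ∈ ℕ ] Σ[ ε ∈ ℕ ] (ε ℕ.≤ 1 × s ≡ n ℕ.+ (ε ℕ.+ n))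
halve s = s ℕ./ 2 , s % 2 , ℕ.s≤s⁻¹ (ℕ.m%n<n s 2) ,
  trans (ℕ.m≡m%n+[m/n]*n s 2) (rearrange (s % 2) (s ℕ./ 2))
  where
  rearrange : ∀ r k → r ℕ.+ k ℕ.* 2 ≡ k ℕ.+ (r ℕ.+ k)
  rearrange = ℕ-Ring.solve-∀

-- If s = 2 n + 1 the factor s - 1 is halved, and if t = 2 q + 1 the factor t + 1 is; both numbers
-- being even contradicts coprimality.
half-centre : ∀ n ε q δ → ε ℕ.≤ 1 → δ ℕ.≤ 1 → Coprime (n ℕ.+ (ε ℕ.+ n)) (q ℕ.+ (δ ℕ.+ q)) →
              Σ[ c ∈ ℤ ] c + c ≡ (+ (n ℕ.+ (ε ℕ.+ n)) - 1ℤ) * (+ (q ℕ.+ (δ ℕ.+ q)) + 1ℤ)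
half-centre n 1 q δ (s≤s z≤n) _ _ = + n * (+ (q ℕ.+ (δ ℕ.+ q)) + 1ℤ) , solve (+ n) (+ (q ℕ.+ (δ ℕ.+ q)))
  where
  solve : ∀ n t → n * (t + 1ℤ) + n * (t + 1ℤ) ≡ (n + (1ℤ + n) - 1ℤ) * (t + 1ℤ)
  solve = solve-∀
half-centre n 0 q 1 z≤n (s≤s z≤n) _ = (+ (n ℕ.+ n) - 1ℤ) * (+ q + 1ℤ) , solve (+ (n ℕ.+ n)) (+ q)
  where
  solve : ∀ s q → (s - 1ℤ) * (q + 1ℤ) + (s - 1ℤ) * (q + 1ℤ) ≡ (s - 1ℤ) * (q + (1ℤ + q) + 1ℤ)
  solve = solve-∀
half-centre n 0 q 0 z≤n z≤n coprime =
  contradiction (coprime (ℕ∣.divides n (m+m≡m*2 n) , ℕ∣.divides q (m+m≡m*2 q))) λ ()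

Claim : ℕ → ℕ → Set
Claim s t =
  Σ[ cores ∈ Finite (𝒟∩𝒟 s t) ]
  Σ[ stabs ∈ FiniteStabs s t ]
  (t % 2 ≡ 1 → weightedAverageSize cores stabs ≡ ((+ s - + 1) * (+ t * + t - + 1)) / 24)
  × (t % 2 ≡ 0 → weightedAverageSize cores stabs ≡ ((+ s - + 1) * (+ t * + t + + 2)) / 24)

claim-halves : ∀ n ε q δ → ε ℕ.≤ 1 → δ ℕ.≤ 1 → NonZero (n ℕ.+ (ε ℕ.+ n)) → NonZero (q ℕ.+ (δ ℕ.+ q)) →
               Coprime (n ℕ.+ (ε ℕ.+ n)) (q ℕ.+ (δ ℕ.+ q)) → Claim (n ℕ.+ (ε ℕ.+ n)) (q ℕ.+ (δ ℕ.+ q))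
claim-halves n ε q δ ε≤1 δ≤1 s≢0 t≢0 coprime = Cases.theorem record
  { n = n ; ε = ε ; q = q ; δ = δ ; ε≤1 = ε≤1 ; δ≤1 = δ≤1
  ; s-nonZero = s≢0 ; t-nonZero = t≢0 ; coprime = coprime
  ; c = proj₁ centre ; c+c = proj₂ centre
  ; τ = proj₁ inverse ; g = proj₁ (proj₂ inverse) ; τ*t = proj₂ (proj₂ inverse) }
  where
  centre = half-centre n ε q δ ε≤1 δ≤1 coprime
  inverse = bezout coprime

claim : ∀ s t → s ≢ 0 → t ≢ 0 → Coprime s t → Claim s t
claim s t s≢0 t≢0 coprime with halve s | halve t
... | n , ε , ε≤1 , refl | q , δ , δ≤1 , refl =
  claim-halves n ε q δ ε≤1 δ≤1 (ℕ.≢-nonZero s≢0) (ℕ.≢-nonZero t≢0) coprime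

theorem1p4 : (s t : ℕ) .{{_ : NonZero s}} .{{_ : NonZero t}} → Coprime s t →
    Σ[ cores ∈ Finite (𝒟∩𝒟 s t) ]
    Σ[ stabs ∈ FiniteStabs s t ]
    (t % 2 ≡ 1 → weightedAverageSize cores stabs ≡ ((+ s - + 1) * (+ t * + t - + 1)) / 24)
    × (t % 2 ≡ 0 → weightedAverageSize cores stabs ≡ ((+ s - + 1) * (+ t * + t + + 2)) / 24)
theorem1p4 s t = claim s t (ℕ.≢-nonZero⁻¹ s) (ℕ.≢-nonZero⁻¹ t)
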